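{- Let $\beta>1$ be a simple Parry number with Rényi expansion of unity $d_\beta(1)=t_1t_2\cdots t_m$, $m\ge 2$, and let $u_\beta$ be the fixed point of the canonical substitution $\varphi$ associated with $\beta$. Then the factor complexity $\mathcal C$ of $u_\beta$ is an affine function (i.e. there are constants $a,b$ with $\mathcal C(n)=an+b$ for all $n\in\mathbb N$) if and only if both of the following hold: 1) $t_m=1$; 2) either $t_1\cdots t_{m-1}=w^k$ for some word $w$ and some integer $k\ge 2$, or no non-empty word is simultaneously a proper prefix and a proper suffix of the word $t_1t_2\cdots t_{m-1}$.
   Context: A simple Parry number is a real $\beta>1$ whose Rényi expansion of $1$ is finite: $d_\beta(1)=t_1\cdots t_m$ with nonnegative integer digits, $t_1=\lfloor\beta\rfloor\ge1$, $t_m\ge1$, $1=\sum_{i=1}^m t_i\beta^{ -i}$. The digits satisfy the Parry condition: $t_it_{i+1}\cdots t_m0^\omega$ is lexicographically strictly smaller than $t_1\cdots t_m0^\omega$ for every $2\le i\le m$ (in particular $t_1\ge t_i$ for all $i$). The canonical substitution on the alphabet $\mathcal A=\{0,1,\dots,m-1\}$ is $\varphi(k)=0^{t_{k+1}}(k+1)$ for $0\le k\le m-2$ and $\varphi(m-1)=0^{t_m}$; it is primitive and $u_\beta=\lim_{n\to\infty}\varphi^n(0)$ is its unique fixed point. The factor complexity is $\mathcal C(n)=$ the number of distinct factors (finite contiguous subwords) of $u_\beta$ of length $n$. Words here are finite sequences of digits; $w^k$ denotes the concatenation of $k$ copies of $w$. -}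

module Defs where

open import Algebra.Bundles using (CommutativeMonoid)
import Algebra.Properties.CommutativeSemigroup as CommutativeSemigroupProperties
open import Data.Fin.Base using (Fin; zero; suc; toℕ; inject₁)
open import Data.Fin.Relation.Unary.Top using (view; ‵fromℕ; ‵inject₁)
open import Data.Integer.Base as ℤ using (ℤ; +_)
open import Data.List.Base as List using (List; []; _∷_; _++_; [_]; concat; concatMap; drop; head; length)
open import Data.List.Membership.Propositional using (_∈_)
open import Data.List.Relation.Binary.Prefix.Heterogeneous using (Prefix)
open import Data.List.Relation.Binary.Suffix.Heterogeneous using (Suffix)
open import Data.List.Relation.Unary.Unique.Propositional using (Unique)
open import Data.Maybe.Base using (just)
open import Data.Nat.Base as ℕ using (ℕ; zero; suc)
open import Data.Nat.GeneralisedArithmetic using (fold)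
import Data.Nat.Properties as ℕ
open import Data.Product.Base using (Σ; ∃; ∃₂; _×_; _,_; proj₁; proj₂)
open import Data.Rational.Base as ℚ using (ℚ; 0ℚ; 1ℚ; ½; ∣_∣; Positive; NonNegative; NonZero)
import Data.Rational.Properties as ℚ
open import Data.Vec.Base as Vec using (Vec; toList; init; last; tabulate)
open import Function.Bundles using (_⇔_)
open import Relation.Binary.PropositionalEquality using (_≡_; _≢_; refl; sym; trans; cong; cong₂; subst; module ≡-Reasoning)
open import Relation.Nullary using (¬_)

------------------------------------------------------------------------
-- Real numbers as Cauchy sequences of rationals. The operations are
-- termwise, and equality of reals is the relation x ≤ y × y ≤ x.

IsCauchy : (ℕ → ℚ) → Set
IsCauchy x = ∀ ε → Positive ε →
  ∃ λ N → ∀ i j → N ℕ.≤ i → N ℕ.≤ j → ∣ x i ℚ.- x j ∣ ℚ.≤ ε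

record ℝ : Set where
  constructor mkℝ
  field
    approx   : ℕ → ℚ
    isCauchy : IsCauchy approx

open ℝ public

private
  open CommutativeSemigroupProperties (CommutativeMonoid.commutativeSemigroup ℚ.+-0-commutativeMonoid)
    using (interchange)

  sub-interchange : ∀ a b c d → (a ℚ.- b) ℚ.- (c ℚ.- d) ≡ (a ℚ.- c) ℚ.- (b ℚ.- d)
  sub-interchange a b c d = begin
    (a ℚ.- b) ℚ.- (c ℚ.- d)               ≡⟨ cong ((a ℚ.- b) ℚ.+_) (ℚ.neg-distrib-+ c (ℚ.- d)) ⟩
    (a ℚ.- b) ℚ.+ (ℚ.- c ℚ.- (ℚ.- d))     ≡⟨ interchange a (ℚ.- b) (ℚ.- c) (ℚ.- (ℚ.- d)) ⟩
    (a ℚ.- c) ℚ.+ (ℚ.- b ℚ.- (ℚ.- d))     ≡⟨ cong ((a ℚ.- c) ℚ.+_) (ℚ.neg-distrib-+ b (ℚ.- d)) ⟨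
    (a ℚ.- c) ℚ.- (b ℚ.- d)               ∎
    where open ≡-Reasoning

  sub-cancel : ∀ a b c → (a ℚ.- b) ℚ.+ (b ℚ.+ c) ≡ a ℚ.+ c
  sub-cancel a b c = begin
    (a ℚ.- b) ℚ.+ (b ℚ.+ c)       ≡⟨ ℚ.+-assoc a (ℚ.- b) (b ℚ.+ c) ⟩
    a ℚ.+ (ℚ.- b ℚ.+ (b ℚ.+ c))   ≡⟨ cong (a ℚ.+_) (ℚ.+-assoc (ℚ.- b) b c) ⟨
    a ℚ.+ ((ℚ.- b ℚ.+ b) ℚ.+ c)   ≡⟨ cong (λ z → a ℚ.+ (z ℚ.+ c)) (ℚ.+-inverseˡ b) ⟩
    a ℚ.+ (0ℚ ℚ.+ c)              ≡⟨ cong (a ℚ.+_) (ℚ.+-identityˡ c) ⟩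
    a ℚ.+ c                       ∎
    where open ≡-Reasoning

  mul-sub : ∀ a b c d → a ℚ.* b ℚ.- c ℚ.* d ≡ a ℚ.* (b ℚ.- d) ℚ.+ d ℚ.* (a ℚ.- c)
  mul-sub a b c d = begin
    a ℚ.* b ℚ.- c ℚ.* d
      ≡⟨ sub-cancel (a ℚ.* b) (a ℚ.* d) (ℚ.- (c ℚ.* d)) ⟨
    (a ℚ.* b ℚ.- a ℚ.* d) ℚ.+ (a ℚ.* d ℚ.- c ℚ.* d)
      ≡⟨ cong₂ ℚ._+_
           (trans (cong (a ℚ.* b ℚ.+_) (ℚ.neg-distribʳ-* a d)) (sym (ℚ.*-distribˡ-+ a b (ℚ.- d))))
           (trans (cong (a ℚ.* d ℚ.+_) (ℚ.neg-distribˡ-* c d)) (sym (ℚ.*-distribʳ-+ d a (ℚ.- c)))) ⟩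
    a ℚ.* (b ℚ.- d) ℚ.+ (a ℚ.- c) ℚ.* d
      ≡⟨ cong (a ℚ.* (b ℚ.- d) ℚ.+_) (ℚ.*-comm (a ℚ.- c) d) ⟩
    a ℚ.* (b ℚ.- d) ℚ.+ d ℚ.* (a ℚ.- c) ∎
    where open ≡-Reasoning

  const-cauchy : ∀ q → IsCauchy (λ _ → q)
  const-cauchy q ε ε>0 = 0 , λ _ _ _ _ → begin
    ∣ q ℚ.- q ∣  ≡⟨ cong ∣_∣ (ℚ.+-inverseʳ q) ⟩
    0ℚ           <⟨ ℚ.positive⁻¹ ε {{ε>0}} ⟩
    ε            ∎
    where open ℚ.≤-Reasoning

  sub-cauchy : ∀ x y → IsCauchy x → IsCauchy y → IsCauchy (λ n → x n ℚ.- y n)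
  sub-cauchy x y cx cy ε ε>0 =
    let δ>0     = ℚ.pos*pos⇒pos ε {{ε>0}} ½
        (N , p) = cx (ε ℚ.* ½) δ>0
        (M , q) = cy (ε ℚ.* ½) δ>0
    in N ℕ.⊔ M , λ i j N⊔M≤i N⊔M≤j → begin
      ∣ (x i ℚ.- y i) ℚ.- (x j ℚ.- y j) ∣
        ≡⟨ cong ∣_∣ (sub-interchange (x i) (y i) (x j) (y j)) ⟩
      ∣ (x i ℚ.- x j) ℚ.- (y i ℚ.- y j) ∣
        ≤⟨ ℚ.∣p-q∣≤∣p∣+∣q∣ (x i ℚ.- x j) (y i ℚ.- y j) ⟩
      ∣ x i ℚ.- x j ∣ ℚ.+ ∣ y i ℚ.- y j ∣
        ≤⟨ ℚ.+-mono-≤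
             (p i j (ℕ.m⊔n≤o⇒m≤o N M N⊔M≤i) (ℕ.m⊔n≤o⇒m≤o N M N⊔M≤j))
             (q i j (ℕ.m⊔n≤o⇒n≤o N M N⊔M≤i) (ℕ.m⊔n≤o⇒n≤o N M N⊔M≤j)) ⟩
      ε ℚ.* ½ ℚ.+ ε ℚ.* ½
        ≡⟨ ℚ.*-distribˡ-+ ε ½ ½ ⟨
      ε ℚ.* 1ℚ
        ≡⟨ ℚ.*-identityʳ ε ⟩
      ε ∎
    where open ℚ.≤-Reasoning

  bounded : ∀ x → IsCauchy x →
    ∃₂ λ N B → Positive B × (∀ i → N ℕ.≤ i → ∣ x i ∣ ℚ.≤ B)
  bounded x cx =
    let (N , p) = cx 1ℚ _
    in N , 1ℚ ℚ.+ ∣ x N ∣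
         , ℚ.pos+nonNeg⇒pos 1ℚ ∣ x N ∣ {{ℚ.∣-∣-nonNeg (x N)}}
         , λ i N≤i → begin
           ∣ x i ∣
             ≡⟨ cong ∣_∣ (trans (sub-cancel (x i) (x N) 0ℚ) (ℚ.+-identityʳ (x i))) ⟨
           ∣ (x i ℚ.- x N) ℚ.+ (x N ℚ.+ 0ℚ) ∣
             ≡⟨ cong (λ z → ∣ (x i ℚ.- x N) ℚ.+ z ∣) (ℚ.+-identityʳ (x N)) ⟩
           ∣ (x i ℚ.- x N) ℚ.+ x N ∣
             ≤⟨ ℚ.∣p+q∣≤∣p∣+∣q∣ (x i ℚ.- x N) (x N) ⟩
           ∣ x i ℚ.- x N ∣ ℚ.+ ∣ x N ∣
             ≤⟨ ℚ.+-monoˡ-≤ ∣ x N ∣ (p i N N≤i ℕ.≤-refl) ⟩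
           1ℚ ℚ.+ ∣ x N ∣ ∎
    where open ℚ.≤-Reasoning

  *-mono : ∀ {a b c d} → NonNegative a → NonNegative d →
           a ℚ.≤ b → c ℚ.≤ d → a ℚ.* c ℚ.≤ b ℚ.* d
  *-mono {a} {b} {c} {d} a≥0 d≥0 a≤b c≤d = ℚ.≤-trans
    (ℚ.*-monoˡ-≤-nonNeg a {{a≥0}} c≤d) (ℚ.*-monoʳ-≤-nonNeg d {{d≥0}} a≤b)

  mul-cauchy : ∀ x y → IsCauchy x → IsCauchy y → IsCauchy (λ n → x n ℚ.* y n)
  mul-cauchy x y cx cy ε ε>0 = (K ℕ.⊔ L) ℕ.⊔ (N ℕ.⊔ M) , λ i j h k → begin
      ∣ x i ℚ.* y i ℚ.- x j ℚ.* y j ∣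
        ≡⟨ cong ∣_∣ (mul-sub (x i) (y i) (x j) (y j)) ⟩
      ∣ x i ℚ.* (y i ℚ.- y j) ℚ.+ y j ℚ.* (x i ℚ.- x j) ∣
        ≤⟨ ℚ.∣p+q∣≤∣p∣+∣q∣ (x i ℚ.* (y i ℚ.- y j)) (y j ℚ.* (x i ℚ.- x j)) ⟩
      ∣ x i ℚ.* (y i ℚ.- y j) ∣ ℚ.+ ∣ y j ℚ.* (x i ℚ.- x j) ∣
        ≤⟨ ℚ.+-mono-≤
             (bound (x i) _ (x≤A i (K≤ h)) (q i j (M≤ h) (M≤ k)))
             (bound (y j) _ (y≤B j (L≤ k)) (p i j (N≤ h) (N≤ k))) ⟩
      A ℚ.* δ ℚ.+ B ℚ.* δ
        ≡⟨ ℚ.*-distribʳ-+ δ A B ⟨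
      (A ℚ.+ B) ℚ.* δ
        ≡⟨ ℚ.*-assoc (A ℚ.+ B) r ε ⟨
      ((A ℚ.+ B) ℚ.* r) ℚ.* ε
        ≡⟨ cong (ℚ._* ε) (ℚ.*-inverseʳ (A ℚ.+ B) {{A+B≢0}}) ⟩
      1ℚ ℚ.* ε
        ≡⟨ ℚ.*-identityˡ ε ⟩
      ε ∎
    where
    K L : ℕ
    A B : ℚ
    K = proj₁ (bounded x cx)
    A = proj₁ (proj₂ (bounded x cx))
    L = proj₁ (bounded y cy)
    B = proj₁ (proj₂ (bounded y cy))
    A>0 : Positive A
    A>0 = proj₁ (proj₂ (proj₂ (bounded x cx)))
    B>0 : Positive B
    B>0 = proj₁ (proj₂ (proj₂ (bounded y cy)))
    x≤A : ∀ i → K ℕ.≤ i → ∣ x i ∣ ℚ.≤ A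
    x≤A = proj₂ (proj₂ (proj₂ (bounded x cx)))
    y≤B : ∀ i → L ℕ.≤ i → ∣ y i ∣ ℚ.≤ B
    y≤B = proj₂ (proj₂ (proj₂ (bounded y cy)))
    open ℚ.≤-Reasoning
    A+B>0 : Positive (A ℚ.+ B)
    A+B>0 = ℚ.pos+pos⇒pos A {{A>0}} B {{B>0}}
    A+B≢0 : NonZero (A ℚ.+ B)
    A+B≢0 = ℚ.pos⇒nonZero (A ℚ.+ B) {{A+B>0}}
    r δ : ℚ
    r = (ℚ.1/ (A ℚ.+ B)) {{A+B≢0}}
    δ = r ℚ.* ε
    δ>0 : Positive δ
    δ>0 = ℚ.pos*pos⇒pos r {{ℚ.1/pos⇒pos (A ℚ.+ B) {{A+B>0}}}} ε {{ε>0}}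
    δ≥0 : NonNegative δ
    δ≥0 = ℚ.pos⇒nonNeg δ {{δ>0}}
    N M : ℕ
    N = proj₁ (cx δ δ>0)
    M = proj₁ (cy δ δ>0)
    p : ∀ i j → N ℕ.≤ i → N ℕ.≤ j → ∣ x i ℚ.- x j ∣ ℚ.≤ δ
    p = proj₂ (cx δ δ>0)
    q : ∀ i j → M ℕ.≤ i → M ℕ.≤ j → ∣ y i ℚ.- y j ∣ ℚ.≤ δ
    q = proj₂ (cy δ δ>0)
    bound : ∀ {C} a b → ∣ a ∣ ℚ.≤ C → ∣ b ∣ ℚ.≤ δ → ∣ a ℚ.* b ∣ ℚ.≤ C ℚ.* δ
    bound a b a≤C b≤δ = subst (ℚ._≤ _) (sym (ℚ.∣p*q∣≡∣p∣*∣q∣ a b))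
      (*-mono (ℚ.∣-∣-nonNeg a) δ≥0 a≤C b≤δ)
    KL≤ : ∀ {i} → (K ℕ.⊔ L) ℕ.⊔ (N ℕ.⊔ M) ℕ.≤ i → K ℕ.⊔ L ℕ.≤ i
    KL≤ = ℕ.m⊔n≤o⇒m≤o (K ℕ.⊔ L) (N ℕ.⊔ M)
    NM≤ : ∀ {i} → (K ℕ.⊔ L) ℕ.⊔ (N ℕ.⊔ M) ℕ.≤ i → N ℕ.⊔ M ℕ.≤ i
    NM≤ = ℕ.m⊔n≤o⇒n≤o (K ℕ.⊔ L) (N ℕ.⊔ M)
    K≤ : ∀ {i} → (K ℕ.⊔ L) ℕ.⊔ (N ℕ.⊔ M) ℕ.≤ i → K ℕ.≤ i
    K≤ h = ℕ.m⊔n≤o⇒m≤o K L (KL≤ h)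
    L≤ : ∀ {i} → (K ℕ.⊔ L) ℕ.⊔ (N ℕ.⊔ M) ℕ.≤ i → L ℕ.≤ i
    L≤ h = ℕ.m⊔n≤o⇒n≤o K L (KL≤ h)
    N≤ : ∀ {i} → (K ℕ.⊔ L) ℕ.⊔ (N ℕ.⊔ M) ℕ.≤ i → N ℕ.≤ i
    N≤ h = ℕ.m⊔n≤o⇒m≤o N M (NM≤ h)
    M≤ : ∀ {i} → (K ℕ.⊔ L) ℕ.⊔ (N ℕ.⊔ M) ℕ.≤ i → M ℕ.≤ i
    M≤ h = ℕ.m⊔n≤o⇒n≤o N M (NM≤ h)

infix  4 _<ᴿ_ _≤ᴿ_
infixl 6 _-ᴿ_
infixl 7 _*ᴿ_

fromℕᴿ : ℕ → ℝ
fromℕᴿ n = mkℝ (λ _ → + n ℚ./ 1) (const-cauchy (+ n ℚ./ 1))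

_-ᴿ_ : ℝ → ℝ → ℝ
x -ᴿ y = mkℝ (λ n → approx x n ℚ.- approx y n) (sub-cauchy (approx x) (approx y) (isCauchy x) (isCauchy y))

_*ᴿ_ : ℝ → ℝ → ℝ
x *ᴿ y = mkℝ (λ n → approx x n ℚ.* approx y n) (mul-cauchy (approx x) (approx y) (isCauchy x) (isCauchy y))

_<ᴿ_ : ℝ → ℝ → Set
x <ᴿ y = ∃₂ λ ε N → Positive ε × (∀ i → N ℕ.≤ i → approx x i ℚ.+ ε ℚ.≤ approx y i)

_≤ᴿ_ : ℝ → ℝ → Set
x ≤ᴿ y = ¬ (y <ᴿ x)

------------------------------------------------------------------------
-- Rényi expansion of unity

IsFloor : ℝ → ℕ → Set
IsFloor x k = (fromℕᴿ k ≤ᴿ x) × (x <ᴿ fromℕᴿ (suc k))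

digit : List ℕ → ℕ → ℕ
digit []       _       = 0
digit (d ∷ _)  zero    = d
digit (_ ∷ ds) (suc i) = digit ds i

-- With T(x) = βx - ⌊βx⌋, this is Tⁱ(1) provided that digit ds j = ⌊β Tʲ(1)⌋
-- for all j < i, as is required in IsRényiExpansion.
remainder : ℝ → List ℕ → ℕ → ℝ
remainder β ds zero    = fromℕᴿ 1
remainder β ds (suc i) = (β *ᴿ remainder β ds i) -ᴿ fromℕᴿ (digit ds i)

-- d_β(1) = t₁t₂⋯t_m with m = suc n: the (i+1)-st digit of the expansion is
-- ⌊β Tⁱ(1)⌋, the digits after t_m are all 0, and t_m ≠ 0.
record IsRényiExpansion (β : ℝ) {n : ℕ} (t : Vec ℕ (suc n)) : Set where
  field
    floors  : ∀ i → IsFloor (β *ᴿ remainder β (toList t) i) (digit (toList t) i)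
    lastPos : 1 ℕ.≤ last t

------------------------------------------------------------------------
-- The canonical substitution and its fixed point

-- The letters 0, …, m-1 are the elements of Fin (suc n), with m = suc n.
φ : ∀ {n} → Vec ℕ (suc n) → Fin (suc n) → List (Fin (suc n))
φ t k with view k
... | ‵inject₁ j = List.replicate (Vec.lookup t (inject₁ j)) zero ++ [ suc j ]
... | ‵fromℕ     = List.replicate (last t) zero

φ^_[0] : ∀ {n} → ℕ → Vec ℕ (suc n) → List (Fin (suc n))
φ^ k [0] t = fold [ zero ] (concatMap (φ t)) k

-- The finite words converge letter by letter to the infinite word.
_⟶_ : ∀ {A : Set} → (ℕ → List A) → (ℕ → A) → Set
w ⟶ u = ∀ i → ∃ λ N → ∀ k → N ℕ.≤ k → head (drop i (w k)) ≡ just (u i)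

IsFixedPointWord : ∀ {n} → Vec ℕ (suc n) → (ℕ → Fin (suc n)) → Set
IsFixedPointWord t u = (λ k → φ^ k [0] t) ⟶ u

------------------------------------------------------------------------
-- Factor complexity

IsFactor : ∀ {A : Set} {l} → (ℕ → A) → Vec A l → Set
IsFactor {l = l} u w = ∃ λ i → w ≡ tabulate {n = l} (λ j → u (i ℕ.+ toℕ j))

HasCardinality : ∀ {A : Set} → (A → Set) → ℕ → Set
HasCardinality {A} P c = Σ (List A) λ xs →
  Unique xs × length xs ≡ c × (∀ x → x ∈ xs ⇔ P x)

IsFactorComplexity : ∀ {A : Set} → (ℕ → A) → (ℕ → ℕ) → Set
IsFactorComplexity {A} u C = ∀ l → HasCardinality {Vec A l} (IsFactor u) (C l)

-- Integer constants lose no generality: a = C 1 - C 0 and b = C 0 are forced.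
IsAffine : (ℕ → ℕ) → Set
IsAffine C = ∃₂ λ (a b : ℤ) → ∀ l → + C l ≡ a ℤ.* + l ℤ.+ b

------------------------------------------------------------------------
-- Words

_^ʷ_ : ∀ {A : Set} → List A → ℕ → List A
w ^ʷ k = concat (List.replicate k w)

ProperPrefix ProperSuffix : ∀ {A : Set} → List A → List A → Set
ProperPrefix v w = Prefix _≡_ v w × v ≢ w
ProperSuffix v w = Suffix _≡_ v w × v ≢ w

{-# OPTIONS --safe #-}

-- Write p = m - 1 and let u be the fixed point. The last letters of φ(0), …, φ(p) are
-- pairwise distinct, so every prefix of u extends to the left by all m letters. Hence
-- C(l + 1) - C(l) ≥ p, with equality for all l exactly when prefixes are the only left
-- special factors, and C is affine if and only if this holds.
--
-- If t_m ≥ 2, then 0^(t₁+1) is left special, while u starts with 0^(t₁)1. If t_m = 1, suppose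
-- that vc is a prefix of u, and follow the letters b ≠ c occurring after v when φ is applied:
-- they are compared with c through the digits t_{b+1} and t_{c+1}. By the Parry condition
-- only a letter descending from p can have a larger digit than c, and p can occur only if
-- c = 0 or t₁⋯t_c is a border of t₁⋯t_p. A new left special factor appears when two
-- letters b overtake c at the same time. If t₁⋯t_p is a power of an unbordered
-- word, the letters which descend from p at different times never do so. Otherwise let d be the
-- length of the shortest border. The letter p and another letter, which becomes p after
-- as many steps as the length of the longest power of t₁⋯t_d at the end of t₁⋯t_p, overtake c
-- together, at the first place where t₁⋯t_p fails to have period d.
module Submission where

open import Defs
open import Data.Empty using (⊥-elim)
open import Data.Fin.Base using (Fin; zero; suc; toℕ; inject₁; fromℕ)
import Data.Fin.Properties as Fin
open import Data.Fin.Relation.Unary.Top using (view; ‵fromℕ; ‵inject₁)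
import Data.Integer.Base as ℤ
import Data.Integer.Properties as ℤ
import Data.Integer.Tactic.RingSolver as ℤ-Solver
open import Data.List.Base as List using (List; []; _∷_; _++_; [_]; _∷ʳ_; _∷ʳ′_; allFin; concatMap; drop; filter; head; initLast; length; map; replicate; take)
open import Data.List.Membership.Propositional using (_∈_)
open import Data.List.Membership.Propositional.Properties using (∈-∃++; ∈-++⁻; ∈-++⁺ˡ; ∈-++⁺ʳ; ∈-map⁺; ∈-map⁻; ∈-filter⁺; ∈-filter⁻; ∈-allFin)
open import Data.List.Properties using (++-assoc; ++-identityʳ; ++-cancelˡ; ++-cancelʳ; ++-conicalˡ; ++-conicalʳ; ∷-injective; ∷-injectiveˡ; ∷-injectiveʳ; ∷ʳ-injective; concatMap-++; concatMap-cong; concatMap-map; drop-map; length-++; length-drop; length-map; length-tabulate; length-take; map-++; map-concatMap; map-replicate; take++drop≡id)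
open import Data.List.Relation.Binary.Pointwise using (Pointwise-≡⇒≡; ≡⇒Pointwise-≡)
import Data.List.Relation.Binary.Prefix.Heterogeneous as Prefix
open Prefix using (Prefix)
open import Data.List.Relation.Binary.Subset.Propositional using (_⊆_)
import Data.List.Relation.Binary.Suffix.Heterogeneous as Suffix
open Suffix using (Suffix; here; there; _++ˢ_)
open import Data.List.Relation.Unary.All as All using (All; []; _∷_)
import Data.List.Relation.Unary.All.Properties as All
open import Data.List.Relation.Unary.AllPairs using ([]; _∷_)
open import Data.List.Relation.Unary.Any using (here; there)
open import Data.List.Relation.Unary.Unique.Propositional using (Unique)
import Data.List.Relation.Unary.Unique.Propositional.Properties as Unique
open import Data.List.Reverse using (Reverse; []; _∶_∶ʳ_; reverseView)
open import Data.Maybe.Base as Maybe using (just)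
open import Data.Nat.Base
open import Data.Nat.Divisibility using (_∣_; divides; quotient; _∣?_; _∣0)
open import Data.Nat.DivMod using (_%_; _/_; m≡m%n+[m/n]*n; m%n<n; [m+n]%n≡m%n; [m+kn]%n≡m%n; m<n⇒m%n≡m)
open import Data.Nat.GCD using (gcd; gcd[m,n]∣m; gcd[m,n]≤n; gcd[m,n]≢0; gcd-GCD; module Bézout)
open import Data.Nat.GeneralisedArithmetic using (fold)
open import Data.Nat.Induction using (<-rec)
open import Data.Nat.Properties
open import Data.Nat.Tactic.RingSolver using (solve-∀)
open import Data.Product.Base using (∃; ∃₂; _×_; _,_; proj₁; proj₂)
import Data.Rational.Base as ℚ
import Data.Rational.Properties as ℚ
import Data.Rational.Unnormalised.Base as ℚᵘ
import Data.Rational.Unnormalised.Properties as ℚᵘ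
open import Data.Sum.Base using (_⊎_; inj₁; inj₂)
open import Data.Vec.Base as Vec using (Vec; []; _∷_; toList; init; last; tabulate)
import Data.Vec.Properties as Vec
open import Function.Bundles using (_⇔_; mk⇔; Equivalence)
open import Relation.Binary.Definitions using (tri<; tri≈; tri>)
open import Relation.Binary.PropositionalEquality hiding ([_])
open import Relation.Nullary
open import Relation.Nullary.Decidable using (¬?; map′)

-- The Parry condition

-- A letter that overtakes `c` restarts at 0 while the prefix moves on to `c + 1`. Afterwards the
-- Parry condition never lets it fall short: it matches the digits of `c` or overtakes again. If the
-- root is unbordered, a letter restarted inside a period of length `d` is back at 0 at the end of
-- this period, since the digits matched by then would otherwise form a border of the root. From
-- there it trails `c` by a multiple of `d`, and periodicity makes its digits equal to those of `c`.
-- It becomes harmless exactly when the next `p` may arrive, so the dangerous letter is a function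
-- of `c` alone. For a shortest border of length `d` the same return to 0 happens at `c = d`, but
-- the letter then overtakes `c` at the first failure `N` of the period. A letter restarted after
-- `K` does so too: by the Parry condition its digit is at least `e N′ > e N`. The pair to start
-- from comes from the last failure `M`: as `e M` and `e (M + K)` differ, the letters `M + 1` and
-- `M + 1 + K` can follow the same run of zeros with different letters before it. Beyond `M` the
-- period carries both upwards together.

natℚ : ℕ → ℚ.ℚ
natℚ n = ℤ.+ n ℚ./ 1

natℚ≃ : ∀ n → ℚ.toℚᵘ (natℚ n) ℚᵘ.≃ ℤ.+ n ℚᵘ./ 1
natℚ≃ n = ℚ.toℚᵘ-fromℚᵘ (ℤ.+ n ℚᵘ./ 1)

natℚ-mono : ∀ {m n} → m ≤ n → natℚ m ℚ.≤ natℚ n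
natℚ-mono {m} {n} m≤n = ℚ.toℚᵘ-cancel-≤ (begin
  ℚ.toℚᵘ (natℚ m)  ≃⟨ natℚ≃ m ⟩
  ℤ.+ m ℚᵘ./ 1     ≤⟨ ℚᵘ.*≤* (ℤ.*-monoʳ-≤-nonNeg (ℤ.+ 1) (ℤ.+≤+ m≤n)) ⟩
  ℤ.+ n ℚᵘ./ 1     ≃⟨ natℚ≃ n ⟨
  ℚ.toℚᵘ (natℚ n)  ∎)
  where open ℚᵘ.≤-Reasoning

natℚ-suc : ∀ n → natℚ (suc n) ≡ natℚ 1 ℚ.+ natℚ n
natℚ-suc n = ℚ.toℚᵘ-injective (begin
  ℚ.toℚᵘ (natℚ (suc n))                      ≈⟨ natℚ≃ (suc n) ⟩
  ℤ.+ suc n ℚᵘ./ 1                           ≈⟨ ℚᵘ.*≡* (cong (λ z → (ℤ.+ 1 ℤ.+ z) ℤ.* ℤ.+ 1) (sym (ℤ.*-identityʳ (ℤ.+ n)))) ⟩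
  (ℤ.+ 1 ℚᵘ./ 1) ℚᵘ.+ (ℤ.+ n ℚᵘ./ 1)         ≈⟨ ℚᵘ.+-cong (natℚ≃ 1) (natℚ≃ n) ⟨
  ℚ.toℚᵘ (natℚ 1) ℚᵘ.+ ℚ.toℚᵘ (natℚ n)       ≈⟨ ℚ.toℚᵘ-homo-+ (natℚ 1) (natℚ n) ⟨
  ℚ.toℚᵘ (natℚ 1 ℚ.+ natℚ n)                 ∎)
  where open import Relation.Binary.Reasoning.Setoid ℚᵘ.≃-setoid

module _ (β : ℝ) (1<β : fromℕᴿ 1 <ᴿ β) {n : ℕ} (t : Vec ℕ (suc n)) (R : IsRényiExpansion β t) where

  open IsRényiExpansion R

  private
    ds : List ℕ
    ds = toList t

    r : ℕ → ℕ → ℚ.ℚ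
    r i j = approx (remainder β ds i) j

    β≥0 : ∃ λ N → ∀ j → N ≤ j → ℚ.NonNegative (approx β j)
    β≥0 = let (ε , N , ε>0 , h) = 1<β in N , λ j N≤j → ℚ.nonNegative (begin
      ℚ.0ℚ           ≤⟨ natℚ-mono {0} {1} z≤n ⟩
      natℚ 1         ≡⟨ ℚ.+-identityʳ (natℚ 1) ⟨
      natℚ 1 ℚ.+ ℚ.0ℚ ≤⟨ ℚ.+-monoʳ-≤ (natℚ 1) (ℚ.<⇒≤ (ℚ.positive⁻¹ ε {{ε>0}})) ⟩
      natℚ 1 ℚ.+ ε   ≤⟨ h j N≤j ⟩
      approx β j     ∎)
      where open ℚ.≤-Reasoning

    remainder≤1 : ∀ i → ∃ λ N → ∀ j → N ≤ j → r (suc i) j ℚ.≤ r 0 j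
    remainder≤1 i = let (ε , N , ε>0 , h) = proj₂ (floors i) in N , λ j N≤j → begin
      βr j ℚ.- d                     ≡⟨ cong (ℚ._- d) (ℚ.+-identityʳ (βr j)) ⟨
      (βr j ℚ.+ ℚ.0ℚ) ℚ.- d          ≤⟨ ℚ.+-monoˡ-≤ (ℚ.- d) (ℚ.+-monoʳ-≤ (βr j) (ℚ.<⇒≤ (ℚ.positive⁻¹ ε {{ε>0}}))) ⟩
      (βr j ℚ.+ ε) ℚ.- d             ≤⟨ ℚ.+-monoˡ-≤ (ℚ.- d) (h j N≤j) ⟩
      natℚ (suc (digit ds i)) ℚ.- d  ≡⟨ cong (ℚ._- d) (natℚ-suc (digit ds i)) ⟩
      (natℚ 1 ℚ.+ d) ℚ.- d           ≡⟨ ℚ.+-assoc (natℚ 1) d (ℚ.- d) ⟩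
      natℚ 1 ℚ.+ (d ℚ.- d)           ≡⟨ cong (natℚ 1 ℚ.+_) (ℚ.+-inverseʳ d) ⟩
      natℚ 1 ℚ.+ ℚ.0ℚ                ≡⟨ ℚ.+-identityʳ (natℚ 1) ⟩
      natℚ 1                         ∎
      where
      open ℚ.≤-Reasoning
      d : ℚ.ℚ
      d = natℚ (digit ds i)
      βr : ℕ → ℚ.ℚ
      βr j = approx β j ℚ.* r i j

    -- Equal digits are subtracted on both sides, so the initial inequality `T^(o+1)(1) ≤ 1` is
    -- carried along the orbits. It is compared at a single index `j` of the approximations, where
    -- monotonicity in ℚ suffices.
    remainder-mono : ∀ o k → (∀ i → i < k → digit ds (suc o + i) ≡ digit ds i) →
                     ∀ j → ℚ.NonNegative (approx β j) → r (suc o) j ℚ.≤ r 0 j →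
                     r (suc o + k) j ℚ.≤ r k j
    remainder-mono o zero    eq j β≥0 h rewrite +-identityʳ o = h
    remainder-mono o (suc k) eq j β≥0 h rewrite +-suc o k | eq k ≤-refl =
      ℚ.+-monoˡ-≤ (ℚ.- natℚ (digit ds k)) (ℚ.*-monoˡ-≤-nonNeg (approx β j) {{β≥0}}
        (remainder-mono o k (λ i i<k → eq i (m≤n⇒m≤1+n i<k)) j β≥0 h))

  -- If the first digit to differ were larger, then `β T^(o+k)(1) ≤ β T^k(1) < t_(k+1) + 1 ≤
  -- t_(o+k+1)`, against the floor condition at `o + k`. As `≤ᴿ` is a negated `<ᴿ`, a margin `ε` is
  -- needed; it is the one in the upper bound at `k`.
  parry : ∀ o k → 0 < o → (∀ i → i < k → digit ds (o + i) ≡ digit ds i) →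
          digit ds (o + k) ≤ digit ds k
  parry (suc o) k _ eq with digit ds (suc o + k) ≤? digit ds k
  ... | yes le = le
  ... | no ≰ =
    let (ε , N₁ , ε>0 , h) = proj₂ (floors k)
        (N₂ , β≥0ⱼ) = β≥0
        (N₃ , r≤1) = remainder≤1 o
    in ⊥-elim (proj₁ (floors (suc o + k)) (ε , N₁ ⊔ (N₂ ⊔ N₃) , ε>0 , λ j N≤j →
      let N₂₃≤j = m⊔n≤o⇒n≤o N₁ (N₂ ⊔ N₃) N≤j
          pos = β≥0ⱼ j (m⊔n≤o⇒m≤o N₂ N₃ N₂₃≤j)
      in begin
        approx β j ℚ.* r (suc o + k) j ℚ.+ ε
          ≤⟨ ℚ.+-monoˡ-≤ ε (ℚ.*-monoˡ-≤-nonNeg (approx β j) {{pos}}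
               (remainder-mono o k eq j pos (r≤1 j (m⊔n≤o⇒n≤o N₂ N₃ N₂₃≤j)))) ⟩
        approx β j ℚ.* r k j ℚ.+ ε
          ≤⟨ h j (m⊔n≤o⇒m≤o N₁ (N₂ ⊔ N₃) N≤j) ⟩
        natℚ (suc (digit ds k))
          ≤⟨ natℚ-mono (≰⇒> ≰) ⟩
        natℚ (digit ds (suc o + k)) ∎))
    where open ℚ.≤-Reasoning

  firstDigit>0 : 0 < digit ds 0
  firstDigit>0 with digit ds 0 in eq
  ... | suc _ = z<s
  ... | zero =
    let (ε , N₁ , ε>0 , h) = proj₂ (floors 0)
        (δ , N₂ , δ>0 , h′) = 1<β
        j = N₁ ⊔ N₂
        open ℚ.≤-Reasoning
    in ⊥-elim (ℚ.<-irrefl refl (begin-strict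
      natℚ 1                               ≡⟨ ℚ.+-identityʳ (natℚ 1) ⟨
      natℚ 1 ℚ.+ ℚ.0ℚ                      <⟨ ℚ.+-monoʳ-< (natℚ 1) (ℚ.positive⁻¹ δ {{δ>0}}) ⟩
      natℚ 1 ℚ.+ δ                         ≤⟨ h′ j (m≤n⊔m N₁ N₂) ⟩
      approx β j                           ≡⟨ ℚ.*-identityʳ (approx β j) ⟨
      approx β j ℚ.* ℚ.1ℚ                  ≡⟨ ℚ.+-identityʳ _ ⟨
      approx β j ℚ.* ℚ.1ℚ ℚ.+ ℚ.0ℚ         ≤⟨ ℚ.+-monoʳ-≤ (approx β j ℚ.* ℚ.1ℚ) (ℚ.<⇒≤ (ℚ.positive⁻¹ ε {{ε>0}})) ⟩
      approx β j ℚ.* ℚ.1ℚ ℚ.+ ε            ≤⟨ h j (m≤m⊔n N₁ N₂) ⟩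
      natℚ (suc (digit ds 0))              ≡⟨ cong (λ d → natℚ (suc d)) eq ⟩
      natℚ 1                               ∎))

-- The substitution on ℕ-letters, its factors and prefixes

𝟘 : ℕ → List ℕ
𝟘 r = replicate r 0

𝟘-∷ʳ : ∀ r → 𝟘 (suc r) ≡ 𝟘 r ∷ʳ 0
𝟘-∷ʳ zero    = refl
𝟘-∷ʳ (suc r) = cong (0 ∷_) (𝟘-∷ʳ r)

++-𝟘-∷ʳ : ∀ w r → (w ++ 𝟘 r) ∷ʳ 0 ≡ w ++ 𝟘 (suc r)
++-𝟘-∷ʳ w r = trans (++-assoc w (𝟘 r) [ 0 ]) (cong (w ++_) (sym (𝟘-∷ʳ r)))

𝟘-+ : ∀ r s → 𝟘 (r + s) ≡ 𝟘 r ++ 𝟘 s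
𝟘-+ zero    s = refl
𝟘-+ (suc r) s = cong (0 ∷_) (𝟘-+ r s)

run-split : ∀ r {b A} x {j y} → 𝟘 r ++ b ∷ A ≡ x ++ suc j ∷ y →
            (x ≡ 𝟘 r × b ≡ suc j × A ≡ y) ⊎ (∃ λ x′ → x ≡ 𝟘 r ++ b ∷ x′ × A ≡ x′ ++ suc j ∷ y)
run-split zero    []      refl = inj₁ (refl , refl , refl)
run-split zero    (a ∷ x) refl = inj₂ (x , refl , refl)
run-split (suc r) (a ∷ x) eq with ∷-injective eq
... | refl , eq′ with run-split r x eq′
... | inj₁ (refl , q , s)      = inj₁ (refl , q , s)
... | inj₂ (x′ , refl , s)     = inj₂ (x′ , refl , s)

run-next : ∀ r {j A} s {b y} → 𝟘 r ++ suc j ∷ A ≡ 𝟘 s ++ b ∷ y →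
           (s < r × b ≡ 0) ⊎ (s ≡ r × b ≡ suc j)
run-next zero    zero    refl = inj₂ (refl , refl)
run-next (suc r) zero    refl = inj₁ (z<s , refl)
run-next (suc r) (suc s) eq with run-next r s (∷-injectiveʳ eq)
... | inj₁ (s<r , b≡0) = inj₁ (s<s s<r , b≡0)
... | inj₂ (s≡r , b≡)  = inj₂ (cong suc s≡r , b≡)

run-bound : ∀ r {j A} s {y} → 𝟘 r ++ suc j ∷ A ≡ 𝟘 s ++ y → s ≤ r
run-bound r       zero    _  = z≤n
run-bound (suc r) (suc s) eq = s≤s (run-bound r s (∷-injectiveʳ eq))

lastNonzero : ∀ w → (∃ λ s → w ≡ 𝟘 s) ⊎ (∃₂ λ w₁ j → ∃ λ s → w ≡ w₁ ++ suc j ∷ 𝟘 s)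
lastNonzero [] = inj₁ (0 , refl)
lastNonzero (a ∷ w) with lastNonzero w
lastNonzero (a ∷ w)     | inj₂ (w₁ , j , s , refl) = inj₂ (a ∷ w₁ , j , s , refl)
lastNonzero (zero ∷ w)  | inj₁ (s , refl)          = inj₁ (suc s , refl)
lastNonzero (suc j ∷ w) | inj₁ (s , refl)          = inj₂ ([] , j , s , refl)

-- The letters are 0, …, p with p = m - 1. With e k = t_{k+1} for k < p and e p = t_m - 1,
-- all the images φ(k) have the same shape 0^(e k) σ(k).
module Morphism (p : ℕ) (e : ℕ → ℕ) where

  opaque
    σ : ℕ → ℕ
    σ k with k ≟ p
    ... | yes _ = 0
    ... | no  _ = suc k

    σ-p : σ p ≡ 0
    σ-p with p ≟ p
    ... | yes _ = refl
    ... | no ≢  = ⊥-elim (≢ refl)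

    σ-≢p : ∀ {k} → k ≢ p → σ k ≡ suc k
    σ-≢p {k} k≢p with k ≟ p
    ... | yes k≡p = ⊥-elim (k≢p k≡p)
    ... | no _    = refl

    σ-injective : ∀ {a b} → σ a ≡ σ b → a ≡ b
    σ-injective {a} {b} eq with a ≟ p | b ≟ p
    ... | yes refl | yes refl = refl
    ... | no _     | no _     = suc-injective eq

    σ≡suc : ∀ {a j} → σ a ≡ suc j → a ≡ j × a ≢ p
    σ≡suc {a} eq with a ≟ p
    ... | no a≢p = suc-injective eq , a≢p

    σ≤p : ∀ {a} → a ≤ p → σ a ≤ p
    σ≤p {a} a≤p with a ≟ p
    ... | yes _  = z≤n
    ... | no a≢p = ≤∧≢⇒< a≤p a≢p

    σ-surjective : ∀ {a} → a ≤ p → ∃ λ b → b ≤ p × σ b ≡ a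
    σ-surjective {zero}  _   = p , ≤-refl , σ-p
    σ-surjective {suc a} a<p = a , <⇒≤ a<p , σ-≢p (<⇒≢ a<p)

  ψ : ℕ → List ℕ
  ψ k = 𝟘 (e k) ∷ʳ σ k

  Φ : List ℕ → List ℕ
  Φ = concatMap ψ

  Φ-∷ : ∀ a w → Φ (a ∷ w) ≡ 𝟘 (e a) ++ σ a ∷ Φ w
  Φ-∷ a w = ++-assoc (𝟘 (e a)) [ σ a ] (Φ w)

  Φ-++ : ∀ v w → Φ (v ++ w) ≡ Φ v ++ Φ w
  Φ-++ = concatMap-++ ψ

  Φ-∷ʳ : ∀ w a → Φ (w ∷ʳ a) ≡ (Φ w ++ 𝟘 (e a)) ∷ʳ σ a
  Φ-∷ʳ w a = begin
    Φ (w ∷ʳ a)                        ≡⟨ Φ-++ w [ a ] ⟩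
    Φ w ++ (ψ a ++ [])                ≡⟨ cong (Φ w ++_) (++-identityʳ (ψ a)) ⟩
    Φ w ++ (𝟘 (e a) ∷ʳ σ a)           ≡⟨ ++-assoc (Φ w) (𝟘 (e a)) [ σ a ] ⟨
    (Φ w ++ 𝟘 (e a)) ∷ʳ σ a           ∎
    where open ≡-Reasoning

  iter : ℕ → List ℕ
  iter = fold [ 0 ] Φ

module Substitution (p : ℕ) (e : ℕ → ℕ) (0<p : 0 < p) (0<e₀ : 0 < e 0) where

  open Morphism p e public

  private
    e₀≡suc : ∃ λ r → e 0 ≡ suc r
    e₀≡suc = pred (e 0) , sym (suc-pred (e 0) {{>-nonZero 0<e₀}})

  -- As `e 0 > 0`, the image of 0 starts with 0 and has a further letter; `Φ` carries a strict
  -- extension to a strict extension. Strictness is what allows every prefix to be extended.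
  iter-suc : ∀ k → ∃₂ λ c r → iter (suc k) ≡ iter k ++ c ∷ r
  iter-suc zero with e 0 | e₀≡suc
  ... | _ | zero , refl  = σ 0 , [] , refl
  ... | _ | suc r , refl = 0 , 𝟘 r ++ [ σ 0 ] ++ [] , cong (λ w → 0 ∷ 0 ∷ w) (++-assoc (𝟘 r) _ _)
  iter-suc (suc k) with iter-suc k
  ... | c , r , eq with Φ (c ∷ r) in eq′
  ... | [] with 𝟘 (e c) | trans (sym (Φ-∷ c r)) eq′
  ...   | []    | ()
  ...   | _ ∷ _ | ()
  iter-suc (suc k) | c , r , eq | c′ ∷ r′ = c′ , r′ , (begin
    Φ (iter (suc k))            ≡⟨ cong Φ eq ⟩
    Φ (iter k ++ c ∷ r)         ≡⟨ Φ-++ (iter k) (c ∷ r) ⟩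
    iter (suc k) ++ Φ (c ∷ r)   ≡⟨ cong (iter (suc k) ++_) eq′ ⟩
    iter (suc k) ++ c′ ∷ r′     ∎)
    where open ≡-Reasoning

  iter-mono : ∀ {k l} → k ≤ l → ∃ λ r → iter l ≡ iter k ++ r
  iter-mono {k} k≤l with m≤n⇒∃[o]m+o≡n k≤l
  ... | o , refl = go o
    where
    go : ∀ o → ∃ λ r → iter (k + o) ≡ iter k ++ r
    go zero    rewrite +-identityʳ k = [] , sym (++-identityʳ (iter k))
    go (suc o) rewrite +-suc k o with go o | iter-suc (k + o)
    ... | r , eq | c , r′ , eq′ =
      r ++ c ∷ r′ , trans eq′ (trans (cong (_++ c ∷ r′) eq) (++-assoc (iter k) r (c ∷ r′)))

  -- The level is an index, not a field, because the main inductions recurse on it: desubstitution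
  -- lowers it by one.
  record Fac (k : ℕ) (w : List ℕ) : Set where
    constructor fac
    field
      before after : List ℕ
      occurs       : iter k ≡ before ++ w ++ after

  Factor : List ℕ → Set
  Factor w = ∃ λ k → Fac k w

  record Pre (w : List ℕ) : Set where
    constructor pre
    field
      level : ℕ
      after : List ℕ
      occurs : iter level ≡ w ++ after

  Fac-infix : ∀ {k} x w y → Fac k (x ++ w ++ y) → Fac k w
  Fac-infix x w y (fac x′ y′ eq) = fac (x′ ++ x) (y ++ y′) (trans eq (begin
    x′ ++ (x ++ w ++ y) ++ y′     ≡⟨ cong (x′ ++_) (++-assoc x (w ++ y) y′) ⟩
    x′ ++ x ++ (w ++ y) ++ y′     ≡⟨ ++-assoc x′ x _ ⟨
    (x′ ++ x) ++ (w ++ y) ++ y′   ≡⟨ cong ((x′ ++ x) ++_) (++-assoc w y y′) ⟩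
    (x′ ++ x) ++ w ++ y ++ y′     ∎))
    where open ≡-Reasoning

  Fac-prefix : ∀ {k} w y → Fac k (w ++ y) → Fac k w
  Fac-prefix = Fac-infix []

  Fac-suffix : ∀ {k} x w → Fac k (x ++ w) → Fac k w
  Fac-suffix {k} x w f = Fac-infix x w [] (subst (λ v → Fac k (x ++ v)) (sym (++-identityʳ w)) f)

  Fac-mono : ∀ {k l w} → k ≤ l → Fac k w → Fac l w
  Fac-mono {w = w} k≤l (fac x y eq) with iter-mono k≤l
  ... | r , eq′ = fac x (y ++ r) (trans eq′ (begin
    _                  ≡⟨ cong (_++ r) eq ⟩
    (x ++ w ++ y) ++ r ≡⟨ ++-assoc x (w ++ y) r ⟩
    x ++ (w ++ y) ++ r ≡⟨ cong (x ++_) (++-assoc w y r) ⟩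
    x ++ w ++ y ++ r   ∎))
    where open ≡-Reasoning

  Pre⇒Factor : ∀ {w} → Pre w → Factor w
  Pre⇒Factor (pre k y eq) = k , fac [] y eq

  Pre-prefix : ∀ w y → Pre (w ++ y) → Pre w
  Pre-prefix w y (pre k y′ eq) = pre k (y ++ y′) (trans eq (++-assoc w y y′))

  Pre-extend : ∀ {w} → Pre w → ∃ λ c → Pre (w ∷ʳ c)
  Pre-extend {w} (pre k [] eq) with iter-suc k
  ... | c , r , eq′ = c , pre (suc k) r (trans eq′ (trans (cong (_++ c ∷ r) (trans eq (++-identityʳ w))) (sym (++-assoc w [ c ] r))))
  Pre-extend {w} (pre k (c ∷ y) eq) = c , pre k y (trans eq (sym (++-assoc w [ c ] y)))

  Fac-extend : ∀ {k w} → Fac k w → ∃ λ c → Factor (w ∷ʳ c)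
  Fac-extend {k} {w} (fac x y eq) with Pre-extend {x ++ w} (pre k y (trans eq (sym (++-assoc x w y))))
  ... | c , pre k′ y′ eq′ = c , k′ , fac x y′ (trans eq′ (trans (cong (_++ y′) (++-assoc x w [ c ])) (++-assoc x (w ∷ʳ c) y′)))

  Pre-unique : ∀ v {c x c′ x′} → Pre (v ++ c ∷ x) → Pre (v ++ c′ ∷ x′) → c ≡ c′
  Pre-unique v {c} {x} {c′} {x′} (pre k y eq) (pre l z eq′)
    with iter-mono (m≤m⊔n k l) | iter-mono (m≤n⊔m k l)
  ... | r , h | r′ , h′ = ∷-injectiveˡ (++-cancelˡ v _ _ (trans (sym (reassoc k (k ⊔ l) eq h)) (reassoc l (k ⊔ l) eq′ h′)))
    where
    reassoc : ∀ {d w y r} K L → iter K ≡ (v ++ d ∷ w) ++ y → iter L ≡ iter K ++ r →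
              iter L ≡ v ++ d ∷ (w ++ y) ++ r
    reassoc {d} {w} {y} {r} _ _ eq h = trans h (trans (cong (_++ r) (trans eq (++-assoc v (d ∷ w) y))) (++-assoc v (d ∷ w ++ y) r))

  Pre-Φ : ∀ {w} → Pre w → Pre (Φ w)
  Pre-Φ {w} (pre k y eq) = pre (suc k) (Φ y) (trans (cong Φ eq) (Φ-++ w y))

  Fac-Φ : ∀ {k w} → Fac k w → Fac (suc k) (Φ w)
  Fac-Φ {k} {w} (fac x y eq) = fac (Φ x) (Φ y) (trans (cong Φ eq) (trans (Φ-++ x (w ++ y)) (cong (Φ x ++_) (Φ-++ w y))))

  Fac-Φ-∷ : ∀ {k a w} → Fac k (a ∷ w) → Fac (suc k) (σ a ∷ Φ w)
  Fac-Φ-∷ {k} {a} {w} f = Fac-suffix (𝟘 (e a)) _ (subst (Fac (suc k)) (Φ-∷ a w) (Fac-Φ f))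

  ψ≤p : ∀ {a} → a ≤ p → All (_≤ p) (ψ a)
  ψ≤p {a} a≤p = All.++⁺ (All.replicate⁺ (e a) z≤n) (σ≤p a≤p ∷ [])

  Φ≤p : ∀ {w} → All (_≤ p) w → All (_≤ p) (Φ w)
  Φ≤p []       = []
  Φ≤p (h ∷ hs) = All.++⁺ (ψ≤p h) (Φ≤p hs)

  iter≤p : ∀ k → All (_≤ p) (iter k)
  iter≤p zero    = z≤n ∷ []
  iter≤p (suc k) = Φ≤p (iter≤p k)

  Fac-∷≤p : ∀ {k b w} → Fac k (b ∷ w) → b ≤ p
  Fac-∷≤p {k} (fac x y eq) with All.++⁻ʳ x (subst (All (_≤ p)) eq (iter≤p k))
  ... | h ∷ _ = h

  Pre-head : ∀ {c w} → Pre (c ∷ w) → c ≡ 0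
  Pre-head h = Pre-unique [] h (pre 0 [] refl)

  -- A nonzero letter `suc j` can only end a block, and that block is the image of `j`; cutting
  -- after it never splits a block.
  cut : ∀ z x {j y} → Φ z ≡ x ++ suc j ∷ y →
        ∃₂ λ z₁ z₂ → z ≡ z₁ ++ j ∷ z₂ × j ≢ p × x ≡ Φ z₁ ++ 𝟘 (e j) × y ≡ Φ z₂
  cut []      []      ()
  cut []      (_ ∷ _) ()
  cut (a ∷ z) x eq with run-split (e a) x (trans (sym (Φ-∷ a z)) eq)
  ... | inj₁ (refl , σa≡ , refl) with σ≡suc σa≡
  ...   | refl , a≢p = [] , z , refl , a≢p , refl , refl
  cut (a ∷ z) x eq | inj₂ (x′ , refl , eq′) with cut z x′ eq′
  ... | z₁ , z₂ , refl , j≢p , refl , y≡ = a ∷ z₁ , z₂ , refl , j≢p , (begin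
    𝟘 (e a) ++ σ a ∷ Φ z₁ ++ 𝟘 (e _)      ≡⟨ ++-assoc (𝟘 (e a)) (σ a ∷ Φ z₁) _ ⟨
    (𝟘 (e a) ++ σ a ∷ Φ z₁) ++ 𝟘 (e _)    ≡⟨ cong (_++ 𝟘 (e _)) (Φ-∷ a z₁) ⟨
    Φ (a ∷ z₁) ++ 𝟘 (e _)                 ∎) , y≡
    where open ≡-Reasoning

  lastBlock : ∀ z {y l} → Φ z ≡ y ∷ʳ l → ∃₂ λ z′ b → z ≡ z′ ∷ʳ b × σ b ≡ l × y ≡ Φ z′ ++ 𝟘 (e b)
  lastBlock z {y} eq with initLast z
  lastBlock .[] {[]}    () | []
  lastBlock .[] {_ ∷ _} () | []
  lastBlock .(z′ ∷ʳ b) {y} eq | z′ ∷ʳ′ b with ∷ʳ-injective _ y (trans (sym (Φ-∷ʳ z′ b)) eq)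
  ... | y≡ , σb≡ = z′ , b , refl , σb≡ , sym y≡

  -- σ is injective, so the images of the letters form a suffix code.
  sync : ∀ {z v} x → Reverse v → Φ z ≡ x ++ Φ v → ∃ λ z₀ → z ≡ z₀ ++ v × Φ z₀ ≡ x
  sync {z} x []              eq = z , sym (++-identityʳ z) , trans eq (++-identityʳ x)
  sync {z} x (v ∶ rs ∶ʳ b) eq
    with lastBlock z (trans eq (trans (cong (x ++_) (Φ-∷ʳ v b)) (sym (++-assoc x _ [ σ b ]))))
  ... | z′ , b′ , refl , σ≡ , eq′ with σ-injective σ≡
  ... | refl with sync {z′} x rs (++-cancelʳ (𝟘 (e b)) (Φ z′) (x ++ Φ v) (trans (sym eq′) (sym (++-assoc x (Φ v) _))))
  ... | z₀ , refl , h = z₀ , ++-assoc z₀ v [ b ] , h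

  private
    -- If the final `r` zeros reached beyond `w`, both `a` and `a′` would be 0.
    strip-zeros : ∀ r {A A′ a a′} x x′ w → a ≢ a′ → A ++ 𝟘 r ≡ x ++ a ∷ w → A′ ++ 𝟘 r ≡ x′ ++ a′ ∷ w →
                  ∃ λ w′ → w ≡ w′ ++ 𝟘 r × A ≡ x ++ a ∷ w′ × A′ ≡ x′ ++ a′ ∷ w′
    strip-zeros zero {A} {A′} x x′ w a≢a′ eq eq′ =
      w , sym (++-identityʳ w) , trans (sym (++-identityʳ A)) eq , trans (sym (++-identityʳ A′)) eq′
    strip-zeros (suc r) {A} {A′} {a} {a′} x x′ w a≢a′ eq eq′ with initLast w
    ... | [] = ⊥-elim (a≢a′ (trans (sym (proj₂ (∷ʳ-injective _ x (trans (++-𝟘-∷ʳ A r) eq))))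
                                   (proj₂ (∷ʳ-injective _ x′ (trans (++-𝟘-∷ʳ A′ r) eq′)))))
    ... | w₁ ∷ʳ′ l with ∷ʳ-injective (A ++ 𝟘 r) (x ++ a ∷ w₁) (trans (++-𝟘-∷ʳ A r) (trans eq (sym (++-assoc x (a ∷ w₁) [ l ]))))
                      | ∷ʳ-injective (A′ ++ 𝟘 r) (x′ ++ a′ ∷ w₁) (trans (++-𝟘-∷ʳ A′ r) (trans eq′ (sym (++-assoc x′ (a′ ∷ w₁) [ l ]))))
    ... | h , refl | h′ , _ with strip-zeros r x x′ w₁ a≢a′ h h′
    ... | w′ , refl , g , g′ = w′ , ++-𝟘-∷ʳ w′ r , g , g′

  -- The last letter of a block determines the whole block. Read from the right, two images can
  -- therefore first differ only at the last letters of blocks, and `w` consists of entire blocks.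
  desubstitute : ∀ {z} z′ {a a′} x x′ w → Reverse z → a ≢ a′ → Φ z ≡ x ++ a ∷ w → Φ z′ ≡ x′ ++ a′ ∷ w →
    ∃ λ v → w ≡ Φ v × ∃₂ λ b b′ → b ≢ b′ × ∃₂ λ z₀ z₀′ → z ≡ z₀ ++ b ∷ v × z′ ≡ z₀′ ++ b′ ∷ v
  desubstitute z′ []      x′ w [] a≢a′ () eq′
  desubstitute z′ (_ ∷ _) x′ w [] a≢a′ () eq′
  desubstitute z′ {a} {a′} x x′ w (z₁ ∶ rs ∶ʳ b) a≢a′ eq eq′ with initLast w
  ... | [] with lastBlock z′ eq′ | ∷ʳ-injective _ x (trans (sym (Φ-∷ʳ z₁ b)) eq)
  ...   | z₁′ , b′ , refl , σb′≡ , _ | _ , σb≡ =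
    [] , refl , b , b′ , (λ { refl → a≢a′ (trans (sym σb≡) σb′≡) }) , z₁ , z₁′ , refl , refl
  desubstitute z′ {a} {a′} x x′ w (z₁ ∶ rs ∶ʳ b) a≢a′ eq eq′ | w₁ ∷ʳ′ l
    with lastBlock z′ (trans eq′ (sym (++-assoc x′ (a′ ∷ w₁) [ l ])))
       | ∷ʳ-injective _ (x ++ a ∷ w₁) (trans (sym (Φ-∷ʳ z₁ b)) (trans eq (sym (++-assoc x (a ∷ w₁) [ l ]))))
  ... | z₁′ , b′ , refl , σb′≡ , h′ | h , σb≡ with σ-injective (trans σb≡ (sym σb′≡))
  ... | refl with strip-zeros (e b) x x′ w₁ a≢a′ h (sym h′)
  ... | w′ , refl , g , g′ with desubstitute z₁′ x x′ w′ rs a≢a′ g g′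
  ... | v , refl , c , c′ , c≢c′ , z₀ , z₀′ , refl , refl =
    v ∷ʳ b , trans (cong ((Φ v ++ 𝟘 (e b)) ∷ʳ_) (sym σb≡)) (sym (Φ-∷ʳ v b)) ,
    c , c′ , c≢c′ , z₀ , z₀′ , ++-assoc z₀ (c ∷ v) [ b ] , ++-assoc z₀′ (c′ ∷ v) [ b ]

  -- Between `suc y` and `suc x` there is no room for zeros, so `e x = 0`, hence `x ≠ 0`, and `y x`
  -- is a factor one level lower. The descent stops when `y = 0`.
  ascent : ∀ k {y x} → Fac k (suc y ∷ suc x ∷ []) → y < x
  ascent zero    (fac [] _ ())
  ascent zero    (fac (_ ∷ []) _ ())
  ascent zero    (fac (_ ∷ _ ∷ _) _ ())
  ascent (suc k) {y} {x} (fac X Y eq) with cut (iter k) X eq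
  ... | z₁ , z₂ , eq₁ , _ , _ , eq₂ with cut z₂ [] (sym eq₂)
  ... | z₃ , z₄ , refl , _ , eq₃ , _ with ++-conicalˡ (Φ z₃) _ (sym eq₃) | ++-conicalʳ (Φ z₃) _ (sym eq₃)
  ...   | Φz₃≡[] | e≡[] with x
  ...     | zero with e 0 | e₀≡suc | e≡[]
  ...       | _ | _ , refl | ()
  ascent (suc k) {y} {x} (fac X Y eq) | z₁ , z₂ , eq₁ , _ , _ , eq₂ | z₃ , z₄ , refl , _ , eq₃ , _ | Φz₃≡[] | e≡[] | suc x′
    with z₃ | y
  ... | []    | zero   = z<s
  ... | []    | suc y′ = s<s (ascent k (fac z₁ z₄ eq₁))
  ... | a ∷ z | _ with 𝟘 (e a) | Φz₃≡[]
  ...   | []    | ()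
  ...   | _ ∷ _ | ()

  after-p : ∀ {k b} → Fac k (p ∷ b ∷ []) → b ≡ 0
  after-p {b = zero}      f = refl
  after-p {k} {b = suc b} f = ⊥-elim (<-irrefl refl (<-≤-trans (ascent k f′) (s≤s⁻¹ b<p)))
    where
    instance
      p≢0 : NonZero p
      p≢0 = >-nonZero 0<p
    f′ : Fac k (suc (pred p) ∷ suc b ∷ [])
    f′ = subst (λ q → Fac k (q ∷ suc b ∷ [])) (sym (suc-pred p)) f
    b<p : suc b ≤ suc (pred p)
    b<p = subst (suc b ≤_) (sym (suc-pred p)) (Fac-∷≤p (Fac-suffix [ p ] [ suc b ] f))

  Pre-first : Pre (𝟘 (e 0) ∷ʳ 1)
  Pre-first = pre 1 [] (cong (λ j → (𝟘 (e 0) ++ [ j ]) ++ []) (σ-≢p (<⇒≢ 0<p)))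

  -- Left extensions of prefixes

  private
    letter-occurs : ∀ {k} → k ≤ p → ∃ λ w → iter k ≡ w ∷ʳ k
    letter-occurs {zero}  _ = [] , refl
    letter-occurs {suc k} k<p with letter-occurs (<⇒≤ k<p)
    ... | w , eq = Φ w ++ 𝟘 (e k) , trans (cong Φ eq) (trans (Φ-∷ʳ w k) (cong ((Φ w ++ 𝟘 (e k)) ∷ʳ_) (σ-≢p (<⇒≢ k<p))))

  letter : ∀ {a} → a ≤ p → Factor [ a ]
  letter {a} a≤p with letter-occurs a≤p
  ... | w , eq = a , fac w [] eq

  Factor-p0 : Factor (p ∷ 0 ∷ [])
  Factor-p0 with letter ≤-refl
  ... | k , f with Fac-extend f
  ... | c , k′ , f′ with after-p f′
  ... | refl = k′ , f′

  private
    Φ[0] : Φ [ 0 ] ≡ 0 ∷ (𝟘 (pred (e 0)) ∷ʳ σ 0) ++ []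
    Φ[0] with e 0 | e₀≡suc
    ... | _ | _ , refl = refl

    0-leftExtension : ∀ {a b} → Factor (a ∷ 0 ∷ []) → σ a ≡ b → Factor (b ∷ 0 ∷ [])
    0-leftExtension {a} (k , f) refl = suc k , Fac-prefix (σ a ∷ 0 ∷ []) _ (subst (λ w → Fac (suc k) (σ a ∷ w)) Φ[0] (Fac-Φ-∷ f))

    -- `Φ` turns an occurrence of `a 0` into one of `σ(a) 0`, and `σ` permutes the letters
    -- cyclically, so all of them are reached from `p 0`.
    0-leftExtensions : ∀ {a} → a ≤ p → Factor (a ∷ 0 ∷ [])
    0-leftExtensions {zero}  _   = 0-leftExtension Factor-p0 σ-p
    0-leftExtensions {suc a} a<p = 0-leftExtension (0-leftExtensions (<⇒≤ a<p)) (σ-≢p (<⇒≢ a<p))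

  iter-leftExtension : ∀ {a} k → a ≤ p → Factor (a ∷ iter k)
  iter-leftExtension zero    a≤p = 0-leftExtensions a≤p
  iter-leftExtension (suc k) a≤p with σ-surjective a≤p
  ... | b , b≤p , refl with iter-leftExtension k b≤p
  ... | l , f = suc l , Fac-Φ-∷ f

  Pre-leftExtension : ∀ {a w} → a ≤ p → Pre w → Factor (a ∷ w)
  Pre-leftExtension {a} {w} a≤p (pre k y eq) with iter-leftExtension k a≤p
  ... | l , f = l , Fac-prefix (a ∷ w) y (subst (λ v → Fac l (a ∷ v)) eq f)

-- Left special factors

𝟘-prefix : ∀ {r s} → r ≤ s → ∃ λ w → 𝟘 s ≡ 𝟘 r ++ w
𝟘-prefix {r} r≤s with m≤n⇒∃[o]m+o≡n r≤s
... | o , refl = 𝟘 o , 𝟘-+ r o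

𝟘-prefix-0 : ∀ {r s} → r < s → ∃ λ w → 𝟘 s ≡ 𝟘 r ++ 0 ∷ w
𝟘-prefix-0 {r} r<s with m≤n⇒∃[o]m+o≡n r<s
... | o , refl = 𝟘 o , trans (cong 𝟘 (sym (+-suc r o))) (𝟘-+ r (suc o))

𝟘-++-comm : ∀ r s w → 𝟘 r ++ 𝟘 s ++ w ≡ 𝟘 s ++ 𝟘 r ++ w
𝟘-++-comm r s w = begin
  𝟘 r ++ 𝟘 s ++ w     ≡⟨ ++-assoc (𝟘 r) (𝟘 s) w ⟨
  (𝟘 r ++ 𝟘 s) ++ w   ≡⟨ cong (_++ w) (𝟘-+ r s) ⟨
  𝟘 (r + s) ++ w      ≡⟨ cong (λ i → 𝟘 i ++ w) (+-comm r s) ⟩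
  𝟘 (s + r) ++ w      ≡⟨ cong (_++ w) (𝟘-+ s r) ⟩
  (𝟘 s ++ 𝟘 r) ++ w   ≡⟨ ++-assoc (𝟘 s) (𝟘 r) w ⟩
  𝟘 s ++ 𝟘 r ++ w     ∎
  where open ≡-Reasoning

run-or-beyond : ∀ r {b A} x {C} → 𝟘 r ++ b ∷ A ≡ x ++ C →
                (∃ λ i → x ≡ 𝟘 i) ⊎ (∃ λ x′ → x ≡ 𝟘 r ++ b ∷ x′ × A ≡ x′ ++ C)
run-or-beyond r       []      eq   = inj₁ (0 , refl)
run-or-beyond zero    (a ∷ x) refl = inj₂ (x , refl , refl)
run-or-beyond (suc r) (a ∷ x) eq with ∷-injective eq
... | refl , eq′ with run-or-beyond r x eq′
... | inj₁ (i , refl)      = inj₁ (suc i , refl)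
... | inj₂ (x′ , refl , h) = inj₂ (x′ , refl , h)

module LeftSpecial (p : ℕ) (e : ℕ → ℕ) (0<p : 0 < p) (0<e₀ : 0 < e 0) where

  open Substitution p e 0<p 0<e₀ public

  NonPrefixLeftSpecial : Set
  NonPrefixLeftSpecial = ∃ λ w → ∃₂ λ a a′ → a ≢ a′ × Factor (a ∷ w) × Factor (a′ ∷ w) × ¬ Pre w

  ¬Pre-𝟘 : ∀ {w} → ¬ Pre (𝟘 (e 0) ++ 0 ∷ w)
  ¬Pre-𝟘 h = 0≢1+n (Pre-unique (𝟘 (e 0)) h Pre-first)

  Fac-cut : ∀ {k} v {j} w → Fac (suc k) (v ++ suc j ∷ w) →
            ∃₂ λ x y → ∃₂ λ z₁ z₂ → iter k ≡ z₁ ++ j ∷ z₂ × x ++ v ≡ Φ z₁ ++ 𝟘 (e j) × Φ z₂ ≡ w ++ y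
  Fac-cut {k} v {j} w (fac x y eq)
    with cut (iter k) (x ++ v) (trans eq (trans (cong (x ++_) (++-assoc v (suc j ∷ w) y)) (sym (++-assoc x v _))))
  ... | z₁ , z₂ , eq₁ , _ , eq₂ , eq₃ = x , y , z₁ , z₂ , eq₁ , eq₂ , sym eq₃

  Pre-cut : ∀ v {j} w → Pre (v ++ suc j ∷ w) →
            ∃₂ λ k y → ∃₂ λ z₁ z₂ → iter k ≡ z₁ ++ j ∷ z₂ × v ≡ Φ z₁ ++ 𝟘 (e j) × Φ z₂ ≡ w ++ y
  Pre-cut v {j} w (pre k y eq) with iter-suc k
  ... | c , r , eq′ with cut (iter k) v (trans eq′ (trans (cong (_++ c ∷ r) (trans eq (++-assoc v (suc j ∷ w) y))) (++-assoc v (suc j ∷ w ++ y) (c ∷ r))))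
  ... | z₁ , z₂ , eq₁ , _ , eq₂ , eq₃ = k , y ++ c ∷ r , z₁ , z₂ , eq₁ , eq₂ , trans (sym eq₃) (++-assoc w y (c ∷ r))

  -- Since p0 is a factor, so is 0^(t_m + t₁), whereas the word starts with 0^(t₁)1.
  longRun : 0 < e p → Factor (𝟘 (2 + e 0))
  longRun 0<eₚ =
    let (k , f) = Factor-p0
    in suc k , Fac-infix w (𝟘 (2 + e 0)) (σ 0 ∷ []) (subst (Fac (suc k)) Φp0 (Fac-Φ f))
      where
      w : List ℕ
      w = proj₁ (𝟘-prefix 0<eₚ)
      eq : 𝟘 (e p) ≡ 0 ∷ w
      eq = proj₂ (𝟘-prefix 0<eₚ)
      open ≡-Reasoning
      comm : 0 ∷ w ≡ w ∷ʳ 0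
      comm = begin
        0 ∷ w ≡⟨ eq ⟨
        𝟘 (e p) ≡⟨ cong 𝟘 (suc-pred (e p) {{>-nonZero 0<eₚ}}) ⟨
        𝟘 (suc (pred (e p))) ≡⟨ 𝟘-∷ʳ (pred (e p)) ⟩
        𝟘 (pred (e p)) ∷ʳ 0 ≡⟨ cong (_∷ʳ 0) (∷-injectiveʳ (trans (cong 𝟘 (suc-pred (e p) {{>-nonZero 0<eₚ}})) eq)) ⟩
        w ∷ʳ 0 ∎
      Φp0 : Φ (p ∷ 0 ∷ []) ≡ w ++ 𝟘 (2 + e 0) ++ σ 0 ∷ []
      Φp0 = begin
        Φ (p ∷ 0 ∷ [])                             ≡⟨ Φ-∷ p (0 ∷ []) ⟩
        𝟘 (e p) ++ σ p ∷ Φ (0 ∷ [])                ≡⟨ cong₂ (λ v j → v ++ j ∷ Φ (0 ∷ [])) (trans eq comm) σ-p ⟩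
        (w ∷ʳ 0) ++ 0 ∷ Φ (0 ∷ [])                 ≡⟨ ++-assoc w [ 0 ] _ ⟩
        w ++ 0 ∷ 0 ∷ Φ (0 ∷ [])                    ≡⟨ cong (λ v → w ++ 0 ∷ 0 ∷ v) (Φ-∷ 0 []) ⟩
        w ++ 𝟘 (2 + e 0) ++ σ 0 ∷ []               ∎
  -- The zeros just before the occurrence commute with it, so it can be slid to the left until it
  -- meets a nonzero letter or the start of the word.
  run-left : ∀ {k r} → Fac k (𝟘 r) → Pre (𝟘 r) ⊎ ∃ λ j → Fac k (suc j ∷ 𝟘 r)
  run-left {k} {r} (fac x y eq) with lastNonzero x
  ... | inj₁ (i , refl) = inj₁ (pre k (𝟘 i ++ y) (begin
    iter k                  ≡⟨ eq ⟩
    𝟘 i ++ 𝟘 r ++ y         ≡⟨ 𝟘-++-comm i r y ⟩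
    𝟘 r ++ 𝟘 i ++ y         ∎))
    where open ≡-Reasoning
  ... | inj₂ (x₁ , j , i , refl) = inj₂ (j , fac x₁ (𝟘 i ++ y) (begin
    iter k                                ≡⟨ eq ⟩
    (x₁ ++ suc j ∷ 𝟘 i) ++ 𝟘 r ++ y       ≡⟨ ++-assoc x₁ (suc j ∷ 𝟘 i) _ ⟩
    x₁ ++ suc j ∷ 𝟘 i ++ 𝟘 r ++ y         ≡⟨ cong (λ v → x₁ ++ suc j ∷ v) (𝟘-++-comm i r y) ⟩
    x₁ ++ suc j ∷ 𝟘 r ++ 𝟘 i ++ y         ∎))
    where open ≡-Reasoning

  nonPrefixLeftSpecial-run : 0 < e p → NonPrefixLeftSpecial
  nonPrefixLeftSpecial-run 0<eₚ = from (longRun 0<eₚ)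
    where
    ¬Pre : ¬ Pre (𝟘 (suc (e 0)))
    ¬Pre h = ¬Pre-𝟘 (subst Pre (𝟘-∷ʳ (e 0)) h)
    from : Factor (𝟘 (2 + e 0)) → NonPrefixLeftSpecial
    from (k , f) with run-left {k} {suc (e 0)} (Fac-suffix [ 0 ] (𝟘 (suc (e 0))) f)
    ... | inj₁ h       = ⊥-elim (¬Pre h)
    ... | inj₂ (j , g) = 𝟘 (suc (e 0)) , 0 , suc j , 0≢1+n , (k , f) , (k , g) , ¬Pre

  -- Images of letters when the last digit is 1

  module UnitLastDigit (eₚ≡0 : e p ≡ 0) where

    Φ-p : ∀ w → Φ (p ∷ w) ≡ 0 ∷ Φ w
    Φ-p w = trans (Φ-∷ p w) (cong₂ (λ r j → 𝟘 r ++ j ∷ Φ w) eₚ≡0 σ-p)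

    Φ-≢p : ∀ {a} → a ≢ p → ∀ w → Φ (a ∷ w) ≡ 𝟘 (e a) ++ suc a ∷ Φ w
    Φ-≢p {a} a≢p w = trans (Φ-∷ a w) (cong (λ j → 𝟘 (e a) ++ j ∷ Φ w) (σ-≢p a≢p))

    -- The image of `p` is the single letter 0 and merges with the zeros of the next block, which is
    -- the image of 0. This is where the bound `suc (e 0)` on runs comes from.
    Φ-p0 : ∀ w → Φ (p ∷ 0 ∷ w) ≡ 𝟘 (suc (e 0)) ++ 1 ∷ Φ w
    Φ-p0 w = trans (Φ-p (0 ∷ w)) (cong (0 ∷_) (Φ-≢p (<⇒≢ 0<p) w))

    -- Step b s b′: the image of b, completed by that of the letter 0 if b = p, starts with 0ˢb′.
    data Step : ℕ → ℕ → ℕ → Set where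
      below : ∀ {b s} → b ≢ p → s < e b → Step b s 0
      exact : ∀ {b} → b ≢ p → Step b (e b) (suc b)
      wrap  : ∀ {s} → s ≤ e 0 → Step p s 0
      wrap₁ : Step p (suc (e 0)) 1

    -- The image of `b`, completed as in `Step`, starts with `s` zeros. Nothing is said about the
    -- letter after them, as is needed for words that end within a run.
    Room : ℕ → ℕ → Set
    Room b s = (b ≢ p × s ≤ e b) ⊎ (b ≡ p × s ≤ suc (e 0))

    decode-step : ∀ {k} b z s {b′ y} → Fac k (b ∷ z) → Φ (b ∷ z) ≡ 𝟘 s ++ b′ ∷ y → Step b s b′
    decode-step b z s f eq with b ≟ p
    decode-step b z s f eq | no b≢p with run-next (e b) s (trans (sym (Φ-≢p b≢p z)) eq)
    ... | inj₁ (s<e , refl)  = below b≢p s<e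
    ... | inj₂ (refl , refl) = exact b≢p
    decode-step b []      s f eq | yes refl with s | trans (sym (Φ-p [])) eq
    ... | zero        | refl = wrap z≤n
    ... | suc zero    | ()
    ... | suc (suc _) | ()
    decode-step b (x ∷ z) s f eq | yes refl with after-p (Fac-prefix (p ∷ x ∷ []) z f)
    ... | refl with run-next (suc (e 0)) s (trans (sym (Φ-p0 z)) eq)
    ... | inj₁ (s<e , refl)  = wrap (s≤s⁻¹ s<e)
    ... | inj₂ (refl , refl) = wrap₁

    decode-room : ∀ {k} b z s {y} → Fac k (b ∷ z) → Φ (b ∷ z) ≡ 𝟘 s ++ y → Room b s
    decode-room b z s f eq with b ≟ p
    decode-room b z s f eq | no b≢p = inj₁ (b≢p , run-bound (e b) s (trans (sym (Φ-≢p b≢p z)) eq))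
    decode-room b []      s f eq | yes refl with s | trans (sym (Φ-p [])) eq
    ... | zero        | _  = inj₂ (refl , z≤n)
    ... | suc zero    | _  = inj₂ (refl , s≤s z≤n)
    ... | suc (suc _) | ()
    decode-room b (x ∷ z) s f eq | yes refl with after-p (Fac-prefix (p ∷ x ∷ []) z f)
    ... | refl = inj₂ (refl , run-bound (suc (e 0)) s (trans (sym (Φ-p0 z)) eq))

    decode-next : ∀ {k} z₁ j z₂ s {b y} → iter k ≡ z₁ ++ j ∷ z₂ → Φ z₂ ≡ (𝟘 s ∷ʳ b) ++ y →
                  ∃₂ λ β z₃ → z₂ ≡ β ∷ z₃ × Step β s b
    decode-next z₁ j []       zero    eq ()
    decode-next z₁ j []       (suc s) eq ()
    decode-next {k} z₁ j (β ∷ z₃) s {b} {y} eq eq′ =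
      β , z₃ , refl , decode-step {k} β z₃ s (Fac-suffix (z₁ ∷ʳ j) (β ∷ z₃) (fac [] [] (trans eq (sym reassoc))))
        (trans eq′ (++-assoc (𝟘 s) [ b ] y))
      where
      reassoc : ((z₁ ∷ʳ j) ++ β ∷ z₃) ++ [] ≡ z₁ ++ j ∷ β ∷ z₃
      reassoc = trans (++-identityʳ _) (++-assoc z₁ [ j ] (β ∷ z₃))

    ext : ℕ → List ℕ
    ext b with b ≟ p
    ... | yes _ = [ 0 ]
    ... | no _  = []

    Factor-ext : ∀ x b → Factor (x ∷ʳ b) → Factor (x ++ b ∷ ext b)
    Factor-ext x b f with b ≟ p
    Factor-ext x b f       | no _ = f
    Factor-ext x b (k , f) | yes refl with Fac-extend f
    ... | c , k′ , g with after-p (Fac-suffix x (p ∷ c ∷ []) (subst (Fac k′) (++-assoc x [ p ] [ c ]) g))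
    ... | refl = k′ , subst (Fac k′) (++-assoc x [ p ] [ 0 ]) g

    Pre-ext : ∀ x b → Pre (x ∷ʳ b) → Pre (x ++ b ∷ ext b)
    Pre-ext x b f with b ≟ p
    Pre-ext x b f | no _ = f
    Pre-ext x b f | yes refl with Pre-extend f
    ... | c , g with Pre⇒Factor g
    ... | k′ , h with after-p (Fac-suffix x (p ∷ c ∷ []) (subst (Fac k′) (++-assoc x [ p ] [ c ]) h))
    ... | refl = subst Pre (++-assoc x [ p ] [ 0 ]) g

    Φ-ext-≢p : ∀ {b} → b ≢ p → Φ (b ∷ ext b) ≡ 𝟘 (e b) ++ suc b ∷ []
    Φ-ext-≢p {b} b≢p with b ≟ p
    ... | yes b≡p = ⊥-elim (b≢p b≡p)
    ... | no _    = Φ-≢p b≢p []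

    Φ-ext-p : Φ (p ∷ ext p) ≡ 𝟘 (suc (e 0)) ++ 1 ∷ []
    Φ-ext-p with p ≟ p
    ... | yes _ = Φ-p0 []
    ... | no ≢  = ⊥-elim (≢ refl)

    Step-word : ∀ {b s b′} → Step b s b′ → ∃ λ r → Φ (b ∷ ext b) ≡ 𝟘 s ++ b′ ∷ r
    Step-word {b} {s} (below b≢p s<e) with 𝟘-prefix-0 s<e
    ... | w , eq = w ++ suc b ∷ [] , trans (Φ-ext-≢p b≢p) (trans (cong (_++ suc b ∷ []) eq) (++-assoc (𝟘 s) (0 ∷ w) _))
    Step-word (exact b≢p) = [] , Φ-ext-≢p b≢p
    Step-word {b} {s} (wrap s≤e) with 𝟘-prefix-0 (s≤s s≤e)
    ... | w , eq = w ++ 1 ∷ [] , trans Φ-ext-p (trans (cong (_++ 1 ∷ []) eq) (++-assoc (𝟘 s) (0 ∷ w) _))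
    Step-word wrap₁ = [] , Φ-ext-p

    Room-word : ∀ {b s} → Room b s → ∃ λ r → Φ (b ∷ ext b) ≡ 𝟘 s ++ r
    Room-word {b} {s} (inj₁ (b≢p , s≤e)) with 𝟘-prefix s≤e
    ... | w , eq = w ++ suc b ∷ [] , trans (Φ-ext-≢p b≢p) (trans (cong (_++ suc b ∷ []) eq) (++-assoc (𝟘 s) w _))
    Room-word {b} {s} (inj₂ (refl , s≤e)) with 𝟘-prefix s≤e
    ... | w , eq = w ++ 1 ∷ [] , trans Φ-ext-p (trans (cong (_++ 1 ∷ []) eq) (++-assoc (𝟘 s) w _))

    private
      step-eq : ∀ x {b s b′ r} → Φ (b ∷ ext b) ≡ 𝟘 s ++ b′ ∷ r →
                Φ (x ++ b ∷ ext b) ≡ ((Φ x ++ 𝟘 s) ∷ʳ b′) ++ r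
      step-eq x {b} {s} {b′} {r} eq = begin
        Φ (x ++ b ∷ ext b)              ≡⟨ Φ-++ x (b ∷ ext b) ⟩
        Φ x ++ Φ (b ∷ ext b)            ≡⟨ cong (Φ x ++_) eq ⟩
        Φ x ++ 𝟘 s ++ b′ ∷ r            ≡⟨ ++-assoc (Φ x) (𝟘 s) _ ⟨
        (Φ x ++ 𝟘 s) ++ b′ ∷ r          ≡⟨ ++-assoc (Φ x ++ 𝟘 s) [ b′ ] r ⟨
        ((Φ x ++ 𝟘 s) ∷ʳ b′) ++ r       ∎
        where open ≡-Reasoning

    Factor-step : ∀ x {b s b′} → Factor (x ∷ʳ b) → Step b s b′ → Factor ((Φ x ++ 𝟘 s) ∷ʳ b′)
    Factor-step x {b} f st with Factor-ext x b f | Step-word st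
    ... | k , g | r , eq = suc k , Fac-prefix _ r (subst (Fac (suc k)) (step-eq x eq) (Fac-Φ g))

    Pre-step : ∀ x {b s b′} → Pre (x ∷ʳ b) → Step b s b′ → Pre ((Φ x ++ 𝟘 s) ∷ʳ b′)
    Pre-step x {b} f st with Step-word st
    ... | r , eq = Pre-prefix _ r (subst Pre (step-eq x eq) (Pre-Φ (Pre-ext x b f)))

    -- Of the block on the left only its last letter `σ a` is kept. As `σ` is injective, different
    -- left letters stay different.
    Factor-step-∷ : ∀ a x {b s b′} → Factor (a ∷ x ∷ʳ b) → Step b s b′ → Factor (σ a ∷ (Φ x ++ 𝟘 s) ∷ʳ b′)
    Factor-step-∷ a x {b} {s} {b′} f st =
      let (k , g) = Factor-step (a ∷ x) f st
      in k , Fac-suffix (𝟘 (e a)) _ (subst (Fac k) eq g)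
      where
      open ≡-Reasoning
      eq : (Φ (a ∷ x) ++ 𝟘 s) ∷ʳ b′ ≡ 𝟘 (e a) ++ σ a ∷ (Φ x ++ 𝟘 s) ∷ʳ b′
      eq = begin
        (Φ (a ∷ x) ++ 𝟘 s) ∷ʳ b′                   ≡⟨ cong (λ v → (v ++ 𝟘 s) ∷ʳ b′) (Φ-∷ a x) ⟩
        ((𝟘 (e a) ++ σ a ∷ Φ x) ++ 𝟘 s) ∷ʳ b′      ≡⟨ cong (_∷ʳ b′) (++-assoc (𝟘 (e a)) (σ a ∷ Φ x) (𝟘 s)) ⟩
        (𝟘 (e a) ++ σ a ∷ Φ x ++ 𝟘 s) ∷ʳ b′        ≡⟨ ++-assoc (𝟘 (e a)) (σ a ∷ Φ x ++ 𝟘 s) [ b′ ] ⟩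
        𝟘 (e a) ++ σ a ∷ (Φ x ++ 𝟘 s) ∷ʳ b′        ∎

    Pre-room : ∀ x {b s} → Pre (x ∷ʳ b) → Room b s → Pre (Φ x ++ 𝟘 s)
    Pre-room x {b} {s} f room with Room-word room
    ... | r , eq = Pre-prefix _ r (subst Pre (trans (Φ-++ x _) (trans (cong (Φ x ++_) eq) (sym (++-assoc (Φ x) (𝟘 s) r)))) (Pre-Φ (Pre-ext x b f)))

-- Powers of unbordered words

Match : (ℕ → ℕ) → ℕ → ℕ → Set
Match e o k = ∀ i → i < k → e (o + i) ≡ e i

-- The lexicographic condition in the form in which it is applied: after `k` matching digits the
-- next one is not larger. It is restricted to indices below `p`, because `e p` is `t_m - 1` and not
-- a digit.
Parry : ℕ → (ℕ → ℕ) → Set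
Parry p e = ∀ o k → 0 < o → Match e o k → o + k < p → e (o + k) ≤ e k

Match-suc : ∀ e o k → Match e o k → e (o + k) ≡ e k → Match e o (suc k)
Match-suc e o k m eq i (s≤s i≤k) with i ≟ k
... | yes refl = eq
... | no i≢k   = m i (≤∧≢⇒< i≤k i≢k)

Match-0 : ∀ e o → Match e o 0
Match-0 e o i ()

Parry⇒≤e₀ : ∀ {p e} → Parry p e → ∀ {b} → b < p → e b ≤ e 0
Parry⇒≤e₀ parry {zero}  _   = ≤-refl
Parry⇒≤e₀ {p} {e} parry {suc b} b<p =
  subst (λ c → e c ≤ e 0) (+-identityʳ (suc b)) (parry (suc b) 0 z<s (Match-0 e (suc b)) (subst (_< p) (sym (+-identityʳ (suc b))) b<p))

period⇒* : ∀ {p d} {e : ℕ → ℕ} → (∀ i → i + d < p → e (i + d) ≡ e i) → ∀ l i → i + l * d < p → e (i + l * d) ≡ e i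
period⇒* {p} {d} {e} period zero    i _ = cong e (+-identityʳ i)
period⇒* {p} {d} {e} period (suc l) i h = trans (cong e (shift i d (l * d)))
  (trans (period (i + l * d) (subst (_< p) (shift i d (l * d)) h))
         (period⇒* {e = e} period l i (≤-<-trans (+-monoʳ-≤ i (m≤n+m (l * d) d)) h)))
  where
  shift : ∀ a b c → a + (b + c) ≡ (a + c) + b
  shift = solve-∀

record UnborderedRoot (p : ℕ) (e : ℕ → ℕ) (d : ℕ) : Set where
  field
    0<d        : 0 < d
    q          : ℕ
    p≡q*d      : p ≡ q * d
    period     : ∀ i → i + d < p → e (i + d) ≡ e i
    unbordered : ∀ o b → 0 < o → 0 < b → d ≡ o + b → ¬ Match e o b

module Affine (p : ℕ) (e : ℕ → ℕ) (0<p : 0 < p) (0<e₀ : 0 < e 0) (eₚ≡0 : e p ≡ 0)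
  (parry : Parry p e) (d : ℕ) (root : UnborderedRoot p e d) where

  open LeftSpecial p e 0<p 0<e₀
  open UnitLastDigit eₚ≡0
  open UnborderedRoot root

  private
    instance
      d≢0 : NonZero d
      d≢0 = >-nonZero 0<d

    ≤e₀ : ∀ {b} → b < p → e b ≤ e 0
    ≤e₀ = Parry⇒≤e₀ parry

  period* : ∀ l i → i + l * d < p → e (i + l * d) ≡ e i
  period* = period⇒* {e = e} period

  -- The last `c % d` letters of such a border start a copy of the root, and as the end of the whole
  -- word they also end a copy. If there were any, they would be a border of the root.
  border⇒d∣ : ∀ o c → 0 < o → p ≡ o + c → Match e o c → d ∣ c
  border⇒d∣ o c 0<o p≡ m with c % d in eq
  ... | zero  = divides (c / d) (trans (m≡m%n+[m/n]*n c d) (cong (_+ c / d * d) eq))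
  ... | suc r with q | p≡q*d
  ...   | zero   | p≡0 = ⊥-elim (<⇒≢ 0<p (sym p≡0))
  ...   | suc q′ | p≡d+q′d = ⊥-elim (unbordered o′ (suc r) (m<n⇒0<n∸m r<d) z<s d≡ border)
    where
    open ≡-Reasoning
    k o′ : ℕ
    k = c / d
    o′ = d ∸ suc r
    c≡ : c ≡ suc r + k * d
    c≡ = trans (m≡m%n+[m/n]*n c d) (cong (_+ k * d) eq)
    r<d : suc r < d
    r<d = subst (_< d) eq (m%n<n c d)
    d≡ : d ≡ o′ + suc r
    d≡ = sym (m∸n+n≡m (<⇒≤ r<d))
    -- The last `suc r` letters of the word begin at `o + k * d`, which is place `o′` in the last
    -- copy of the root.
    shift : o + k * d ≡ o′ + q′ * d
    shift = +-cancelˡ-≡ (suc r) _ _ (begin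
      suc r + (o + k * d)      ≡⟨ lemma (suc r) o (k * d) ⟩
      o + (suc r + k * d)      ≡⟨ cong (o +_) c≡ ⟨
      o + c                    ≡⟨ p≡ ⟨
      p                        ≡⟨ p≡d+q′d ⟩
      d + q′ * d               ≡⟨ cong (_+ q′ * d) d≡ ⟩
      o′ + suc r + q′ * d      ≡⟨ lemma′ o′ (suc r) (q′ * d) ⟩
      suc r + (o′ + q′ * d)    ∎)
      where
      lemma : ∀ a b c → a + (b + c) ≡ b + (a + c)
      lemma = solve-∀
      lemma′ : ∀ a b c → a + b + c ≡ b + (a + c)
      lemma′ = solve-∀
    border : Match e o′ (suc r)
    border i i<r = begin
      e (o′ + i)             ≡⟨ period* q′ (o′ + i) <p ⟨
      e (o′ + i + q′ * d)    ≡⟨ cong e swap ⟩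
      e (o + (i + k * d))    ≡⟨ m (i + k * d) i+kd<c ⟩
      e (i + k * d)          ≡⟨ period* k i (<-≤-trans i+kd<c (subst (c ≤_) (sym p≡) (m≤n+m c o))) ⟩
      e i                    ∎
      where
      i+kd<c : i + k * d < c
      i+kd<c = subst (i + k * d <_) (sym c≡) (+-monoˡ-< (k * d) i<r)
      lemma : ∀ a b c → a + b + c ≡ b + (a + c)
      lemma = solve-∀
      lemma′ : ∀ a b c → b + (a + c) ≡ a + (b + c)
      lemma′ = solve-∀
      swap : o′ + i + q′ * d ≡ o + (i + k * d)
      swap = trans (lemma o′ i (q′ * d)) (trans (cong (i +_) (sym shift)) (lemma′ o i (k * d)))
      <p : o′ + i + q′ * d < p
      <p = subst₂ _<_ (sym swap) (sym p≡) (+-monoʳ-< o i+kd<c)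

  -- While the prefix continues with c, F c is the letter descending from an occurrence of
  -- the letter p at the last multiple of d before c.
  F : ℕ → ℕ
  F zero = 0
  F (suc c) with d ∣? c
  ... | yes _ = 0
  ... | no _ with e (F c) ≟ e c
  ...   | yes _ = suc (F c)
  ...   | no _  = 0

  -- By `border⇒d∣` the letter `p` can compete with `c` only at multiples of `d`. There `F c` is 0,
  -- whose digit equals that of `c`, so the two candidates never clash.
  top : ℕ → ℕ
  top c with d ∣? c
  ... | yes _ = p
  ... | no _  = F c

  F-restart : ∀ c → d ∣ c → F (suc c) ≡ 0
  F-restart c d∣c with d ∣? c
  ... | yes _   = refl
  ... | no d∤c  = ⊥-elim (d∤c d∣c)

  F-advance : ∀ c → ¬ d ∣ c → e (F c) ≡ e c → F (suc c) ≡ suc (F c)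
  F-advance c d∤c eq with d ∣? c
  ... | yes d∣c = ⊥-elim (d∤c d∣c)
  ... | no _ with e (F c) ≟ e c
  ...   | yes _ = refl
  ...   | no ≢  = ⊥-elim (≢ eq)

  -- `o` is the place of the last reset of `F`, and it lies in the same period as `c`. Periods are
  -- intervals open on the left and closed on the right, because `F` is reset one place after a
  -- multiple of `d`.
  F-match : ∀ c → 0 < c → ∃₂ λ o l → c ≡ o + F c × l * d < o × c ≤ d + l * d × Match e o (F c)
  F-match (suc c) _ with d ∣? c
  ... | yes (divides l refl) =
    suc (l * d) , l , sym (+-identityʳ _) , ≤-refl , +-monoˡ-≤ (l * d) 0<d , Match-0 e _
  ... | no d∤c with F-match c (n≢0⇒n>0 λ { refl → d∤c (d ∣0) })
  ...   | o , l , c≡ , l<o , c≤ , m with e (F c) ≟ e c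
  ...     | yes eq = o , l , trans (cong suc c≡) (sym (+-suc o (F c))) , l<o , c<
                   , Match-suc e o (F c) m (trans (cong e (sym c≡)) (sym eq))
    where
    c< : suc c ≤ d + l * d
    c< = ≤∧≢⇒< c≤ λ { refl → d∤c (divides (suc l) refl) }
  ...     | no _   = suc c , l , sym (+-identityʳ _) , m≤n⇒m≤1+n (<-≤-trans l<o (subst (o ≤_) (sym c≡) (m≤m+n o (F c))))
                   , c< , Match-0 e _
    where
    c< : suc c ≤ d + l * d
    c< = ≤∧≢⇒< c≤ λ { refl → d∤c (divides (suc l) refl) }

  F≤ : ∀ c → F c ≤ c
  F≤ zero    = z≤n
  F≤ (suc c) with F-match (suc c) z<s
  ... | o , _ , c≡ , _ = subst (F (suc c) ≤_) (sym c≡) (m≤n+m _ o)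

  -- The digits matched since the last reset end at the end of a period; a nonzero number of them
  -- would form a border of the root.
  F-multiple : ∀ c → 0 < c → c ≤ p → d ∣ c → F c ≡ 0
  F-multiple c 0<c c≤p (divides m refl) with F-match (m * d) 0<c
  ... | o , l , c≡ , l<o , c≤ , match with F (m * d)
  ...   | zero  = refl
  ...   | suc f with m≤n⇒∃[o]m+o≡n (<⇒≤ l<o)
  ...     | o′ , refl = ⊥-elim (unbordered o′ (suc f) 0<o′ z<s d≡ border)
    where
    0<o′ : 0 < o′
    0<o′ = n≢0⇒n>0 λ { refl → <-irrefl (sym (+-identityʳ (l * d))) l<o }
    l<m : l < m
    l<m = *-cancelʳ-< d l m (<-≤-trans l<o (subst (l * d + o′ ≤_) (sym c≡) (m≤m+n _ (suc f))))
    m≡ : m ≡ suc l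
    m≡ = ≤-antisym (*-cancelʳ-≤ m (suc l) d c≤) l<m
    d≡ : d ≡ o′ + suc f
    d≡ = +-cancelˡ-≡ (l * d) _ _ (trans (+-comm (l * d) d) (trans (cong (_* d) (sym m≡)) (trans c≡ (+-assoc (l * d) o′ (suc f)))))
    swap : ∀ a b c → b + c + a ≡ a + b + c
    swap = solve-∀
    border : Match e o′ (suc f)
    border i i<f = trans
      (sym (period* l (o′ + i) (<-≤-trans (subst₂ _<_ (sym (swap (l * d) o′ i)) (sym c≡) (+-monoʳ-< (l * d + o′) i<f)) c≤p)))
      (trans (cong e (swap (l * d) o′ i)) (match i i<f))

  -- Possible letters b after an occurrence of a prefix v, where the prefix itself continues with c.
  -- Only the letter top c can have a longer run of zeros in its image than c.
  data Inv (c b : ℕ) : Set where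
    same    : b ≡ c → Inv c b
    lower   : ∀ o → 0 < o → b ≡ o + c → b ≤ p → Match e o c → Inv c b
    regular : ∀ l → c ≡ b + suc l * d → Inv c b
    exc     : 0 < c → b ≡ F c → Inv c b

  Over : ℕ → ℕ → Set
  Over c b = b ≡ p ⊎ (b ≢ p × e c < e b)

  over⇒top : ∀ c b → c < p → Inv c b → Over c b → b ≡ top c
  over⇒top c b c<p (same refl) (inj₁ refl)     = ⊥-elim (<-irrefl refl c<p)
  over⇒top c b c<p (same refl) (inj₂ (_ , lt)) = ⊥-elim (<-irrefl refl lt)
  over⇒top c b c<p (lower o 0<o refl b≤p m) (inj₁ b≡p) with d ∣? c
  ... | yes _  = b≡p
  ... | no d∤c = ⊥-elim (d∤c (border⇒d∣ o c 0<o (sym b≡p) m))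
  over⇒top c b c<p (lower o 0<o refl b≤p m) (inj₂ (b≢p , lt)) =
    ⊥-elim (<⇒≱ lt (parry o c 0<o m (≤∧≢⇒< b≤p b≢p)))
  over⇒top c b c<p (regular l refl) (inj₁ refl)     = ⊥-elim (m+n≮m b _ c<p)
  over⇒top c b c<p (regular l refl) (inj₂ (_ , lt)) = ⊥-elim (<⇒≢ lt (period* (suc l) b c<p))
  over⇒top c b c<p (exc 0<c refl) over with d ∣? c
  ... | no _    = refl
  ... | yes d∣c@(divides m refl) with F (m * d) | F-multiple (m * d) 0<c (<⇒≤ c<p) d∣c | over
  ...   | _ | refl | inj₁ refl     = ⊥-elim (<-irrefl refl 0<p)
  ...   | _ | refl | inj₂ (_ , lt) = ⊥-elim (<⇒≢ lt (period* m 0 c<p))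

  F-over : ∀ c → c < p → Over c (top c) → F (suc c) ≡ 0
  F-over c c<p over with d ∣? c
  ... | yes _ = refl
  F-over c c<p (inj₁ F≡p)      | no d∤c = ⊥-elim (<⇒≱ c<p (subst (_≤ c) F≡p (F≤ c)))
  F-over c c<p (inj₂ (_ , lt)) | no d∤c with e (F c) ≟ e c
  ... | yes eq = ⊥-elim (<⇒≢ lt (sym eq))
  ... | no _   = refl

  Inv-0 : ∀ {b} → b ≤ p → Inv 0 b
  Inv-0 {zero}  _   = same refl
  Inv-0 {suc b} b≤p = lower (suc b) z<s (sym (+-identityʳ _)) b≤p (Match-0 e _)

  -- A letter that overtakes `γ` is `top γ` and restarts at 0, just where `F` restarts. A letter
  -- with an equal digit advances along with `γ`. At a positive multiple of `d` the exceptional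
  -- letter is 0 and turns `regular`, which leaves `exc` to the descendant of `p`.
  Inv-step : ∀ {γ β s c b} → γ ≤ p → β ≤ p → b ≤ p → Inv γ β → Step γ s c → Step β s b → Inv c b
  Inv-step γ≤p β≤p b≤p inv (below _ _) _ = Inv-0 b≤p
  Inv-step γ≤p β≤p b≤p inv (wrap _)    _ = Inv-0 b≤p
  Inv-step γ≤p β≤p b≤p inv wrap₁ st = go β≤p st refl
    where
    go : ∀ {β s b} → β ≤ p → Step β s b → s ≡ suc (e 0) → Inv 1 b
    go β≤p (below β≢p lt) refl = ⊥-elim (<⇒≱ lt (≤-trans (≤e₀ (≤∧≢⇒< β≤p β≢p)) (n≤1+n _)))
    go β≤p (exact β≢p)    eq   = ⊥-elim (<-irrefl refl (subst (_≤ e 0) eq (≤e₀ (≤∧≢⇒< β≤p β≢p))))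
    go β≤p (wrap le)      refl = ⊥-elim (<-irrefl refl le)
    go β≤p wrap₁          _    = same refl
  Inv-step {γ} {β} γ≤p β≤p b≤p inv (exact γ≢p) st = go inv st refl
    where
    γ<p : γ < p
    γ<p = ≤∧≢⇒< γ≤p γ≢p
    from-top : ∀ {β} → Inv γ β → Over γ β → Inv (suc γ) 0
    from-top {β} inv over = exc z<s (sym (F-over γ γ<p (subst (Over γ) (over⇒top γ β γ<p inv over) over)))
    go : ∀ {β s b} → Inv γ β → Step β s b → s ≡ e γ → Inv (suc γ) b
    go inv (below β≢p lt) refl = from-top inv (inj₂ (β≢p , lt))
    go inv (wrap _)       _    = from-top inv (inj₁ refl)
    go inv wrap₁          eq   = ⊥-elim (<-irrefl refl (subst (_≤ e 0) (sym eq) (≤e₀ γ<p)))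
    go (same refl) (exact _) _ = same refl
    go {β} (lower o 0<o refl β≤p m) (exact β≢p) eq =
      lower o 0<o (sym (+-suc o γ)) (≤∧≢⇒< β≤p β≢p) (Match-suc e o γ m eq)
    go (regular l refl) (exact _) _ = regular l refl
    go {β} (exc 0<γ refl) (exact β≢p) eq with d ∣? γ
    ... | no d∤γ = exc z<s (sym (F-advance γ d∤γ eq))
    ... | yes (divides zero γ≡) = ⊥-elim (<⇒≢ 0<γ (sym γ≡))
    ... | yes d∣γ@(divides (suc l) γ≡) =
      regular l (cong suc (trans γ≡ (cong (_+ suc l * d) (sym (F-multiple γ 0<γ γ≤p d∣γ)))))

  -- Induction on the level. After its last nonzero letter `v` is a run of zeros; the part before it
  -- desubstitutes to a prefix one level lower, followed by `γ` and `β`, from which `c` and `b`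
  -- arise in one step.
  nextLetter : ∀ k v b c → Pre (v ∷ʳ c) → Fac k (v ∷ʳ b) → Inv c b
  nextLetter zero    []          b c h (fac [] _ eq) rewrite ∷-injectiveˡ (sym eq) | Pre-head h = same refl
  nextLetter zero    []          b c h (fac (_ ∷ []) _ ())
  nextLetter zero    []          b c h (fac (_ ∷ _ ∷ _) _ ())
  nextLetter zero    (_ ∷ [])    b c h (fac [] _ ())
  nextLetter zero    (_ ∷ _ ∷ _) b c h (fac [] _ ())
  nextLetter zero    (_ ∷ _)     b c h (fac (_ ∷ []) _ ())
  nextLetter zero    (_ ∷ _)     b c h (fac (_ ∷ _ ∷ _) _ ())
  nextLetter (suc k) v b c h f with lastNonzero v
  ... | inj₁ (s , refl) = afterZeros h f
    where
    b≤p : ∀ {s} → Fac (suc k) (𝟘 s ∷ʳ b) → b ≤ p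
    b≤p {s} f = Fac-∷≤p (Fac-suffix (𝟘 s) [ b ] f)
    -- If the run before this letter were shorter in its own block than `e 0`, a 0 would end the
    -- preceding block. This 0 is `σ p`, so `p` would be followed by `suc b` instead of 0.
    large : ∀ {b} → Fac (suc k) (𝟘 (e 0) ∷ʳ suc (suc b)) → e 0 ≤ e (suc b)
    large {b} (fac x y eq) with cut (iter k) (x ++ 𝟘 (e 0)) (trans eq (trans (cong (x ++_) (++-assoc (𝟘 (e 0)) (suc (suc b) ∷ []) y)) (sym (++-assoc x (𝟘 (e 0)) _))))
    ... | z₁ , z₂ , eq₁ , _ , eq₂ , _ with e 0 ≤? e (suc b)
    ...   | yes le = le
    ...   | no ≰ with m≤n⇒∃[o]m+o≡n (≰⇒> ≰)
    ...     | o , e₀≡ with lastBlock z₁ (++-cancelʳ (𝟘 (e (suc b))) (Φ z₁) ((x ++ 𝟘 o) ∷ʳ 0) (begin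
      Φ z₁ ++ 𝟘 (e (suc b))                  ≡⟨ eq₂ ⟨
      x ++ 𝟘 (e 0)                           ≡⟨ cong (λ r → x ++ 𝟘 r) (trans (sym e₀≡) (cong suc (+-comm (e (suc b)) o))) ⟩
      x ++ 𝟘 (suc o + e (suc b))             ≡⟨ cong (x ++_) (𝟘-+ (suc o) (e (suc b))) ⟩
      x ++ 𝟘 (suc o) ++ 𝟘 (e (suc b))        ≡⟨ ++-assoc x (𝟘 (suc o)) _ ⟨
      (x ++ 𝟘 (suc o)) ++ 𝟘 (e (suc b))      ≡⟨ cong (_++ 𝟘 (e (suc b))) (++-𝟘-∷ʳ x o) ⟨
      ((x ++ 𝟘 o) ∷ʳ 0) ++ 𝟘 (e (suc b))     ∎))
      where open ≡-Reasoning
    ...       | z₃ , a , refl , σa≡0 , _ with σ-injective (trans σa≡0 (sym σ-p))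
    ...         | refl = ⊥-elim (1+n≢0 (after-p {k} (fac z₃ z₂ (trans eq₁ (++-assoc z₃ [ p ] _)))))
    afterZeros : ∀ {s} → Pre (𝟘 s ∷ʳ c) → Fac (suc k) (𝟘 s ∷ʳ b) → Inv c b
    afterZeros {s} h f with s <? e 0
    ... | yes s<e₀ with 𝟘-prefix-0 s<e₀
    ...   | w , eq with Pre-unique (𝟘 s) h (subst Pre (trans (cong (_∷ʳ 1) eq) (++-assoc (𝟘 s) (0 ∷ w) [ 1 ])) Pre-first)
    ...     | refl = Inv-0 (b≤p {s} f)
    afterZeros {s} h f | no s≮e₀ with m≤n⇒m<n∨m≡n (≮⇒≥ s≮e₀)
    ... | inj₁ e₀<s with 𝟘-prefix-0 e₀<s
    ...   | w , eq = ⊥-elim (¬Pre-𝟘 (subst Pre (trans (cong (_∷ʳ c) eq) (++-assoc (𝟘 (e 0)) (0 ∷ w) [ c ])) h))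
    afterZeros {s} h f | no s≮e₀ | inj₂ refl with Pre-unique (𝟘 (e 0)) h Pre-first
    ... | refl = after1 b f
      where
      after1 : ∀ b → Fac (suc k) (𝟘 (e 0) ∷ʳ b) → Inv 1 b
      after1 zero          f = exc z<s (sym (F-restart 0 (d ∣0)))
      after1 (suc zero)    f = same refl
      after1 (suc (suc b)) f = lower (suc b) z<s (+-comm 1 (suc b)) b≤p′
        λ { zero _ → trans (cong e (+-identityʳ (suc b))) (≤-antisym (≤e₀ b≤p′) (large f)) ; (suc _) (s≤s ()) }
        where
        b≤p′ : suc (suc b) ≤ p
        b≤p′ = Fac-∷≤p (Fac-suffix (𝟘 (e 0)) [ suc (suc b) ] f)
  nextLetter (suc k) v b c h f | inj₂ (v₁ , j , s , refl)
    with Fac-cut v₁ (𝟘 s ∷ʳ b) (subst (Fac (suc k)) (++-assoc v₁ (suc j ∷ 𝟘 s) [ b ]) f)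
       | Pre-cut v₁ (𝟘 s ∷ʳ c) (subst Pre (++-assoc v₁ (suc j ∷ 𝟘 s) [ c ]) h)
  ... | x , y , z₁ , z₂ , eq₁ , eq₂ , eq₃ | l , y′ , ζ₁ , ζ₂ , eq₁′ , refl , eq₃′
    with decode-next {k} z₁ j z₂ s eq₁ eq₃ | decode-next {l} ζ₁ j ζ₂ s eq₁′ eq₃′
  ... | β , z₃ , refl , stβ | γ , ζ₃ , refl , stγ
    with sync {z₁} x (reverseView ζ₁) (++-cancelʳ (𝟘 (e j)) (Φ z₁) (x ++ Φ ζ₁) (trans (sym eq₂) (sym (++-assoc x (Φ ζ₁) _))))
  ... | z₀ , refl , _ =
    Inv-step (Fac-∷≤p {l} (Fac-suffix (ζ₁ ∷ʳ j) [ γ ] preγ)) (Fac-∷≤p {k} (Fac-suffix (ζ₁ ∷ʳ j) [ β ] facβ))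
             (Fac-∷≤p {suc k} (Fac-suffix _ [ b ] f))
             (nextLetter k (ζ₁ ∷ʳ j) β γ (pre l ζ₃ (trans eq₁′ (assoc₃ ζ₁ j γ ζ₃))) facβ) stγ stβ
    where
    assoc₃ : ∀ (u : List ℕ) a b w → u ++ a ∷ b ∷ w ≡ (u ∷ʳ a ∷ʳ b) ++ w
    assoc₃ u a b w = sym (trans (++-assoc (u ∷ʳ a) [ b ] w) (++-assoc u [ a ] (b ∷ w)))
    preγ : Fac l (ζ₁ ∷ʳ j ∷ʳ γ)
    preγ = fac [] ζ₃ (trans eq₁′ (assoc₃ ζ₁ j γ ζ₃))
    facβ : Fac k (ζ₁ ∷ʳ j ∷ʳ β)
    facβ = fac z₀ z₃ (trans eq₁ (trans (++-assoc z₀ ζ₁ _) (cong (z₀ ++_) (assoc₃ ζ₁ j β z₃))))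

  runBound : ∀ {k r} z x {y} → Fac k z → Φ z ≡ x ++ 𝟘 r ++ y → r ≤ suc (e 0)
  runBound {r = zero}  z       x       f eq = z≤n
  runBound {r = suc r} []      []      f ()
  runBound {r = suc r} []      (_ ∷ _) f ()
  runBound {k} {r@(suc _)} (β ∷ z) x {y} f eq with run-or-beyond (e β) x (trans (sym (Φ-∷ β z)) eq)
  ... | inj₂ (x′ , refl , eq′) = runBound {k} {r} z x′ (Fac-suffix [ β ] z f) eq′
  ... | inj₁ (i , refl) with decode-room {k} β z (i + r) f (trans eq (trans (sym (++-assoc (𝟘 i) (𝟘 r) y)) (cong (_++ y) (sym (𝟘-+ i r)))))
  ...   | inj₁ (β≢p , le) = ≤-trans (m≤n+m r i) (≤-trans le (≤-trans (≤e₀ (≤∧≢⇒< (Fac-∷≤p f) β≢p)) (n≤1+n _)))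
  ...   | inj₂ (_ , le)   = ≤-trans (m≤n+m r i) le

  Fac-𝟘⇒≤ : ∀ {k r} → Fac (suc k) (𝟘 r) → r ≤ suc (e 0)
  Fac-𝟘⇒≤ {k} {r} (fac x y eq) = runBound {k} {r} (iter k) x (fac [] [] (sym (++-identityʳ _))) eq

  Pre-𝟘 : ∀ {s} → s ≤ e 0 → Pre (𝟘 s)
  Pre-𝟘 {s} s≤ with 𝟘-prefix s≤
  ... | w , eq = Pre-prefix (𝟘 s) (w ∷ʳ 1) (subst Pre (trans (cong (_∷ʳ 1) eq) (++-assoc (𝟘 s) w [ 1 ])) Pre-first)

  room≤ : ∀ {b s} → b ≤ p → Room b s → s ≤ suc (e 0)
  room≤ b≤p (inj₁ (b≢p , le)) = ≤-trans le (≤-trans (≤e₀ (≤∧≢⇒< b≤p b≢p)) (n≤1+n _))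
  room≤ b≤p (inj₂ (_ , le))   = le

  Room? : ∀ b s → Dec (Room b s)
  Room? b s with b ≟ p
  ... | yes b≡p with s ≤? suc (e 0)
  ...   | yes le = yes (inj₂ (b≡p , le))
  ...   | no ≰   = no λ { (inj₁ (b≢p , _)) → b≢p b≡p ; (inj₂ (_ , le)) → ≰ le }
  Room? b s | no b≢p with s ≤? e b
  ...   | yes le = yes (inj₁ (b≢p , le))
  ...   | no ≰   = no λ { (inj₁ (_ , le)) → ≰ le ; (inj₂ (b≡p , _)) → b≢p b≡p }

  ¬room⇒over : ∀ {c β s} → c ≤ p → β ≤ p → ¬ Room c s → Room β s → c < p × Over c β
  ¬room⇒over {c} {β} {s} c≤p β≤p ¬room room = ≤∧≢⇒< c≤p c≢p , over room
    where
    c≢p : c ≢ p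
    c≢p c≡p = ¬room (inj₂ (c≡p , room≤ β≤p room))
    over : Room β s → Over c β
    over (inj₁ (β≢p , le)) = inj₂ (β≢p , <-≤-trans (≰⇒> λ le′ → ¬room (inj₁ (c≢p , le′))) le)
    over (inj₂ (β≡p , _))  = inj₁ β≡p

  -- Induction on the level. If `w` is not a run, then `w = Φ v ++ 𝟘 s` with `v` left special one
  -- level lower, hence a prefix; it remains to see that the prefix `v` continues with a letter that
  -- allows `s` zeros.
  leftSpecial⇒Pre : ∀ k w a a′ → a ≢ a′ → Fac k (a ∷ w) → Fac k (a′ ∷ w) → Pre w
  leftSpecial⇒Pre zero    []      a a′ a≢a′ f f′ = pre 0 [ 0 ] refl
  leftSpecial⇒Pre zero    (_ ∷ _) a a′ a≢a′ (fac [] _ ()) f′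
  leftSpecial⇒Pre zero    (_ ∷ _) a a′ a≢a′ (fac (_ ∷ []) _ ()) f′
  leftSpecial⇒Pre zero    (_ ∷ _) a a′ a≢a′ (fac (_ ∷ _ ∷ _) _ ()) f′
  leftSpecial⇒Pre (suc k) w a a′ a≢a′ f f′ with lastNonzero w
  ... | inj₁ (s , refl) = zeros a a′ a≢a′ f f′
    where
    p-follows : ∀ {j} → suc (e 0) ≤ s → Fac (suc k) (suc j ∷ 𝟘 s) → Fac k (j ∷ p ∷ [])
    p-follows {j} e₀<s f with Fac-cut [] (𝟘 s) f
    ... | x , y , z₁ , z₂ , eq₁ , _ , eq₃ = go z₂ s e₀<s eq₁ eq₃
      where
      go : ∀ z₂ s → suc (e 0) ≤ s → iter k ≡ z₁ ++ j ∷ z₂ → Φ z₂ ≡ 𝟘 s ++ y → Fac k (j ∷ p ∷ [])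
      go []       (suc s) e₀<s eq₁ ()
      go (β ∷ z₃) s       e₀<s eq₁ eq₃
        with decode-room {k} β z₃ s (fac (z₁ ∷ʳ j) [] (trans eq₁ (trans (sym (++-assoc z₁ [ j ] (β ∷ z₃))) (cong ((z₁ ∷ʳ j) ++_) (sym (++-identityʳ (β ∷ z₃))))))) eq₃
      ... | inj₂ (refl , _)   = fac z₁ z₃ eq₁
      ... | inj₁ (β≢p , s≤e) = ⊥-elim (<⇒≱ e₀<s (≤-trans s≤e (≤e₀ (≤∧≢⇒< β≤p β≢p))))
        where
        β≤p : β ≤ p
        β≤p = Fac-∷≤p {k} {β} {[]} (fac (z₁ ∷ʳ j) z₃ (trans eq₁ (sym (++-assoc z₁ [ j ] (β ∷ z₃)))))
    zeros : ∀ a a′ → a ≢ a′ → Fac (suc k) (a ∷ 𝟘 s) → Fac (suc k) (a′ ∷ 𝟘 s) → Pre (𝟘 s)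
    zeros zero    a′      a≢a′ f f′ = Pre-𝟘 (s≤s⁻¹ (Fac-𝟘⇒≤ {k} {suc s} f))
    zeros (suc j) zero    a≢a′ f f′ = Pre-𝟘 (s≤s⁻¹ (Fac-𝟘⇒≤ {k} {suc s} f′))
    zeros (suc j) (suc j′) a≢a′ f f′ with s ≤? e 0
    ... | yes s≤ = Pre-𝟘 s≤
    -- A run longer than `e 0` after a nonzero letter stems from `p`. With two such left letters `p`
    -- would be left special one level lower, hence a prefix.
    ... | no ≰   = ⊥-elim (<⇒≢ 0<p (sym (Pre-head (leftSpecial⇒Pre k [ p ] j j′ (λ { refl → a≢a′ refl })
                     (p-follows (≰⇒> ≰) f) (p-follows (≰⇒> ≰) f′)))))
  leftSpecial⇒Pre (suc k) w a a′ a≢a′ f f′ | inj₂ (w₁ , j , s , refl) with Fac-cut (a ∷ w₁) (𝟘 s) f | Fac-cut (a′ ∷ w₁) (𝟘 s) f′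
  ... | x , y , z₁ , z₂ , eq₁ , eq₂ , eq₃ | x′ , y′ , z₁′ , z₂′ , eq₁′ , eq₂′ , eq₃′
    with desubstitute (z₁′ ∷ʳ j) x x′ (w₁ ∷ʳ suc j) (reverseView (z₁ ∷ʳ j)) a≢a′ (block z₁ eq₂) (block z₁′ eq₂′)
    where
    j≢p : j ≢ p
    j≢p = <⇒≢ (Fac-∷≤p {suc k} (Fac-suffix (a ∷ w₁) (suc j ∷ 𝟘 s) f))
    block : ∀ {a x} z → x ++ a ∷ w₁ ≡ Φ z ++ 𝟘 (e j) → Φ (z ∷ʳ j) ≡ x ++ a ∷ (w₁ ∷ʳ suc j)
    block {a} {x} z eq = trans (Φ-∷ʳ z j) (trans (cong₂ _∷ʳ_ (sym eq) (σ-≢p j≢p)) (++-assoc x (a ∷ w₁) [ suc j ]))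
  ... | v , w₁≡ , b , b′ , b≢b′ , z₀ , z₀′ , z₁≡ , z₁′≡ =
    subst Pre (trans (cong (_++ 𝟘 s) (sym w₁≡)) (++-assoc w₁ [ suc j ] (𝟘 s)))
      (finish s z₂ z₂′ (occ z₁≡ eq₁) (occ z₁′≡ eq₁′) eq₃ eq₃′)
    where
    occ : ∀ {z z₀ b z₂} → z ∷ʳ j ≡ z₀ ++ b ∷ v → iter k ≡ z ++ j ∷ z₂ → iter k ≡ z₀ ++ (b ∷ v) ++ z₂
    occ {z} {z₀} {b} {z₂} eq eq′ = trans eq′ (trans (sym (++-assoc z [ j ] z₂)) (trans (cong (_++ z₂) eq) (++-assoc z₀ (b ∷ v) z₂)))
    finish : ∀ s z₂ z₂′ → iter k ≡ z₀ ++ (b ∷ v) ++ z₂ → iter k ≡ z₀′ ++ (b′ ∷ v) ++ z₂′ →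
             Φ z₂ ≡ 𝟘 s ++ y → Φ z₂′ ≡ 𝟘 s ++ y′ → Pre (Φ v ++ 𝟘 s)
    finish zero    z₂       z₂′        o o′ _  _  =
      subst Pre (sym (++-identityʳ _)) (Pre-Φ (leftSpecial⇒Pre k v b b′ b≢b′ (fac z₀ z₂ o) (fac z₀′ z₂′ o′)))
    finish (suc s) []       z₂′        o o′ () _
    finish (suc s) (_ ∷ _)  []         o o′ _  ()
    finish (suc s) (β ∷ z₃) (β′ ∷ z₃′) o o′ h  h′ = close (Pre-extend (leftSpecial⇒Pre k v b b′ b≢b′ (fac z₀ _ o) (fac z₀′ _ o′)))
      where
      facβ : Fac k ((b ∷ v) ++ β ∷ z₃)
      facβ = fac z₀ [] (trans o (cong (z₀ ++_) (sym (++-identityʳ _))))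
      facβ′ : Fac k ((b′ ∷ v) ++ β′ ∷ z₃′)
      facβ′ = fac z₀′ [] (trans o′ (cong (z₀′ ++_) (sym (++-identityʳ _))))
      letterβ : Fac k (v ∷ʳ β)
      letterβ = Fac-suffix [ b ] (v ∷ʳ β) (Fac-prefix _ z₃ (subst (Fac k) (sym (++-assoc (b ∷ v) [ β ] z₃)) facβ))
      letterβ′ : Fac k (v ∷ʳ β′)
      letterβ′ = Fac-suffix [ b′ ] (v ∷ʳ β′) (Fac-prefix _ z₃′ (subst (Fac k) (sym (++-assoc (b′ ∷ v) [ β′ ] z₃′)) facβ′))
      roomβ : Room β (suc s)
      roomβ = decode-room {k} β z₃ (suc s) (Fac-suffix (b ∷ v) (β ∷ z₃) facβ) h
      roomβ′ : Room β′ (suc s)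
      roomβ′ = decode-room {k} β′ z₃′ (suc s) (Fac-suffix (b′ ∷ v) (β′ ∷ z₃′) facβ′) h′
      β≤p : β ≤ p
      β≤p = Fac-∷≤p (Fac-suffix (b ∷ v) (β ∷ z₃) facβ)
      β′≤p : β′ ≤ p
      β′≤p = Fac-∷≤p (Fac-suffix (b′ ∷ v) (β′ ∷ z₃′) facβ′)
      close : (∃ λ c → Pre (v ∷ʳ c)) → Pre (Φ v ++ 𝟘 (suc s))
      close (c , pc) with Room? c (suc s)
      ... | yes room = Pre-room v pc room
      -- Both following letters overtake `c`, so both are `top c`. Then `v` followed by this common
      -- letter is left special one level lower, hence a prefix, and the letter is `c` after all.
      ... | no ¬room = ⊥-elim (¬room (subst (λ x → Room x (suc s)) β≡c roomβ))
        where
        c≤p : c ≤ p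
        c≤p = let (l , g) = Pre⇒Factor pc in Fac-∷≤p (Fac-suffix v [ c ] g)
        β≡β′ : β ≡ β′
        β≡β′ = let (c<p , over)  = ¬room⇒over c≤p β≤p ¬room roomβ
                   (_   , over′) = ¬room⇒over c≤p β′≤p ¬room roomβ′
               in trans (over⇒top c β c<p (nextLetter k v β c pc letterβ) over)
                        (sym (over⇒top c β′ c<p (nextLetter k v β′ c pc letterβ′) over′))
        leftβ : Fac k (b ∷ (v ∷ʳ β))
        leftβ = Fac-prefix _ z₃ (subst (Fac k) (sym (++-assoc (b ∷ v) [ β ] z₃)) facβ)
        leftβ′ : Fac k (b′ ∷ (v ∷ʳ β))
        leftβ′ = subst (λ x → Fac k (b′ ∷ (v ∷ʳ x))) (sym β≡β′)
                   (Fac-prefix _ z₃′ (subst (Fac k) (sym (++-assoc (b′ ∷ v) [ β′ ] z₃′)) facβ′))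
        β≡c : β ≡ c
        β≡c = Pre-unique v (leftSpecial⇒Pre k (v ∷ʳ β) b b′ b≢b′ leftβ leftβ′) pc

-- Other bordered words

-- The shortest border has length d, but the word is not d-periodic: N′ is the first
-- and M the last index i with eᵢ ≠ e_{i+d}.
record AperiodicBorder (p : ℕ) (e : ℕ → ℕ) (d : ℕ) : Set where
  field
    0<d       : 0 < d
    oᵈ        : ℕ
    p≡oᵈ+d    : p ≡ oᵈ + d
    border    : Match e oᵈ d
    shortest  : ∀ o b → 0 < b → b < d → p ≡ o + b → ¬ Match e o b
    N′        : ℕ
    N<p       : d + N′ < p
    periodicˡ : Match e d N′
    breakˡ    : e (d + N′) ≢ e N′
    M         : ℕ
    M+d<p     : M + d < p
    periodicʳ : ∀ i → M < i → i + d < p → e (i + d) ≡ e i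
    breakʳ    : e (M + d) ≢ e M

module NonAffine (p : ℕ) (e : ℕ → ℕ) (0<p : 0 < p) (0<e₀ : 0 < e 0) (eₚ≡0 : e p ≡ 0)
  (parry : Parry p e) (d : ℕ) (aperiodic : AperiodicBorder p e d) where

  open LeftSpecial p e 0<p 0<e₀
  open UnitLastDigit eₚ≡0
  open AperiodicBorder aperiodic

  private
    instance
      d≢0 : NonZero d
      d≢0 = >-nonZero 0<d

    ≤e₀ : ∀ {b} → b < p → e b ≤ e 0
    ≤e₀ = Parry⇒≤e₀ parry

    N : ℕ
    N = d + N′

    eN<eN′ : e N < e N′
    eN<eN′ = ≤∧≢⇒< (parry d N′ 0<d periodicˡ N<p) breakˡ

    M<p : M < p
    M<p = ≤-<-trans (m≤m+n M d) M+d<p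

    -- Writing p = M + 1 + h + K, the word ends with a power of its prefix of
    -- length d, of total length K, and K is maximal.
    l h k K oᴷ : ℕ
    l = p ∸ suc M
    h = l % d
    k = l / d
    K = k * d
    oᴷ = suc M + h

    h<d : h < d
    h<d = m%n<n l d

    l≡ : l ≡ h + K
    l≡ = m≡m%n+[m/n]*n l d

    p≡ : p ≡ oᴷ + K
    p≡ = begin
      p                    ≡⟨ m+[n∸m]≡n M<p ⟨
      suc M + l            ≡⟨ cong (suc M +_) l≡ ⟩
      suc M + (h + K)      ≡⟨ +-assoc (suc M) h K ⟨
      oᴷ + K               ∎
      where open ≡-Reasoning

    0<k : 0 < k
    0<k = n≢0⇒n>0 λ k≡0 → <⇒≱ h<d (+-cancelˡ-≤ (suc M) d h (begin
      suc M + d  ≤⟨ M+d<p ⟩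
      p          ≡⟨ p≡ ⟩
      oᴷ + k * d ≡⟨ cong (λ k → oᴷ + k * d) k≡0 ⟩
      oᴷ + 0     ≡⟨ +-identityʳ oᴷ ⟩
      suc M + h  ∎))
      where open ≤-Reasoning

    k′ : ℕ
    k′ = pred k

    k≡ : k ≡ suc k′
    k≡ = sym (suc-pred k {{>-nonZero 0<k}})

    d≤K : d ≤ K
    d≤K = subst (λ k → d ≤ k * d) (sym k≡) (m≤m+n d (k′ * d))

    periodicʳ* : ∀ a i → M < i → i + a * d < p → e (i + a * d) ≡ e i
    periodicʳ* zero    i M<i _ = cong e (+-identityʳ i)
    periodicʳ* (suc a) i M<i lt = begin
      e (i + suc a * d)   ≡⟨ cong e (shift i d (a * d)) ⟩
      e (i + a * d + d)   ≡⟨ periodicʳ (i + a * d) (≤-trans M<i (m≤m+n i _)) (subst (_< p) (shift i d (a * d)) lt) ⟩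
      e (i + a * d)       ≡⟨ periodicʳ* a i M<i (≤-<-trans (+-monoʳ-≤ i (m≤n+m (a * d) d)) lt) ⟩
      e i                 ∎
      where
      open ≡-Reasoning
      shift : ∀ a b c → a + (b + c) ≡ (a + c) + b
      shift = solve-∀

    periodicˡ* : ∀ a r → r + a * d < N → e (r + a * d) ≡ e r
    periodicˡ* zero    r _  = cong e (+-identityʳ r)
    periodicˡ* (suc a) r lt = trans (cong e (shift r d (a * d)))
      (trans (periodicˡ (r + a * d) (+-cancelˡ-< d _ _ (subst (_< N) (shift r d (a * d)) lt)))
             (periodicˡ* a r (≤-<-trans (+-monoʳ-≤ r (m≤n+m (a * d) d)) lt)))
      where
      shift : ∀ a b c → a + (b + c) ≡ b + (a + c)
      shift = solve-∀

    oᵈ≡ : oᵈ ≡ oᴷ + k′ * d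
    oᵈ≡ = +-cancelʳ-≡ d _ _ (begin
      oᵈ + d                ≡⟨ p≡oᵈ+d ⟨
      p                     ≡⟨ p≡ ⟩
      oᴷ + k * d            ≡⟨ cong (λ k → oᴷ + k * d) k≡ ⟩
      oᴷ + (d + k′ * d)     ≡⟨ shift oᴷ d (k′ * d) ⟩
      oᴷ + k′ * d + d       ∎)
      where
      open ≡-Reasoning
      shift : ∀ a b c → a + (b + c) ≡ a + c + b
      shift = solve-∀

    M<oᴷ : M < oᴷ
    M<oᴷ = m≤m+n (suc M) h

    -- Multiples of `d` move a place of the tail into the last period of the word, and this last
    -- period is the border of length `d`.
    tail-root : ∀ a r → r < d → r + a * d < K → e (oᴷ + (r + a * d)) ≡ e r
    tail-root a r r<d lt = begin
      e (oᴷ + (r + a * d))      ≡⟨ cong e (+-assoc oᴷ r (a * d)) ⟨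
      e (oᴷ + r + a * d)        ≡⟨ periodicʳ* a (oᴷ + r) M<oᴷ+r (subst₂ _<_ (sym (+-assoc oᴷ r (a * d))) (sym p≡) (+-monoʳ-< oᴷ lt)) ⟩
      e (oᴷ + r)                ≡⟨ periodicʳ* k′ (oᴷ + r) M<oᴷ+r (subst₂ _<_ (sym swapped) (sym p≡oᵈ+d) (+-monoʳ-< oᵈ r<d)) ⟨
      e (oᴷ + r + k′ * d)       ≡⟨ cong e swapped ⟩
      e (oᵈ + r)                ≡⟨ border r r<d ⟩
      e r                       ∎
      where
      open ≡-Reasoning
      M<oᴷ+r : M < oᴷ + r
      M<oᴷ+r = ≤-trans M<oᴷ (m≤m+n oᴷ r)
      shift : ∀ a b c → a + b + c ≡ a + c + b
      shift = solve-∀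
      swapped : oᴷ + r + k′ * d ≡ oᵈ + r
      swapped = trans (shift oᴷ r (k′ * d)) (cong (_+ r) (sym oᵈ≡))

    tail-match : ∀ j → j ≤ K → j ≤ N → Match e oᴷ j
    tail-match j j≤K j≤N i i<j = begin
      e (oᴷ + i)                      ≡⟨ cong (λ i → e (oᴷ + i)) i≡ ⟩
      e (oᴷ + (i % d + i / d * d))    ≡⟨ tail-root (i / d) (i % d) (m%n<n i d) (subst (_< K) i≡ (<-≤-trans i<j j≤K)) ⟩
      e (i % d)                       ≡⟨ periodicˡ* (i / d) (i % d) (subst (_< N) i≡ (<-≤-trans i<j j≤N)) ⟨
      e (i % d + i / d * d)           ≡⟨ cong e i≡ ⟨
      e i                             ∎
      where
      open ≡-Reasoning
      i≡ : i ≡ i % d + i / d * d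
      i≡ = m≡m%n+[m/n]*n i d

    -- Otherwise the tail would still repeat the root at `N`, with the digit `e N′ > e N` after a
    -- match of length `N`, against the Parry condition.
    K≤N : K ≤ N
    K≤N = ≮⇒≥ λ N<K → <⇒≱ eN<eN′ (begin
      e N′                            ≡⟨ cong e N′≡ ⟩
      e (r + a * d)                   ≡⟨ periodicˡ* a r (subst (_< N) N′≡ (m<n+m N′ 0<d)) ⟩
      e r                             ≡⟨ tail-root (suc a) r (m%n<n N′ d) (subst (_< K) N≡ N<K) ⟨
      e (oᴷ + (r + suc a * d))        ≡⟨ cong (λ i → e (oᴷ + i)) N≡ ⟨
      e (oᴷ + N)                      ≤⟨ parry oᴷ N z<s (tail-match N (<⇒≤ N<K) ≤-refl) (subst (oᴷ + N <_) (sym p≡) (+-monoʳ-< oᴷ N<K)) ⟩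
      e N                             ∎)
      where
      open ≤-Reasoning
      r a : ℕ
      r = N′ % d
      a = N′ / d
      N′≡ : N′ ≡ r + a * d
      N′≡ = m≡m%n+[m/n]*n N′ d
      shift : ∀ a b c → a + (b + c) ≡ b + (a + c)
      shift = solve-∀
      N≡ : N ≡ r + suc a * d
      N≡ = trans (cong (d +_) N′≡) (shift d r (a * d))

    -- Two occurrences of the prefix `y` with different letters before them. The aim is to let both
    -- following letters fall to 0 in the step in which `c` advances: then `y 0` is left special
    -- without being a prefix.
    Triple : ℕ → ℕ → ℕ → Set
    Triple c b b′ = ∃ λ y → ∃₂ λ a a′ → a ≢ a′ × Factor (a ∷ y ∷ʳ b) × Factor (a′ ∷ y ∷ʳ b′) × Pre (y ∷ʳ c)

    Triple-step : ∀ {c b b′ s c₁ b₁ b₁′} → Triple c b b′ → Step c s c₁ → Step b s b₁ → Step b′ s b₁′ → Triple c₁ b₁ b₁′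
    Triple-step {s = s} (y , a , a′ , a≢a′ , f , f′ , pr) st₁ st₂ st₃ =
      Φ y ++ 𝟘 s , σ a , σ a′ , (λ eq → a≢a′ (σ-injective eq)) ,
      Factor-step-∷ a y f st₂ , Factor-step-∷ a′ y f′ st₃ , Pre-step y pr st₁

    Triple-sym : ∀ {c b b′} → Triple c b b′ → Triple c b′ b
    Triple-sym (y , a , a′ , a≢a′ , f , f′ , pr) = y , a′ , a , (λ eq → a≢a′ (sym eq)) , f′ , f , pr

    Triple⇒leftSpecial : ∀ {c} → Triple (suc c) 0 0 → NonPrefixLeftSpecial
    Triple⇒leftSpecial (y , a , a′ , a≢a′ , f , f′ , pr) =
      y ∷ʳ 0 , a , a′ , a≢a′ , f , f′ , λ pr′ → 0≢1+n (Pre-unique y pr′ pr)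

    full-block : ∀ {j s} → j < p → s < e j → Factor (0 ∷ 𝟘 s ∷ʳ suc j)
    full-block {j} {s} j<p s<e with m≤n⇒∃[o]m+o≡n s<e
    ... | i , s+i≡ = let (k , f) = letter (<⇒≤ j<p) in
      suc k , Fac-suffix (𝟘 i) (0 ∷ 𝟘 s ∷ʳ suc j) (subst (Fac (suc k)) eq (Fac-Φ f))
      where
      open ≡-Reasoning
      eq : Φ [ j ] ≡ 𝟘 i ++ 0 ∷ 𝟘 s ∷ʳ suc j
      eq = begin
        Φ [ j ]                           ≡⟨ Φ-≢p (<⇒≢ j<p) [] ⟩
        𝟘 (e j) ∷ʳ suc j                  ≡⟨ cong (λ r → 𝟘 r ∷ʳ suc j) (trans (sym s+i≡) (+-comm (suc s) i)) ⟩
        𝟘 (i + suc s) ∷ʳ suc j            ≡⟨ cong (_∷ʳ suc j) (𝟘-+ i (suc s)) ⟩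
        (𝟘 i ++ 𝟘 (suc s)) ∷ʳ suc j       ≡⟨ ++-assoc (𝟘 i) (𝟘 (suc s)) [ suc j ] ⟩
        𝟘 i ++ 0 ∷ 𝟘 s ∷ʳ suc j           ∎

    -- The letter before `j` is not `p`, since only 0 follows `p`; so its block ends with a nonzero
    -- letter.
    before-block : ∀ {j} → j < p → j ≢ 0 → ∃ λ a → 0 ≢ a × Factor (a ∷ 𝟘 (e j) ∷ʳ suc j)
    before-block {j} j<p j≢0 = from (letter (<⇒≤ j<p))
      where
      from : Factor [ j ] → ∃ λ a → 0 ≢ a × Factor (a ∷ 𝟘 (e j) ∷ʳ suc j)
      from (k , fac x y eq) with initLast x
      ... | []       = ⊥-elim (j≢0 (Pre-head (pre k y eq)))
      ... | x′ ∷ʳ′ a = σ a , (λ 0≡σa → j≢0 (after-p {k} (subst (λ a → Fac k (a ∷ j ∷ [])) (σ-injective (trans (sym 0≡σa) (sym σ-p))) f))) ,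
                       suc k , subst (λ w → Fac (suc k) (σ a ∷ w)) (Φ-≢p (<⇒≢ j<p) []) (Fac-Φ-∷ f)
        where
        f : Fac k (a ∷ j ∷ [])
        f = fac x′ y (trans eq (++-assoc x′ [ a ] (j ∷ y)))

    -- The common word is the run of length `e j`. Before `suc j` it can be a whole run, with a
    -- nonzero letter on its left; before `suc j′` it is the end of a longer run. The prefix goes on
    -- with 0 because `e j < e 0`.
    Triple-start : ∀ {j j′} → j < p → j′ < p → e j < e j′ → Triple 0 (suc j) (suc j′)
    Triple-start {j} {j′} j<p j′<p lt =
      let (a , 0≢a , f) = before-block j<p λ { refl → <⇒≱ lt (≤e₀ j′<p) }
          (w , eq) = 𝟘-prefix-0 (<-≤-trans lt (≤e₀ j′<p))
      in 𝟘 (e j) , a , 0 , (λ eq → 0≢a (sym eq)) , f , full-block j′<p lt ,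
         Pre-prefix (𝟘 (e j) ∷ʳ 0) (w ∷ʳ 1) (subst Pre (trans (cong (_∷ʳ 1) eq) (reassoc (𝟘 (e j)) w)) Pre-first)
      where
      reassoc : ∀ (v w : List ℕ) → (v ++ 0 ∷ w) ∷ʳ 1 ≡ (v ∷ʳ 0) ++ (w ∷ʳ 1)
      reassoc v w = trans (++-assoc v (0 ∷ w) [ 1 ]) (sym (++-assoc v [ 0 ] (w ∷ʳ 1)))

    -- `b` follows a leader `c`: it was at 0 when the leader was at `o > L`, and has matched all
    -- digits since. By the Parry condition it then advances or restarts, and never falls short. In
    -- `phase₁` it is the prefix letter that follows; in `phase₂` the prefix letter leads.
    Upper : ℕ → ℕ → ℕ → Set
    Upper L c b = ∃ λ o → L < o × c ≡ o + b × Match e o b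

    Upper-init : ∀ {L c} → L < c → Upper L c 0
    Upper-init {c = c} L<c = c , L<c , sym (+-identityʳ c) , Match-0 e c

    Step-≡ : ∀ {b s} → b ≢ p → e b ≡ s → Step b s (suc b)
    Step-≡ b≢p refl = exact b≢p

    Upper-step : ∀ {L c b} → c < p → Upper L c b → ∃ λ b′ → Upper L (suc c) b′ × Step b (e c) b′
    Upper-step {L} {c} {b} c<p (o , L<o , refl , m) with e b ≟ e (o + b)
    ... | yes eq = suc b , (o , L<o , sym (+-suc o b) , Match-suc e o b m (sym eq)) ,
                   Step-≡ (<⇒≢ (≤-<-trans (m≤n+m b o) c<p)) eq
    ... | no ≢   = 0 , Upper-init (≤-trans L<o (≤-trans (m≤m+n o b) (n≤1+n _))) ,
                   below (<⇒≢ (≤-<-trans (m≤n+m b o) c<p)) (≤∧≢⇒< (parry o b (≤-<-trans z≤n L<o) m c<p) (λ eq → ≢ (sym eq)))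

    -- `B₁` and `suc M` differ by a multiple of `d`, so they climb together; after `h` steps they
    -- are `p` and `oᴷ`.
    B₁ : ℕ
    B₁ = suc M + K

    B₁+h≡p : B₁ + h ≡ p
    B₁+h≡p = trans (shift (suc M) K h) (sym p≡)
      where
      shift : ∀ a b c → a + b + c ≡ a + c + b
      shift = solve-∀

    M+K<p : M + K < p
    M+K<p = subst (B₁ ≤_) B₁+h≡p (m≤m+n B₁ h)

    e[M+K]≡ : e (M + K) ≡ e (M + d)
    e[M+K]≡ = trans (cong e eq) (periodicʳ* k′ (M + d) (m<m+n M 0<d) (subst (_< p) eq M+K<p))
      where
      eq : M + K ≡ M + d + k′ * d
      eq = trans (cong (λ k → M + k * d) k≡) (sym (+-assoc M d (k′ * d)))

    start : Triple 0 B₁ (suc M)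
    start with <-cmp (e M) (e (M + K))
    ... | tri< lt _ _ = Triple-sym (Triple-start M<p M+K<p lt)
    ... | tri≈ _ eq _ = ⊥-elim (breakʳ (sym (trans eq e[M+K]≡)))
    ... | tri> _ _ gt = Triple-start M+K<p M<p gt

    phase₁ : ∀ i → i ≤ h → ∃ λ c → Upper (M + K) (B₁ + i) c × Triple c (B₁ + i) (suc M + i)
    phase₁ zero    _   rewrite +-identityʳ (M + K) | +-identityʳ M = 0 , Upper-init ≤-refl , start
    phase₁ (suc i) i<h with phase₁ i (<⇒≤ i<h)
    ... | c , up , tr with Upper-step B₁+i<p up
      where
      B₁+i<p : B₁ + i < p
      B₁+i<p = subst (B₁ + i <_) B₁+h≡p (+-monoʳ-< B₁ i<h)
    ... | c′ , up′ , st rewrite +-suc (M + K) i | +-suc M i =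
      c′ , up′ , Triple-step tr st (exact (<⇒≢ B₁+i<p)) (Step-≡ (<⇒≢ (≤-<-trans (+-monoˡ-≤ i (m≤m+n (suc M) K)) B₁+i<p)) (sym shifted))
      where
      B₁+i<p : B₁ + i < p
      B₁+i<p = subst (B₁ + i <_) B₁+h≡p (+-monoʳ-< B₁ i<h)
      swapped : ∀ a b c → a + b + c ≡ a + c + b
      swapped = solve-∀
      shifted : e (B₁ + i) ≡ e (suc M + i)
      shifted = trans (cong e (swapped (suc M) K i))
        (periodicʳ* k (suc M + i) (m≤m+n (suc M) i) (subst (_< p) (swapped (suc M) K i) B₁+i<p))

    -- After the `h` steps a nonzero prefix letter would be the length of a border of the word, at
    -- most `h` and so less than `d`. Hence the prefix letter is back at 0.
    middle : Triple 0 p oᴷ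
    middle with phase₁ h ≤-refl
    ... | zero  , _ , tr = subst (λ b → Triple 0 b oᴷ) B₁+h≡p tr
    ... | suc c , (o , L<o , eq , m) , _ = ⊥-elim (shortest o (suc c) z<s
      (≤-<-trans (+-cancelˡ-≤ (suc (M + K)) _ _ (≤-trans (+-monoˡ-≤ (suc c) L<o) (≤-reflexive (sym eq)))) h<d)
      (trans (sym B₁+h≡p) eq) m)

    -- A nonzero `b` would be the length of a border of the border of length `d`, hence of the whole
    -- word.
    Upper-d : ∀ {b} → Upper 0 d b → b ≡ 0
    Upper-d {zero}  _ = refl
    Upper-d {suc b} (o , 0<o , d≡ , m) = ⊥-elim (shortest (oᵈ + o) (suc b) z<s
      (subst (suc b <_) (sym d≡) (m<n+m (suc b) 0<o))
      (trans p≡oᵈ+d (trans (cong (oᵈ +_) d≡) (sym (+-assoc oᵈ o (suc b)))))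
      λ i i<b → trans (cong e (+-assoc oᵈ o i)) (trans (border (o + i) (subst (o + i <_) (sym d≡) (+-monoʳ-< o i<b))) (m i i<b)))

    -- First c b and Second c b: the letters descending from p and from oᴷ while the prefix
    -- continues with c. The latter becomes p for c = K.
    data First : ℕ → ℕ → Set where
      initial : First 0 p
      early   : ∀ {c b} → c ≤ d → Upper 0 c b → First c b
      late    : ∀ {c b} → c ≡ d + b → First c b

    late-step : ∀ b → d + b < N → ∃ λ b′ → First (suc (d + b)) b′ × Step b (e (d + b)) b′
    late-step b c<N = suc b , late (sym (+-suc d b)) ,
      Step-≡ (<⇒≢ (≤-<-trans (m≤n+m b d) (<-trans c<N N<p))) (sym (periodicˡ b (+-cancelˡ-< d _ _ c<N)))

    First-step : ∀ {c b} → c < N → First c b → ∃ λ b′ → First (suc c) b′ × Step b (e c) b′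
    First-step c<N initial = 0 , early 0<d (Upper-init z<s) , wrap ≤-refl
    First-step {b = b} c<N (late refl) = late-step b c<N
    First-step {c} {b} c<N (early c≤d up) with m≤n⇒m<n∨m≡n c≤d
    ... | inj₁ c<d = let (b′ , up′ , st) = Upper-step (<-trans c<N N<p) up in b′ , early c<d up′ , st
    ... | inj₂ refl with Upper-d up
    ...   | refl = subst (λ c → ∃ λ b′ → First (suc c) b′ × Step 0 (e c) b′) (+-identityʳ d)
                       (late-step 0 (subst (_< N) (sym (+-identityʳ d)) c<N))

    First-final : ∀ {b} → First N b → Step b (e N) 0
    First-final first = go first refl
      where
      final : ∀ {b} → N ≡ d + b → Step b (e N) 0
      final {b} N≡ with +-cancelˡ-≡ d _ _ N≡
      ... | refl = below (<⇒≢ (≤-<-trans (m≤n+m b d) N<p)) eN<eN′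
      go : ∀ {c b} → First c b → c ≡ N → Step b (e N) 0
      go initial   c≡N = ⊥-elim (<⇒≢ (<-≤-trans 0<d (m≤m+n d N′)) c≡N)
      go (late c≡) c≡N = final (trans (sym c≡N) c≡)
      go (early c≤d up) c≡N with ≤-antisym c≤d (subst (d ≤_) (sym c≡N) (m≤m+n d N′))
      ... | refl with Upper-d up
      ...   | refl = final (trans (sym c≡N) (sym (+-identityʳ d)))

    data Second : ℕ → ℕ → Set where
      tracking : ∀ {c} → c ≤ K → Second c (oᴷ + c)
      wrapped  : ∀ {c b} → Upper K c b → Second c b

    Second-step : ∀ {c b} → c < N → Second c b → ∃ λ b′ → Second (suc c) b′ × Step b (e c) b′
    Second-step c<N (wrapped up) = let (b′ , up′ , st) = Upper-step (<-trans c<N N<p) up in b′ , wrapped up′ , st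
    Second-step {c} c<N (tracking c≤K) with m≤n⇒m<n∨m≡n c≤K
    ... | inj₁ c<K = oᴷ + suc c , tracking c<K ,
      subst (Step (oᴷ + c) (e c)) (sym (+-suc oᴷ c))
        (Step-≡ (<⇒≢ (subst (oᴷ + c <_) (sym p≡) (+-monoʳ-< oᴷ c<K))) (tail-match K ≤-refl K≤N c c<K))
    ... | inj₂ refl = 0 , wrapped (Upper-init ≤-refl) , subst (λ b → Step b (e K) 0) p≡ (wrap (≤e₀ (<-trans c<N N<p)))

    -- If `K = N`, the letter may just have become `p`. Otherwise it restarted after `K ≥ d`; moved
    -- back by `d`, its match ends at `N′`, and the Parry condition gives `e N < e N′ ≤ e b`.
    Second-final : ∀ {b} → Second N b → Step b (e N) 0
    Second-final second = go second refl
      where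
      go : ∀ {c b} → Second c b → c ≡ N → Step b (e N) 0
      go (tracking c≤K) c≡N = subst (λ b → Step b (e N) 0)
        (trans p≡ (cong (oᴷ +_) (sym (≤-antisym c≤K (subst (K ≤_) (sym c≡N) K≤N))))) (wrap (≤e₀ N<p))
      go {c} {b} (wrapped (o , K<o , c≡ , m)) c≡N with m≤n⇒∃[o]m+o≡n (≤-trans d≤K (<⇒≤ K<o))
      ... | o′ , refl = below (<⇒≢ (≤-<-trans (m≤n+m b (d + o′)) (subst (_< p) (trans (sym c≡N) c≡) N<p)))
                          (<-≤-trans eN<eN′ (subst (λ i → e i ≤ e b) (sym N′≡) (parry o′ b 0<o′ m′ (subst (_< p) N′≡ N′<p))))
        where
        N′≡ : N′ ≡ o′ + b
        N′≡ = +-cancelˡ-≡ d _ _ (trans (sym c≡N) (trans c≡ (+-assoc d o′ b)))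
        N′<p : N′ < p
        N′<p = ≤-<-trans (m≤n+m N′ d) N<p
        0<o′ : 0 < o′
        0<o′ = +-cancelˡ-< d 0 o′ (subst (_< d + o′) (sym (+-identityʳ d)) (≤-<-trans d≤K K<o))
        m′ : Match e o′ b
        m′ i i<b = trans (sym (periodicˡ (o′ + i) (subst (o′ + i <_) (sym N′≡) (+-monoʳ-< o′ i<b))))
                         (trans (cong e (sym (+-assoc d o′ i))) (m i i<b))

    phase₂ : ∀ c → c ≤ N → ∃₂ λ b b′ → First c b × Second c b′ × Triple c b b′
    phase₂ zero    _   = p , oᴷ + 0 , initial , tracking z≤n , subst (Triple 0 p) (sym (+-identityʳ oᴷ)) middle
    phase₂ (suc c) c<N =
      let (b , b′ , fst , snd , tr) = phase₂ c (<⇒≤ c<N)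
          (b₁ , fst′ , st)   = First-step c<N fst
          (b₁′ , snd′ , st′) = Second-step c<N snd
      in b₁ , b₁′ , fst′ , snd′ , Triple-step tr (exact (<⇒≢ (<-trans c<N N<p))) st st′

  nonPrefixLeftSpecial-border : NonPrefixLeftSpecial
  nonPrefixLeftSpecial-border =
    let (b , b′ , fst , snd , tr) = phase₂ N ≤-refl
    in Triple⇒leftSpecial (Triple-step tr (exact (<⇒≢ N<p)) (First-final fst) (Second-final snd))

-- Borders and periods of the word of digits

module _ {P : ℕ → Set} (P? : ∀ n → Dec (P n)) where

  private
    none-suc : ∀ {v n} → ¬ P v → (n < v → ¬ P n) → n < suc v → ¬ P n
    none-suc ¬Pv none n<1+v Pn with m<1+n⇒m<n∨m≡n n<1+v
    ... | inj₁ n<v  = none n<v Pn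
    ... | inj₂ refl = ¬Pv Pn

  least : ∀ v → (∃ λ n → n < v × P n × (∀ m → m < n → ¬ P m)) ⊎ (∀ n → n < v → ¬ P n)
  least zero = inj₂ λ _ ()
  least (suc v) with least v
  ... | inj₁ (n , n<v , h) = inj₁ (n , m≤n⇒m≤1+n n<v , h)
  ... | inj₂ none with P? v
  ...   | yes Pv = inj₁ (v , ≤-refl , Pv , none)
  ...   | no ¬Pv = inj₂ λ n → none-suc ¬Pv (none n)

  greatest : ∀ v → (∃ λ n → n < v × P n × (∀ m → n < m → m < v → ¬ P m)) ⊎ (∀ n → n < v → ¬ P n)
  greatest zero = inj₂ λ _ ()
  greatest (suc v) with P? v
  ... | yes Pv = inj₁ (v , ≤-refl , Pv , λ m v<m m<1+v → ⊥-elim (<⇒≱ v<m (s≤s⁻¹ m<1+v)))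
  ... | no ¬Pv with greatest v
  ...   | inj₁ (n , n<v , Pn , h) = inj₁ (n , m≤n⇒m≤1+n n<v , Pn , λ m n<m → none-suc ¬Pv (h m n<m))
  ...   | inj₂ none = inj₂ λ n → none-suc ¬Pv (none n)

Match? : ∀ e o k → Dec (Match e o k)
Match? e o k = map′ to (λ m {i} → m i) (allUpTo? (λ i → e (o + i) ≟ e i) k)
  where
  to : (∀ {i} → i < k → e (o + i) ≡ e i) → Match e o k
  to h i = h

-- o is determined by b, but keeping it avoids truncated subtraction.
Border : ℕ → (ℕ → ℕ) → ℕ → Set
Border p e b = 0 < b × ∃ λ o → 0 < o × p ≡ o + b × Match e o b

Border? : ∀ p e b → Dec (Border p e b)
Border? p e b with 0 <? b | b <? p
... | no b≮  | _      = no λ { (0<b , _) → b≮ 0<b }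
... | _      | no b≮p = no λ { (_ , o , 0<o , refl , _) → b≮p (m<n+m b 0<o) }
... | yes 0<b | yes b<p with Match? e (p ∸ b) b
...   | yes m = yes (0<b , p ∸ b , m<n⇒0<n∸m b<p , sym (m∸n+n≡m (<⇒≤ b<p)) , m)
...   | no ¬m = no λ { (_ , o , _ , p≡ , m) → ¬m (subst (λ o → Match e o b) (trans (sym (m+n∸n≡m o b)) (cong (_∸ b) (sym p≡))) m) }

record PowerRoot (p : ℕ) (e : ℕ → ℕ) (d : ℕ) : Set where
  field
    0<d    : 0 < d
    q      : ℕ
    2≤q    : 2 ≤ q
    p≡q*d  : p ≡ q * d
    period : ∀ i → i + d < p → e (i + d) ≡ e i

-- If the period `d` of the shortest border never fails, then `d` divides `p`, since a nonzero
-- remainder would be the length of a shorter border.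
classify : ∀ p e → 0 < p → (∀ b → ¬ Border p e b) ⊎ (∃ λ d → PowerRoot p e d) ⊎ (∃ λ d → AperiodicBorder p e d)
classify p e 0<p with least (Border? p e) p
... | inj₂ none = inj₁ λ { b B@(_ , _ , 0<o , refl , _) → none b (m<n+m b 0<o) B }
... | inj₁ (d , d<p , (0<d , o , 0<o , p≡ , m) , minimal)
  with least (λ i → ¬? (e (d + i) ≟ e i)) o | greatest (λ i → ¬? (e (i + d) ≟ e i)) o
... | inj₁ (N′ , N′<o , break , before) | inj₁ (M , M<o , breakʳ , after) = inj₂ (inj₂ (d , record
  { 0<d = 0<d ; oᵈ = o ; p≡oᵈ+d = p≡ ; border = m
  ; shortest = λ { o′ b 0<b b<d p≡′ m′ → minimal b b<d (0<b , o′ ,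
      n≢0⇒n>0 (λ { refl → <⇒≢ (<-trans b<d d<p) (sym p≡′) }) , p≡′ , m′) }
  ; N′ = N′ ; N<p = subst (d + N′ <_) (trans (+-comm d o) (sym p≡)) (+-monoʳ-< d N′<o)
  ; periodicˡ = λ i i<N′ → decide (before i i<N′)
  ; breakˡ = break
  ; M = M ; M+d<p = subst (M + d <_) (sym p≡) (+-monoˡ-< d M<o)
  ; periodicʳ = λ i M<i i+d<p → decide (after i M<i (+-cancelʳ-< d i o (subst (i + d <_) p≡ i+d<p)))
  ; breakʳ = breakʳ }))
  where
  decide : ∀ {x y : ℕ} → ¬ ¬ (x ≡ y) → x ≡ y
  decide {x} {y} ¬¬eq with x ≟ y
  ... | yes eq = eq
  ... | no ≢   = ⊥-elim (¬¬eq ≢)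
... | inj₁ (N′ , N′<o , break , _) | inj₂ none = ⊥-elim (none N′ N′<o λ eq → break (trans (cong e (+-comm d N′)) eq))
... | inj₂ none | _ = inj₂ (inj₁ (d , record { 0<d = 0<d ; q = p / d ; 2≤q = 2≤q ; p≡q*d = p≡q*d ; period = period }))
  where
  instance
    d≢0 : NonZero d
    d≢0 = >-nonZero 0<d
  period : ∀ i → i + d < p → e (i + d) ≡ e i
  period i lt with e (d + i) ≟ e i
  ... | yes eq = trans (cong e (+-comm i d)) eq
  ... | no ≢   = ⊥-elim (none i (+-cancelʳ-< d i o (subst (i + d <_) p≡ lt)) ≢)
  p≡r+ : p ≡ p % d + p / d * d
  p≡r+ = m≡m%n+[m/n]*n p d
  r≡0 : p % d ≡ 0
  r≡0 with p % d ≟ 0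
  ... | yes eq = eq
  ... | no r≢0 = ⊥-elim (minimal (p % d) (m%n<n p d) (n≢0⇒n>0 r≢0 , p / d * d , 0<qd , trans p≡r+ (+-comm _ (p / d * d)) , λ i i<r →
      trans (cong e (+-comm (p / d * d) i))
            (period⇒* {e = e} period (p / d) i (subst (i + p / d * d <_) (sym p≡r+) (+-monoˡ-< (p / d * d) i<r)))))
    where
    0<qd : 0 < p / d * d
    0<qd = n≢0⇒n>0 λ qd≡0 → <⇒≱ (m%n<n p d) (≤-trans (<⇒≤ d<p) (≤-reflexive (trans p≡r+ (trans (cong (p % d +_) qd≡0) (+-identityʳ _)))))
  p≡q*d : p ≡ p / d * d
  p≡q*d = trans p≡r+ (cong (_+ p / d * d) r≡0)
  2≤q : 2 ≤ p / d
  2≤q = *-cancelʳ-< d 1 (p / d) (subst₂ _<_ (sym (*-identityˡ d)) p≡q*d d<p)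

-- Common periods and the unbordered root of a power

Period : (ℕ → ℕ) → ℕ → Set
Period S x = ∀ i → S (i + x) ≡ S i

Period-* : ∀ {S x} → Period S x → ∀ k → Period S (k * x)
Period-* {S}     per zero    i = cong S (+-identityʳ i)
Period-* {S} {x} per (suc k) i = trans (cong S (shift i x (k * x))) (trans (per (i + k * x)) (Period-* per k i))
  where
  shift : ∀ a b c → a + (b + c) ≡ (a + c) + b
  shift = solve-∀

-- On an infinite sequence Bézout's identity suffices, with no condition on lengths as for finite
-- words. This is why `shorten` passes to the cyclic extension `S` of the root.
Period-gcd : ∀ {S x y} → Period S x → Period S y → Period S (gcd x y)
Period-gcd {S} {x} {y} perx pery i with Bézout.identity (gcd-GCD x y)
... | Bézout.+- a b eq = trans (sym (Period-* pery b (i + gcd x y)))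
        (trans (cong S (trans (+-assoc i (gcd x y) (b * y)) (cong (i +_) eq))) (Period-* perx a i))
... | Bézout.-+ a b eq = trans (sym (Period-* perx a (i + gcd x y)))
        (trans (cong S (trans (+-assoc i (gcd x y) (a * x)) (cong (i +_) eq))) (Period-* pery b i))

module _ (p : ℕ) (e : ℕ → ℕ) (parry : Parry p e) where

  -- If the root w of the power has a border x, w = xy, then the Parry condition gives
  -- yx ≤ xy ≤ yx, so that the word has a shorter root.
  private
    shorten : ∀ d → PowerRoot p e d → ∀ o b → 0 < o → 0 < b → d ≡ o + b → Match e o b →
              ∃ λ g → g < d × PowerRoot p e g
    shorten d root o b 0<o 0<b d≡ m = g , g<d , record
      { 0<d = 0<g ; q = q * c ; 2≤q = ≤-trans 2≤q (m≤m*n q c {{>-nonZero 0<c}})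
      ; p≡q*d = trans p≡q*d (trans (cong (q *_) d≡c*g) (sym (*-assoc q c g)))
      ; period = λ i lt → trans (e≡S _ lt) (trans (S-g i) (sym (e≡S i (≤-<-trans (m≤m+n i g) lt)))) }
      where
      open PowerRoot root
      instance
        d≢0 : NonZero d
        d≢0 = >-nonZero 0<d
        b≢0 : NonZero b
        b≢0 = >-nonZero 0<b
      g : ℕ
      g = gcd d b
      b<d : b < d
      b<d = subst (b <_) (sym d≡) (m<n+m b 0<o)
      g<d : g < d
      g<d = ≤-<-trans (gcd[m,n]≤n d b) b<d
      0<g : 0 < g
      0<g = n≢0⇒n>0 (gcd[m,n]≢0 d b (inj₁ (λ d≡0 → <⇒≢ 0<d (sym d≡0))))
      c : ℕ
      c = quotient (gcd[m,n]∣m d b)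
      d≡c*g : d ≡ c * g
      d≡c*g = _∣_.equality (gcd[m,n]∣m d b)
      0<c : 0 < c
      0<c = n≢0⇒n>0 λ c≡0 → <⇒≢ 0<d (sym (trans d≡c*g (cong (_* g) c≡0)))
      d+d≤p : d + d ≤ p
      d+d≤p = ≤-trans (≤-reflexive (cong (d +_) (sym (+-identityʳ d)))) (≤-trans (*-monoˡ-≤ d 2≤q) (≤-reflexive (sym p≡q*d)))
      o+b+ : ∀ j → o + (b + j) ≡ d + j
      o+b+ j = trans (sym (+-assoc o b j)) (cong (_+ j) (sym d≡))
      commute : ∀ l → b + l ≤ d → Match e b l
      commute zero    _  = Match-0 e b
      -- The condition at offset `b` gives one inequality. At offset `o` the border is followed by
      -- the next copy of the root, which exists because `2 ≤ q`, and this gives the other.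
      commute (suc l) le = Match-suc e b l ih (≤-antisym (parry b l 0<b ih (<-≤-trans b+l<d d≤p))
          (subst (_≤ e (b + l)) e[d+l] (parry o (b + l) 0<o ih′ (subst (_< p) (sym (o+b+ l)) d+l<p))))
        where
        b+l<d : b + l < d
        b+l<d = subst (_≤ d) (+-suc b l) le
        d≤p : d ≤ p
        d≤p = ≤-trans (m≤m+n d d) d+d≤p
        d+l<p : d + l < p
        d+l<p = <-≤-trans (+-monoʳ-< d (≤-<-trans (m≤n+m l b) b+l<d)) d+d≤p
        ih : Match e b l
        ih = commute l (<⇒≤ b+l<d)
        e[d+_] : ∀ j → j ≤ l → e (o + (b + j)) ≡ e j
        e[d+_] j j≤l = trans (cong e (trans (o+b+ j) (+-comm d j)))
          (period j (subst (_< p) (+-comm d j) (≤-<-trans (+-monoʳ-≤ d j≤l) d+l<p)))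
        e[d+l] : e (o + (b + l)) ≡ e l
        e[d+l] = e[d+_] l ≤-refl
        ih′ : Match e o (b + l)
        ih′ j j<b+l with j <? b
        ... | yes j<b = m j j<b
        ... | no j≮b with m≤n⇒∃[o]m+o≡n (≮⇒≥ j≮b)
        ...   | i , refl = trans (e[d+_] i (<⇒≤ (+-cancelˡ-< b i l j<b+l))) (sym (ih i (+-cancelˡ-< b i l j<b+l)))
      commute-o : Match e b o
      commute-o = commute o (≤-reflexive (trans (+-comm b o) (sym d≡)))
      S : ℕ → ℕ
      S i = e (i % d)
      e≡S : ∀ i → i < p → e i ≡ S i
      e≡S i i<p = trans (cong e i≡) (period⇒* {e = e} period (i / d) (i % d) (subst (_< p) i≡ i<p))
        where
        i≡ : i ≡ i % d + i / d * d
        i≡ = m≡m%n+[m/n]*n i d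
      S-d : Period S d
      S-d i = cong e ([m+n]%n≡m%n i d)
      S-b-small : ∀ r → r < d → S (r + b) ≡ e r
      S-b-small r r<d with r <? o
      ... | yes r<o = trans (cong e (m<n⇒m%n≡m (subst (r + b <_) (sym d≡) (+-monoˡ-< b r<o))))
                            (trans (cong e (+-comm r b)) (commute-o r r<o))
      ... | no r≮o with m≤n⇒∃[o]m+o≡n (≮⇒≥ r≮o)
      ...   | i , refl = trans (cong e (trans (cong (_% d) eq) (trans ([m+n]%n≡m%n i d) (m<n⇒m%n≡m (≤-<-trans (m≤n+m i o) r<d)))))
                               (sym (m i (+-cancelˡ-< o i b (subst (o + i <_) d≡ r<d))))
        where
        eq : o + i + b ≡ i + d
        eq = trans (shift o i b) (cong (i +_) (sym d≡))
          where
          shift : ∀ a b c → a + b + c ≡ b + (a + c)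
          shift = solve-∀
      S-b : Period S b
      S-b i = trans (cong S eq) (trans (cong e ([m+kn]%n≡m%n (i % d + b) (i / d) d)) (S-b-small (i % d) (m%n<n i d)))
        where
        shift : ∀ a b c → a + b + c ≡ a + c + b
        shift = solve-∀
        eq : i + b ≡ i % d + b + i / d * d
        eq = trans (cong (_+ b) (m≡m%n+[m/n]*n i d)) (shift (i % d) (i / d * d) b)
      S-g : Period S g
      S-g = Period-gcd S-d S-b

  unborderedRoot : ∀ d → PowerRoot p e d → ∃ λ d → UnborderedRoot p e d
  unborderedRoot = <-rec _ go
    where
    go : ∀ d → (∀ {g} → g < d → PowerRoot p e g → ∃ λ d → UnborderedRoot p e d) →
         PowerRoot p e d → ∃ λ d → UnborderedRoot p e d
    go d rec root with least (Border? d e) d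
    ... | inj₁ (b , _ , (0<b , o , 0<o , d≡ , m) , _) =
      let (g , g<d , root′) = shorten d root o b 0<o 0<b d≡ m in rec g<d root′
    ... | inj₂ none = d , record
      { 0<d = 0<d ; q = q ; p≡q*d = p≡q*d ; period = period
      ; unbordered = λ { o b 0<o 0<b d≡ m → none b (subst (b <_) (sym d≡) (m<n+m b 0<o)) (0<b , o , 0<o , d≡ , m) } }
      where open PowerRoot root

-- The word is its own root with exponent 1, so that both alternatives of the condition lead to an
-- `UnborderedRoot`.
unbordered⇒root : ∀ p e → 0 < p → (∀ b → ¬ Border p e b) → UnborderedRoot p e p
unbordered⇒root p e 0<p none = record
  { 0<d = 0<p ; q = 1 ; p≡q*d = sym (+-identityʳ p)
  ; period = λ i lt → ⊥-elim (m+n≮n i p lt)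
  ; unbordered = λ o b 0<o 0<b p≡ m → none b (0<b , o , 0<o , p≡ , m) }

-- Borders and powers as words

digit-++ˡ : ∀ xs ys {i} → i < length xs → digit (xs ++ ys) i ≡ digit xs i
digit-++ˡ (x ∷ xs) ys {zero}  _         = refl
digit-++ˡ (x ∷ xs) ys {suc i} (s≤s i<l) = digit-++ˡ xs ys i<l

digit-++ʳ : ∀ xs ys i → digit (xs ++ ys) (length xs + i) ≡ digit ys i
digit-++ʳ []       ys i = refl
digit-++ʳ (x ∷ xs) ys i = digit-++ʳ xs ys i

digit-drop : ∀ d xs i → digit (drop d xs) i ≡ digit xs (d + i)
digit-drop zero    xs       i = refl
digit-drop (suc d) []       i = refl
digit-drop (suc d) (x ∷ xs) i = digit-drop d xs i

digit-take : ∀ d xs {i} → i < d → digit (take d xs) i ≡ digit xs i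
digit-take (suc d) []       _                 = refl
digit-take (suc d) (x ∷ xs) {zero}  _         = refl
digit-take (suc d) (x ∷ xs) {suc i} (s≤s i<d) = digit-take d xs i<d

digit-ext : ∀ xs ys → length xs ≡ length ys → (∀ i → i < length xs → digit xs i ≡ digit ys i) → xs ≡ ys
digit-ext []       []       _  _ = refl
digit-ext (x ∷ xs) (y ∷ ys) eq h =
  cong₂ _∷_ (h 0 z<s) (digit-ext xs ys (suc-injective eq) λ i i<l → h (suc i) (s<s i<l))

length-^ʷ : ∀ (w : List ℕ) k → length (w ^ʷ k) ≡ k * length w
length-^ʷ w zero    = refl
length-^ʷ w (suc k) = trans (length-++ w) (cong (length w +_) (length-^ʷ w k))

^ʷ-suc : ∀ (w : List ℕ) k → w ^ʷ suc k ≡ w ^ʷ k ++ w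
^ʷ-suc w zero    = ++-identityʳ w
^ʷ-suc w (suc k) = trans (cong (w ++_) (^ʷ-suc w k)) (sym (++-assoc w (w ^ʷ k) w))

^ʷ-period : ∀ (w : List ℕ) k i → i + length w < length (w ^ʷ k) → digit (w ^ʷ k) (i + length w) ≡ digit (w ^ʷ k) i
^ʷ-period w zero    i ()
^ʷ-period w (suc k) i lt = begin
  digit (w ++ w ^ʷ k) (i + length w)  ≡⟨ cong (digit (w ++ w ^ʷ k)) (+-comm i (length w)) ⟩
  digit (w ++ w ^ʷ k) (length w + i)  ≡⟨ digit-++ʳ w (w ^ʷ k) i ⟩
  digit (w ^ʷ k) i                    ≡⟨ digit-++ˡ (w ^ʷ k) w i<l ⟨
  digit (w ^ʷ k ++ w) i               ≡⟨ cong (λ v → digit v i) (^ʷ-suc w k) ⟨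
  digit (w ^ʷ suc k) i                ∎
  where
  open ≡-Reasoning
  i<l : i < length (w ^ʷ k)
  i<l = +-cancelˡ-< (length w) i _ (subst₂ _<_ (+-comm i (length w)) (length-++ w) lt)

-- Comparison with a fixed root `y`, rather than with an earlier place of `xs`, keeps the hypothesis
-- stable when the first copy is dropped.
periodic⇒^ʷ : ∀ d y xs q → length y ≡ d → length xs ≡ q * d →
              (∀ a r → r < d → r + a * d < q * d → digit xs (r + a * d) ≡ digit y r) → xs ≡ y ^ʷ q
periodic⇒^ʷ d y []       zero    ly lx h = refl
periodic⇒^ʷ d y xs       (suc q) ly lx h = begin
  xs                       ≡⟨ take++drop≡id d xs ⟨
  take d xs ++ drop d xs   ≡⟨ cong₂ _++_ first rest ⟩
  y ++ y ^ʷ q              ∎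
  where
  open ≡-Reasoning
  shift : ∀ a b c → a + (b + c) ≡ b + (a + c)
  shift = solve-∀
  lt : length (take d xs) ≡ d
  lt = trans (length-take d xs) (m≤n⇒m⊓n≡m (subst (d ≤_) (sym lx) (m≤m+n d (q * d))))
  first : take d xs ≡ y
  first = digit-ext (take d xs) y (trans lt (sym ly)) λ i i<l →
    let i<d = subst (i <_) lt i<l in
    trans (digit-take d xs i<d) (trans (cong (digit xs) (sym (+-identityʳ i)))
      (h 0 i i<d (subst (_< d + q * d) (sym (+-identityʳ i)) (<-≤-trans i<d (m≤m+n d (q * d))))))
  rest : drop d xs ≡ y ^ʷ q
  rest = periodic⇒^ʷ d y (drop d xs) q ly (trans (length-drop d xs) (trans (cong (_∸ d) lx) (m+n∸m≡n d (q * d))))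
    λ a r r<d lt → trans (digit-drop d xs (r + a * d)) (trans (cong (digit xs) (shift d r (a * d)))
      (h (suc a) r r<d (subst (_< d + q * d) (shift d r (a * d)) (+-monoʳ-< d lt))))

Prefix⇒++ : ∀ {v τ : List ℕ} → Prefix _≡_ v τ → ∃ λ ys → τ ≡ v ++ ys
Prefix⇒++ {τ = τ} Prefix.[] = τ , refl
Prefix⇒++ (refl Prefix.∷ pre) = let (ys , eq) = Prefix⇒++ pre in ys , cong (_ ∷_) eq

++⇒Prefix : ∀ (v ys : List ℕ) → Prefix _≡_ v (v ++ ys)
++⇒Prefix []      ys = Prefix.[]
++⇒Prefix (x ∷ v) ys = refl Prefix.∷ ++⇒Prefix v ys

Suffix⇒++ : ∀ {v τ : List ℕ} → Suffix _≡_ v τ → ∃ λ xs → τ ≡ xs ++ v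
Suffix⇒++ (here eq)   = [] , sym (Pointwise-≡⇒≡ eq)
Suffix⇒++ (there suf) = let (xs , eq) = Suffix⇒++ suf in _ ∷ xs , cong (_ ∷_) eq

BorderWord : List ℕ → List ℕ → Set
BorderWord τ v = v ≢ [] × ProperPrefix v τ × ProperSuffix v τ

module _ (τ : List ℕ) (e : ℕ → ℕ) (e≡ : ∀ i → i < length τ → e i ≡ digit τ i) where

  private
    p : ℕ
    p = length τ

  borderWord⇒border : ∀ v → BorderWord τ v → Border p e (length v)
  borderWord⇒border v (v≢[] , (pre , v≢τ) , (suf , _)) = 0<b v v≢[] , length xs , 0<o xs eq′ , p≡ , λ i i<b → begin
    e (length xs + i)           ≡⟨ e≡ _ (subst (length xs + i <_) (sym p≡) (+-monoʳ-< (length xs) i<b)) ⟩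
    digit τ (length xs + i)     ≡⟨ cong (λ τ → digit τ (length xs + i)) eq′ ⟩
    digit (xs ++ v) (length xs + i)  ≡⟨ digit-++ʳ xs v i ⟩
    digit v i                   ≡⟨ digit-++ˡ v ys i<b ⟨
    digit (v ++ ys) i           ≡⟨ cong (λ τ → digit τ i) eq ⟨
    digit τ i                   ≡⟨ e≡ i (<-≤-trans i<b (subst (length v ≤_) (sym p≡) (m≤n+m _ (length xs)))) ⟨
    e i                         ∎
    where
    open ≡-Reasoning
    ys xs : List ℕ
    ys = proj₁ (Prefix⇒++ pre)
    xs = proj₁ (Suffix⇒++ suf)
    eq : τ ≡ v ++ ys
    eq = proj₂ (Prefix⇒++ pre)
    eq′ : τ ≡ xs ++ v
    eq′ = proj₂ (Suffix⇒++ suf)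
    p≡ : p ≡ length xs + length v
    p≡ = trans (cong length eq′) (length-++ xs)
    0<b : ∀ v → v ≢ [] → 0 < length v
    0<b []      v≢[] = ⊥-elim (v≢[] refl)
    0<b (_ ∷ _) _    = z<s
    0<o : ∀ xs → τ ≡ xs ++ v → 0 < length xs
    0<o []      τ≡v = ⊥-elim (v≢τ (sym τ≡v))
    0<o (_ ∷ _) _   = z<s

  border⇒borderWord : ∀ b → Border p e b → ∃ λ v → BorderWord τ v
  border⇒borderWord b (0<b , o , 0<o , p≡ , m) = v , v≢[] , (isPrefix , v≢τ) , (isSuffix , v≢τ)
    where
    open ≡-Reasoning
    v : List ℕ
    v = take b τ
    b<p : b < p
    b<p = subst (b <_) (sym p≡) (m<n+m b 0<o)
    len : length v ≡ b
    len = trans (length-take b τ) (m≤n⇒m⊓n≡m (<⇒≤ b<p))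
    v≢[] : v ≢ []
    v≢[] eq = <⇒≢ 0<b (trans (sym (cong length eq)) len)
    v≢τ : v ≢ τ
    v≢τ eq = <⇒≢ b<p (trans (sym len) (cong length eq))
    isPrefix : Prefix _≡_ v τ
    isPrefix = subst (Prefix _≡_ v) (take++drop≡id b τ) (++⇒Prefix v (drop b τ))
    v≡ : drop o τ ≡ v
    v≡ = digit-ext (drop o τ) v (trans lenʳ (sym len)) λ i i<l →
      let i<b = subst (i <_) lenʳ i<l in begin
      digit (drop o τ) i     ≡⟨ digit-drop o τ i ⟩
      digit τ (o + i)        ≡⟨ e≡ (o + i) (subst (o + i <_) (sym p≡) (+-monoʳ-< o i<b)) ⟨
      e (o + i)              ≡⟨ m i i<b ⟩
      e i                    ≡⟨ e≡ i (<-trans i<b b<p) ⟩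
      digit τ i              ≡⟨ digit-take b τ i<b ⟨
      digit v i              ∎
      where
      lenʳ : length (drop o τ) ≡ b
      lenʳ = trans (length-drop o τ) (trans (cong (_∸ o) p≡) (m+n∸m≡n o b))
    isSuffix : Suffix _≡_ v τ
    isSuffix = subst (Suffix _≡_ v) (trans (cong (take o τ ++_) (sym v≡)) (take++drop≡id o τ)) (take o τ ++ˢ here (≡⇒Pointwise-≡ refl))

  power⇒root : 0 < p → ∀ w k → 2 ≤ k → τ ≡ w ^ʷ k → PowerRoot p e (length w)
  power⇒root 0<p w k 2≤k eq = record
    { 0<d = n≢0⇒n>0 λ d≡0 → <⇒≢ 0<p (sym (trans p≡ (trans (cong (k *_) d≡0) (*-zeroʳ k))))
    ; q = k ; 2≤q = 2≤k ; p≡q*d = p≡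
    ; period = λ i lt → trans (e≡ _ lt) (trans (cong (λ τ → digit τ (i + length w)) eq)
        (trans (^ʷ-period w k i (subst (λ τ → i + length w < length τ) eq lt))
        (trans (cong (λ τ → digit τ i) (sym eq)) (sym (e≡ i (≤-<-trans (m≤m+n i _) lt)))))) }
    where
    p≡ : p ≡ k * length w
    p≡ = trans (cong length eq) (length-^ʷ w k)

  root⇒power : ∀ {d} → PowerRoot p e d → ∃₂ λ w k → 2 ≤ k × τ ≡ w ^ʷ k
  root⇒power {d} root = take d τ , q , 2≤q , periodic⇒^ʷ d (take d τ) τ q
      (trans (length-take d τ) (m≤n⇒m⊓n≡m d≤p)) p≡q*d λ a r r<d lt →
      let lt′ = subst (r + a * d <_) (sym p≡q*d) lt in begin
      digit τ (r + a * d)   ≡⟨ e≡ _ lt′ ⟨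
      e (r + a * d)         ≡⟨ period⇒* {e = e} period a r lt′ ⟩
      e r                   ≡⟨ e≡ r (≤-<-trans (m≤m+n r _) lt′) ⟩
      digit τ r             ≡⟨ digit-take d τ r<d ⟨
      digit (take d τ) r    ∎
    where
    open PowerRoot root
    open ≡-Reasoning
    d≤p : d ≤ p
    d≤p = subst (d ≤_) (sym p≡q*d) (m≤n*m d q {{>-nonZero (≤-trans (s≤s z≤n) 2≤q)}})

-- Counting left extensions

Unique-⊆⇒≤ : ∀ {A : Set} {xs ys : List A} → Unique xs → xs ⊆ ys → length xs ≤ length ys
Unique-⊆⇒≤ {xs = []}     _          _     = z≤n
Unique-⊆⇒≤ {xs = x ∷ xs} (x∉ ∷ uxs) xs⊆ys with ∈-∃++ (xs⊆ys (here refl))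
... | ys₁ , ys₂ , refl = ≤-trans (s≤s (Unique-⊆⇒≤ uxs xs⊆)) (≤-reflexive len)
  where
  len : suc (length (ys₁ ++ ys₂)) ≡ length (ys₁ ++ x ∷ ys₂)
  len = trans (cong suc (length-++ ys₁)) (trans (sym (+-suc (length ys₁) (length ys₂))) (sym (length-++ ys₁)))
  xs⊆ : xs ⊆ ys₁ ++ ys₂
  xs⊆ z∈xs with ∈-++⁻ ys₁ (xs⊆ys (there z∈xs))
  ... | inj₁ z∈           = ∈-++⁺ˡ z∈
  ... | inj₂ (there z∈)   = ∈-++⁺ʳ ys₁ z∈
  ... | inj₂ (here refl)  = ⊥-elim (All.lookup x∉ z∈xs refl)

-- `π` stands for the prefix, whose occurrence at the start has no letter before it; its extensions
-- are given by `Qπ`. Any other factor occurs at a positive position and has at least one extension,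
-- so `cQ` is at least `suc n + (cP - 1) = n + cP`.
module LeftExtensions {n l cP cQ : ℕ} {P : Vec (Fin (suc n)) l → Set} {Q : Vec (Fin (suc n)) (suc l) → Set}
  (#P : HasCardinality P cP) (#Q : HasCardinality Q cQ)
  (π : Vec (Fin (suc n)) l) (Pπ : P π) (Qπ : ∀ a → Q (a ∷ π))
  (extend : ∀ w → P w → w ≢ π → ∃ λ a → Q (a ∷ w)) (tail : ∀ a w → Q (a ∷ w) → P w) where

  open import Data.List.Membership.DecPropositional {A = Vec (Fin (suc n)) (suc l)} (Vec.≡-dec Fin._≟_) using (_∈?_)

  private
    xs : List (Vec (Fin (suc n)) l)
    xs = proj₁ #P
    ys : List (Vec (Fin (suc n)) (suc l))
    ys = proj₁ #Q
    xs-unique : Unique xs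
    xs-unique = proj₁ (proj₂ #P)
    ys-unique : Unique ys
    ys-unique = proj₁ (proj₂ #Q)
    P⇒∈ : ∀ {w} → P w → w ∈ xs
    P⇒∈ = Equivalence.from (proj₂ (proj₂ (proj₂ #P)) _)
    ∈⇒P : ∀ {w} → w ∈ xs → P w
    ∈⇒P = Equivalence.to (proj₂ (proj₂ (proj₂ #P)) _)
    Q⇒∈ : ∀ {w} → Q w → w ∈ ys
    Q⇒∈ = Equivalence.from (proj₂ (proj₂ (proj₂ #Q)) _)
    ∈⇒Q : ∀ {w} → w ∈ ys → Q w
    ∈⇒Q = Equivalence.to (proj₂ (proj₂ (proj₂ #Q)) _)

    ≢π? : ∀ w → Dec (w ≢ π)
    ≢π? w = ¬? (Vec.≡-dec Fin._≟_ w π)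

    rest : List (Vec (Fin (suc n)) l)
    rest = filter ≢π? xs

    rest-unique : Unique rest
    rest-unique = Unique.filter⁺ ≢π? xs-unique

    length-rest : cP ≡ suc (length rest)
    length-rest = trans (sym (proj₁ (proj₂ (proj₂ #P)))) (≤-antisym (Unique-⊆⇒≤ xs-unique sub) (Unique-⊆⇒≤ πrest-unique sub′))
      where
      πrest-unique : Unique (π ∷ rest)
      πrest-unique = All.tabulate (λ z∈ π≡z → proj₂ (∈-filter⁻ ≢π? {xs = xs} z∈) (sym π≡z)) ∷ rest-unique
      sub : xs ⊆ π ∷ rest
      sub {w} w∈ with Vec.≡-dec Fin._≟_ w π
      ... | yes refl = here refl
      ... | no w≢π   = there (∈-filter⁺ ≢π? w∈ w≢π)
      sub′ : π ∷ rest ⊆ xs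
      sub′ (here refl) = P⇒∈ Pπ
      sub′ (there z∈)  = proj₁ (∈-filter⁻ ≢π? z∈)

    left : Vec (Fin (suc n)) l → Fin (suc n)
    left w with Fin.any? (λ a → (a ∷ w) ∈? ys)
    ... | yes (a , _) = a
    -- A default value; `left-∈` shows that no word of `rest` gets here.
    ... | no _        = zero

    left-∈ : ∀ {w} → w ∈ rest → Q (left w ∷ w)
    left-∈ {w} w∈ with Fin.any? (λ a → (a ∷ w) ∈? ys)
    ... | yes (_ , h) = ∈⇒Q h
    ... | no none     = let (w∈xs , w≢π) = ∈-filter⁻ ≢π? {xs = xs} w∈
                            (a , q) = extend w (∈⇒P w∈xs) w≢π
                        in ⊥-elim (none (a , Q⇒∈ q))

    extensions : List (Vec (Fin (suc n)) (suc l))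
    extensions = map (_∷ π) (allFin (suc n)) ++ map (λ w → left w ∷ w) rest

    ∈-extensions⁻ : ∀ {a w} → (a ∷ w) ∈ extensions → w ≡ π ⊎ (w ∈ rest × a ≡ left w)
    ∈-extensions⁻ h with ∈-++⁻ (map (_∷ π) (allFin (suc n))) h
    ... | inj₁ h₁ with ∈-map⁻ (_∷ π) h₁
    ...   | _ , _ , refl = inj₁ refl
    ∈-extensions⁻ h | inj₂ h₂ with ∈-map⁻ (λ w → left w ∷ w) h₂
    ...   | _ , w∈ , refl = inj₂ (w∈ , refl)

    extensions-unique : Unique extensions
    extensions-unique = Unique.++⁺
      (Unique.map⁺ Vec.∷-injectiveˡ (Unique.allFin⁺ (suc n)))
      (Unique.map⁺ Vec.∷-injectiveʳ rest-unique)
      λ { (h₁ , h₂) → disjoint h₁ h₂ }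
      where
      disjoint : ∀ {v} → v ∈ map (_∷ π) (allFin (suc n)) → ¬ (v ∈ map (λ w → left w ∷ w) rest)
      disjoint h₁ h₂ with ∈-map⁻ (_∷ π) h₁ | ∈-map⁻ (λ w → left w ∷ w) h₂
      ... | _ , _ , refl | _ , w∈ , eq = proj₂ (∈-filter⁻ ≢π? {xs = xs} w∈) (sym (Vec.∷-injectiveʳ eq))

    length-extensions : length extensions ≡ suc n + length rest
    length-extensions = trans (length-++ (map (_∷ π) (allFin (suc n))))
      (cong₂ _+_ (trans (length-map (_∷ π) (allFin (suc n))) (length-tabulate (λ i → i))) (length-map _ rest))

    extensions⊆ : extensions ⊆ ys
    extensions⊆ {a ∷ w} h with ∈-extensions⁻ h
    ... | inj₁ refl        = Q⇒∈ (Qπ a)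
    ... | inj₂ (w∈ , refl) = Q⇒∈ (left-∈ w∈)

    length-ys : length ys ≡ cQ
    length-ys = proj₁ (proj₂ (proj₂ #Q))

    extensions-count : length extensions ≡ n + cP
    extensions-count = trans length-extensions (trans (sym (+-suc n (length rest))) (cong (n +_) (sym length-rest)))

  count : (∀ a a′ w → w ≢ π → Q (a ∷ w) → Q (a′ ∷ w) → a ≡ a′) → cQ ≡ n + cP
  count unique = trans (sym length-ys) (trans (≤-antisym (Unique-⊆⇒≤ ys-unique ys⊆) (Unique-⊆⇒≤ extensions-unique extensions⊆)) extensions-count)
    where
    ys⊆ : ys ⊆ extensions
    ys⊆ {a ∷ w} h with Vec.≡-dec Fin._≟_ w π
    ... | yes refl = ∈-++⁺ˡ (∈-map⁺ (_∷ π) (∈-allFin a))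
    ... | no w≢π   = ∈-++⁺ʳ (map (_∷ π) (allFin (suc n)))
      (subst (λ b → (b ∷ w) ∈ map (λ w → left w ∷ w) rest) (unique (left w) a w w≢π (left-∈ w∈) (∈⇒Q h)) (∈-map⁺ (λ w → left w ∷ w) w∈))
      where
      w∈ : w ∈ rest
      w∈ = ∈-filter⁺ ≢π? (P⇒∈ (tail a w (∈⇒Q h))) w≢π

  private
    count-new : ∀ b w → w ≢ π → Q (b ∷ w) → b ≢ left w → n + cP < cQ
    count-new b w w≢π qb b≢ = subst₂ _<_ extensions-count length-ys (Unique-⊆⇒≤ (All.tabulate new ∷ extensions-unique) sub)
      where
      new : ∀ {v} → v ∈ extensions → b ∷ w ≢ v
      new {.b ∷ .w} v∈ refl with ∈-extensions⁻ v∈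
      ... | inj₁ w≡π       = w≢π w≡π
      ... | inj₂ (_ , b≡)  = b≢ b≡
      sub : (b ∷ w) ∷ extensions ⊆ ys
      sub (here refl) = Q⇒∈ qb
      sub (there v∈)  = extensions⊆ v∈

  -- At most one of two different left letters of `w` is the one already counted in `extensions`.
  count< : ∀ a a′ w → w ≢ π → Q (a ∷ w) → Q (a′ ∷ w) → a ≢ a′ → n + cP < cQ
  count< a a′ w w≢π q q′ a≢a′ with a Fin.≟ left w
  ... | no a≢  = count-new a w w≢π q a≢
  ... | yes a≡ = count-new a′ w w≢π q′ λ a′≡ → a≢a′ (trans a≡ (sym a′≡))

-- The fixed point

lookup-digit : ∀ {n} (t : Vec ℕ n) i → Vec.lookup t i ≡ digit (toList t) (toℕ i)
lookup-digit (x ∷ t) zero    = refl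
lookup-digit (x ∷ t) (suc i) = lookup-digit t i

toList≡init∷ʳlast : ∀ {n} (t : Vec ℕ (suc n)) → toList t ≡ toList (init t) ∷ʳ last t
toList≡init∷ʳlast t = trans (cong toList (proj₂ (proj₂ (Vec.initLast t)))) (Vec.toList-∷ʳ (last t) (init t))

++-injectiveˡ : ∀ (v w : List ℕ) {x y} → length v ≡ length w → v ++ x ≡ w ++ y → v ≡ w
++-injectiveˡ []      []      _  _  = refl
++-injectiveˡ (a ∷ v) (b ∷ w) ln eq = cong₂ _∷_ (∷-injectiveˡ eq) (++-injectiveˡ v w (suc-injective ln) (∷-injectiveʳ eq))

module Exponents {n : ℕ} (t : Vec ℕ (suc n)) where

  τ : List ℕ
  τ = toList (init t)

  length-τ : length τ ≡ n
  length-τ = Vec.length-toList (init t)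

  e : ℕ → ℕ
  e = digit (τ ∷ʳ pred (last t))

  e-τ : ∀ i → i < length τ → e i ≡ digit τ i
  e-τ i i<l = digit-++ˡ τ _ i<l

  e-digit : ∀ {i} → i < n → e i ≡ digit (toList t) i
  e-digit {i} i<n = trans (digit-++ˡ τ _ i<l) (sym (trans (cong (λ w → digit w i) (toList≡init∷ʳlast t)) (digit-++ˡ τ _ i<l)))
    where
    i<l : i < length τ
    i<l = subst (i <_) (sym length-τ) i<n

  e-last : e n ≡ pred (last t)
  e-last = trans (cong e (trans (sym length-τ) (sym (+-identityʳ (length τ))))) (digit-++ʳ τ (pred (last t) ∷ []) 0)

module FixedPoint {n : ℕ} (t : Vec ℕ (suc n)) (0<n : 0 < n) (0<t₁ : 0 < digit (toList t) 0) (0<last : 0 < last t)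
  (u : ℕ → Fin (suc n)) (fixed : IsFixedPointWord t u) where

  open Exponents t public

  0<e₀ : 0 < e 0
  0<e₀ = subst (0 <_) (sym (e-digit 0<n)) 0<t₁

  open LeftSpecial n e 0<n 0<e₀ public

  φ-ψ : ∀ k → map toℕ (φ t k) ≡ ψ (toℕ k)
  φ-ψ k with view k
  ... | ‵inject₁ j = begin
    map toℕ (List.replicate (Vec.lookup t (inject₁ j)) zero ++ [ suc j ])
      ≡⟨ map-++ toℕ (List.replicate (Vec.lookup t (inject₁ j)) zero) [ suc j ] ⟩
    map toℕ (List.replicate (Vec.lookup t (inject₁ j)) zero) ∷ʳ suc (toℕ j)
      ≡⟨ cong (_∷ʳ suc (toℕ j)) (map-replicate toℕ (Vec.lookup t (inject₁ j)) zero) ⟩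
    𝟘 (Vec.lookup t (inject₁ j)) ∷ʳ suc (toℕ j)
      ≡⟨ cong₂ (λ r b → 𝟘 r ∷ʳ b) (trans (lookup-digit t (inject₁ j)) (sym (e-digit j<n)))
               (trans (cong suc (sym (Fin.toℕ-inject₁ j))) (sym (σ-≢p (<⇒≢ j<n)))) ⟩
    𝟘 (e (toℕ (inject₁ j))) ∷ʳ σ (toℕ (inject₁ j)) ∎
    where
    open ≡-Reasoning
    j<n : toℕ (inject₁ j) < n
    j<n = subst (_< n) (sym (Fin.toℕ-inject₁ j)) (Fin.toℕ<n j)
  ... | ‵fromℕ = begin
    map toℕ (List.replicate (last t) zero)         ≡⟨ map-replicate toℕ (last t) zero ⟩
    𝟘 (last t)                                     ≡⟨ cong 𝟘 (suc-pred (last t) {{>-nonZero 0<last}}) ⟨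
    𝟘 (suc (pred (last t)))                        ≡⟨ 𝟘-∷ʳ (pred (last t)) ⟩
    𝟘 (pred (last t)) ∷ʳ 0                         ≡⟨ cong₂ (λ r b → 𝟘 r ∷ʳ b) e-last σ-p ⟨
    𝟘 (e n) ∷ʳ σ n                                 ≡⟨ cong (λ k → 𝟘 (e k) ∷ʳ σ k) (Fin.toℕ-fromℕ n) ⟨
    𝟘 (e (toℕ (fromℕ n))) ∷ʳ σ (toℕ (fromℕ n))     ∎
    where open ≡-Reasoning

  φ^-iter : ∀ k → map toℕ (φ^ k [0] t) ≡ iter k
  φ^-iter zero    = refl
  φ^-iter (suc k) = begin
    map toℕ (concatMap (φ t) w)           ≡⟨ map-concatMap toℕ (φ t) w ⟩
    concatMap (λ a → map toℕ (φ t a)) w   ≡⟨ concatMap-cong φ-ψ w ⟩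
    concatMap (λ a → ψ (toℕ a)) w         ≡⟨ concatMap-map ψ toℕ w ⟨
    Φ (map toℕ w)                         ≡⟨ cong Φ (φ^-iter k) ⟩
    Φ (iter k)                            ∎
    where
    open ≡-Reasoning
    w : List (Fin (suc n))
    w = φ^ k [0] t

  -- The list counterpart of `window`, recursive so that it splits along concatenations.
  segment : ℕ → ℕ → List ℕ
  segment i zero    = []
  segment i (suc l) = toℕ (u i) ∷ segment (suc i) l

  length-segment : ∀ i l → length (segment i l) ≡ l
  length-segment i zero    = refl
  length-segment i (suc l) = cong suc (length-segment (suc i) l)

  segment-++ : ∀ i l m → segment i (l + m) ≡ segment i l ++ segment (i + l) m
  segment-++ i zero    m = cong (λ j → segment j m) (sym (+-identityʳ i))
  segment-++ i (suc l) m = cong (toℕ (u i) ∷_) (trans (segment-++ (suc i) l m) (cong (λ j → segment (suc i) l ++ segment j m) (sym (+-suc i l))))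

  segment-∷ʳ : ∀ l → segment 0 (suc l) ≡ segment 0 l ∷ʳ toℕ (u l)
  segment-∷ʳ l = trans (cong (segment 0) (+-comm 1 l)) (segment-++ 0 l 1)

  private
    next-letter : ∀ (v : List ℕ) {w b} → head (drop (length v) (v ++ w)) ≡ just b → ∃ λ w′ → w ≡ b ∷ w′
    next-letter []      {x ∷ w} refl = w , refl
    next-letter (_ ∷ v) eq           = next-letter v eq

    head-map : ∀ (w : List (Fin (suc n))) → head (map toℕ w) ≡ Maybe.map toℕ (head w)
    head-map []      = refl
    head-map (_ ∷ _) = refl

    iter-letter : ∀ i k → proj₁ (fixed i) ≤ k → head (drop i (iter k)) ≡ just (toℕ (u i))
    iter-letter i k N≤k = begin
      head (drop i (iter k))                  ≡⟨ cong (λ w → head (drop i w)) (φ^-iter k) ⟨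
      head (drop i (map toℕ (φ^ k [0] t)))    ≡⟨ cong head (drop-map i (φ^ k [0] t)) ⟩
      head (map toℕ (drop i (φ^ k [0] t)))    ≡⟨ head-map (drop i (φ^ k [0] t)) ⟩
      Maybe.map toℕ (head (drop i (φ^ k [0] t)))  ≡⟨ cong (Maybe.map toℕ) (proj₂ (fixed i) k N≤k) ⟩
      just (toℕ (u i))                        ∎
      where open ≡-Reasoning

  Pre-segment : ∀ l → Pre (segment 0 l)
  Pre-segment zero    = pre 0 [ 0 ] refl
  Pre-segment (suc l) = subst Pre (sym (segment-∷ʳ l)) (from (Pre-segment l))
    where
    N : ℕ
    N = proj₁ (fixed l)
    from : Pre (segment 0 l) → Pre (segment 0 l ∷ʳ toℕ (u l))
    from (pre k y eq) with iter-mono (m≤m⊔n k N)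
    ... | r , eq′ with next-letter (segment 0 l) {y ++ r} {toℕ (u l)} (begin
        head (drop (length (segment 0 l)) (segment 0 l ++ y ++ r))
          ≡⟨ cong₂ (λ i w → head (drop i w)) (length-segment 0 l) (sym level) ⟩
        head (drop l (iter (k ⊔ N)))
          ≡⟨ iter-letter l (k ⊔ N) (m≤n⊔m k N) ⟩
        just (toℕ (u l)) ∎)
      where
      open ≡-Reasoning
      level : iter (k ⊔ N) ≡ segment 0 l ++ y ++ r
      level = trans eq′ (trans (cong (_++ r) eq) (++-assoc (segment 0 l) y r))
    ... | w , y≡ = pre (k ⊔ N) w (trans eq′ (trans (cong (_++ r) eq) (trans (++-assoc (segment 0 l) y r)
                     (trans (cong (segment 0 l ++_) y≡) (sym (++-assoc (segment 0 l) [ toℕ (u l) ] w))))))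

  Pre⇒segment : ∀ {w} → Pre w → w ≡ segment 0 (length w)
  Pre⇒segment {w} (pre k y eq) = from (Pre-segment (length w))
    where
    from : Pre (segment 0 (length w)) → w ≡ segment 0 (length w)
    from (pre l z eq′) with iter-mono (m≤m⊔n k l) | iter-mono (m≤n⊔m k l)
    ... | r , h | r′ , h′ = ++-injectiveˡ w _ (sym (length-segment 0 (length w)))
      (trans (sym (++-assoc w y r)) (trans (cong (_++ r) (sym eq)) (trans (sym h) (trans h′ (trans (cong (_++ r′) eq′) (++-assoc (segment 0 (length w)) z r′))))))

  Factor⇒segment : ∀ {w} → Factor w → ∃ λ i → w ≡ segment i (length w)
  Factor⇒segment {w} (k , fac x y eq) = length x , ++-cancelˡ x _ _ (begin
    x ++ w                                             ≡⟨ x++w≡ ⟩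
    segment 0 (length x) ++ segment (length x) (length w) ≡⟨ cong (_++ segment (length x) (length w)) x≡ ⟨
    x ++ segment (length x) (length w)                 ∎)
    where
    open ≡-Reasoning
    x++w≡ : x ++ w ≡ segment 0 (length x) ++ segment (length x) (length w)
    x++w≡ = trans (Pre⇒segment (pre k y (trans eq (sym (++-assoc x w y)))))
      (trans (cong (segment 0) (length-++ x)) (segment-++ 0 (length x) (length w)))
    x≡ : x ≡ segment 0 (length x)
    x≡ = ++-injectiveˡ x _ (sym (length-segment 0 (length x))) x++w≡

  segment⇒Factor : ∀ i l → Factor (segment i l)
  segment⇒Factor i l = let (k , f) = Pre⇒Factor (Pre-segment (i + l)) in
    k , Fac-suffix (segment 0 i) (segment i l) (subst (Fac k) (segment-++ 0 i l) f)

  word : ∀ {l} → Vec (Fin (suc n)) l → List ℕ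
  word w = map toℕ (toList w)

  length-word : ∀ {l} (w : Vec (Fin (suc n)) l) → length (word w) ≡ l
  length-word w = trans (length-map toℕ (toList w)) (Vec.length-toList w)

  word-injective : ∀ {l} {v w : Vec (Fin (suc n)) l} → word v ≡ word w → v ≡ w
  word-injective {v = []}    {[]}    _  = refl
  word-injective {v = a ∷ v} {b ∷ w} eq = cong₂ _∷_ (Fin.toℕ-injective (∷-injectiveˡ eq)) (word-injective (∷-injectiveʳ eq))

  window : ℕ → ∀ l → Vec (Fin (suc n)) l
  window i l = tabulate {n = l} (λ j → u (i + toℕ j))

  window-suc : ∀ i l → window i (suc l) ≡ u i ∷ window (suc i) l
  window-suc i l = cong₂ _∷_ (cong u (+-identityʳ i)) (Vec.tabulate-cong λ j → cong u (+-suc i (toℕ j)))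

  word-window : ∀ i l → word (window i l) ≡ segment i l
  word-window i zero    = refl
  word-window i (suc l) = trans (cong word (window-suc i l)) (cong (toℕ (u i) ∷_) (word-window (suc i) l))

  IsFactor⇒Factor : ∀ {l} {w : Vec (Fin (suc n)) l} → IsFactor u w → Factor (word w)
  IsFactor⇒Factor {l} (i , refl) = subst Factor (sym (word-window i l)) (segment⇒Factor i l)

  Factor⇒IsFactor : ∀ {l} {w : Vec (Fin (suc n)) l} → Factor (word w) → IsFactor u w
  Factor⇒IsFactor {l} {w} f with Factor⇒segment f
  ... | i , eq = i , word-injective (trans eq (trans (cong (segment i) (length-word w)) (sym (word-window i l))))

  Pre⇒window : ∀ {l} {w : Vec (Fin (suc n)) l} → Pre (word w) → w ≡ window 0 l
  Pre⇒window {l} {w} h = word-injective (trans (Pre⇒segment h) (trans (cong (segment 0) (length-word w)) (sym (word-window 0 l))))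

  Pre-window : ∀ l → Pre (word (window 0 l))
  Pre-window l = subst Pre (sym (word-window 0 l)) (Pre-segment l)

  letter≤n : ∀ (a : Fin (suc n)) → toℕ a ≤ n
  letter≤n a = s≤s⁻¹ (Fin.toℕ<n a)

  Factor⇒word : ∀ {w} → Factor w → ∃ λ (v : Vec (Fin (suc n)) (length w)) → word v ≡ w
  Factor⇒word {w} f with Factor⇒segment f
  ... | i , eq = window i (length w) , trans (word-window i (length w)) (sym eq)

  module Complexity (C : ℕ → ℕ) (complexity : IsFactorComplexity u C) where

    private
      extend : ∀ {l} w → IsFactor u w → w ≢ window 0 l → ∃ λ a → IsFactor u (a ∷ w)
      extend     w (zero  , w≡) w≢π = ⊥-elim (w≢π w≡)
      extend {l} w (suc i , w≡) _   = u i , i , trans (cong (u i ∷_) w≡) (sym (window-suc i l))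

      tail : ∀ {l} a (w : Vec (Fin (suc n)) l) → IsFactor u (a ∷ w) → IsFactor u w
      tail {l} a w (i , eq) = suc i , Vec.∷-injectiveʳ (trans eq (window-suc i l))

      leftExtension : ∀ {l} a → IsFactor u (a ∷ window 0 l)
      leftExtension {l} a = Factor⇒IsFactor (Pre-leftExtension (letter≤n a) (Pre-window l))

      module At (l : ℕ) =
        LeftExtensions {n} {l} (complexity l) (complexity (suc l)) (window 0 l) (0 , refl) leftExtension extend tail

    growth : (∀ w a a′ → a ≢ a′ → Factor (a ∷ w) → Factor (a′ ∷ w) → Pre w) → ∀ l → C (suc l) ≡ n + C l
    growth leftSpecial⇒Pre l = At.count l unique
      where
      unique : ∀ a a′ w → w ≢ window 0 l → IsFactor u (a ∷ w) → IsFactor u (a′ ∷ w) → a ≡ a′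
      unique a a′ w w≢π q q′ with a Fin.≟ a′
      ... | yes a≡a′ = a≡a′
      ... | no a≢a′  = ⊥-elim (w≢π (Pre⇒window (leftSpecial⇒Pre (word w) (toℕ a) (toℕ a′)
                         (λ eq → a≢a′ (Fin.toℕ-injective eq)) (IsFactor⇒Factor q) (IsFactor⇒Factor q′))))

    -- The only word of length 0 is itself a prefix, so the count is exact whatever the left special
    -- factors are. This fixes `n` as the slope of an affine complexity.
    growth₀ : C 1 ≡ n + C 0
    growth₀ = At.count 0 λ { _ _ [] w≢π → ⊥-elim (w≢π refl) }

    growth> : NonPrefixLeftSpecial → ∃ λ l → n + C l < C (suc l)
    growth> (w , a , a′ , a≢a′ , f , f′ , ¬pre) with Factor⇒word f | Factor⇒word f′
    ... | v@(b ∷ x) , eq | v′@(b′ ∷ x′) , eq′ = length w , At.count< (length w) b b′ x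
      (λ x≡π → ¬pre (subst Pre (trans (cong word (sym x≡π)) (∷-injectiveʳ eq)) (Pre-window (length w))))
      (Factor⇒IsFactor (subst Factor (sym eq) f))
      (Factor⇒IsFactor (subst Factor (sym (trans (cong (toℕ b′ ∷_) (trans (∷-injectiveʳ eq) (sym (∷-injectiveʳ eq′)))) eq′)) f′))
      (λ b≡b′ → a≢a′ (trans (sym (∷-injectiveˡ eq)) (trans (cong toℕ b≡b′) (∷-injectiveˡ eq′))))

-- Affine functions and the proof of the equivalence

affine⇒constantGrowth : ∀ {C n} → IsAffine C → C 1 ≡ n + C 0 → ∀ l → C (suc l) ≡ n + C l
affine⇒constantGrowth {C} {n} (a , b , affine) C₁≡ l = +-cancelʳ-≡ (C 0) _ _ (begin
  C (suc l) + C 0      ≡⟨ ℤ.+-injective (step (affine (suc l)) (affine l) (affine 1) (affine 0)) ⟩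
  C l + C 1            ≡⟨ cong (C l +_) C₁≡ ⟩
  C l + (n + C 0)      ≡⟨ +-assoc (C l) n (C 0) ⟨
  C l + n + C 0        ≡⟨ cong (_+ C 0) (+-comm (C l) n) ⟩
  n + C l + C 0        ∎)
  where
  open ≡-Reasoning
  -- Written as `C (l + 1) + C 0 = C l + C 1`, affinity eliminates `a` and `b` and can be read back
  -- in ℕ without subtraction.
  ring : ∀ a b l → a ℤ.* (ℤ.1ℤ ℤ.+ l) ℤ.+ b ℤ.+ (a ℤ.* ℤ.0ℤ ℤ.+ b) ≡ a ℤ.* l ℤ.+ b ℤ.+ (a ℤ.* ℤ.1ℤ ℤ.+ b)
  ring = ℤ-Solver.solve-∀
  step : ℤ.+ C (suc l) ≡ a ℤ.* ℤ.+ suc l ℤ.+ b → ℤ.+ C l ≡ a ℤ.* ℤ.+ l ℤ.+ b →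
         ℤ.+ C 1 ≡ a ℤ.* ℤ.+ 1 ℤ.+ b → ℤ.+ C 0 ≡ a ℤ.* ℤ.+ 0 ℤ.+ b →
         ℤ.+ (C (suc l) + C 0) ≡ ℤ.+ (C l + C 1)
  step h₁ h₂ h₃ h₄ = trans (cong₂ ℤ._+_ h₁ h₄) (trans (ring a b (ℤ.+ l)) (sym (cong₂ ℤ._+_ h₂ h₃)))

constantGrowth⇒affine : ∀ {C n} → (∀ l → C (suc l) ≡ n + C l) → IsAffine C
constantGrowth⇒affine {C} {n} growth = ℤ.+ n , ℤ.+ C 0 , λ l → trans (cong ℤ.+_ (closed l)) (cong (ℤ._+ ℤ.+ C 0) (ℤ.pos-* n l))
  where
  open ≡-Reasoning
  closed : ∀ l → C l ≡ n * l + C 0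
  closed zero    = cong (_+ C 0) (sym (*-zeroʳ n))
  closed (suc l) = begin
    C (suc l)             ≡⟨ growth l ⟩
    n + C l               ≡⟨ cong (n +_) (closed l) ⟩
    n + (n * l + C 0)     ≡⟨ +-assoc n (n * l) (C 0) ⟨
    n + n * l + C 0       ≡⟨ cong (_+ C 0) (*-suc n l) ⟨
    n * suc l + C 0       ∎

PowerOrUnbordered : List ℕ → Set
PowerOrUnbordered τ = (∃₂ λ (w : List ℕ) (k : ℕ) → 2 ≤ k × τ ≡ w ^ʷ k) ⊎ ¬ (∃ λ v → BorderWord τ v)

theorem1 : (β : ℝ) → fromℕᴿ 1 <ᴿ β →
    (n : ℕ) → 2 ≤ suc n →
    (t : Vec ℕ (suc n)) → IsRényiExpansion β t →
    (u : ℕ → Fin (suc n)) → IsFixedPointWord t u →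
    (C : ℕ → ℕ) → IsFactorComplexity u C →
    IsAffine C ⇔
    (last t ≡ 1 ×
    ((∃₂ λ (w : List ℕ) (k : ℕ) → 2 ≤ k × toList (init t) ≡ w ^ʷ k)
    ⊎ ¬ (∃ λ (v : List ℕ) →
    v ≢ [] × ProperPrefix v (toList (init t)) × ProperSuffix v (toList (init t)))))
theorem1 β 1<β n 2≤m t rényi u fixed C complexity = mk⇔ necessary sufficient
  where
  0<n : 0 < n
  0<n = s≤s⁻¹ 2≤m

  open FixedPoint t 0<n (firstDigit>0 β 1<β t rényi) (IsRényiExpansion.lastPos rényi) u fixed
  open Complexity C complexity

  parryₑ : Parry n e
  parryₑ o k 0<o m o+k<n = subst₂ _≤_ (sym (e-digit o+k<n)) (sym (e-digit k<n))
    (parry β 1<β t rényi o k 0<o λ i i<k →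
      trans (sym (e-digit (<-trans (+-monoʳ-< o i<k) o+k<n))) (trans (m i i<k) (e-digit (<-trans i<k k<n))))
    where
    k<n : k < n
    k<n = ≤-<-trans (m≤n+m k o) o+k<n

  necessary : IsAffine C → last t ≡ 1 × PowerOrUnbordered τ
  necessary affine = lastOne , condition (classify n e 0<n)
    where
    noLeftSpecial : ¬ NonPrefixLeftSpecial
    noLeftSpecial ls = let (l , lt) = growth> ls in <⇒≢ lt (sym (affine⇒constantGrowth affine growth₀ l))

    lastOne : last t ≡ 1
    lastOne with last t ≟ 1
    ... | yes eq = eq
    ... | no ≢1  = ⊥-elim (noLeftSpecial (nonPrefixLeftSpecial-run (subst (0 <_) (sym e-last) (<⇒≤pred 1<last))))
      where
      1<last : 1 < last t
      1<last = ≤∧≢⇒< (IsRényiExpansion.lastPos rényi) λ eq → ≢1 (sym eq)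

    condition : (∀ b → ¬ Border n e b) ⊎ (∃ λ d → PowerRoot n e d) ⊎ (∃ λ d → AperiodicBorder n e d) →
                PowerOrUnbordered τ
    condition (inj₁ none) = inj₂ λ { (v , bordered) →
      none (length v) (subst (λ p → Border p e (length v)) length-τ (borderWord⇒border τ e e-τ v bordered)) }
    condition (inj₂ (inj₁ (d , root))) =
      inj₁ (root⇒power τ e e-τ (subst (λ p → PowerRoot p e d) (sym length-τ) root))
    condition (inj₂ (inj₂ (d , aperiodic))) = ⊥-elim (noLeftSpecial
      (NonAffine.nonPrefixLeftSpecial-border n e 0<n 0<e₀ (trans e-last (cong pred lastOne)) parryₑ d aperiodic))

  sufficient : last t ≡ 1 × PowerOrUnbordered τ → IsAffine C
  -- The induction runs over one level, so the two occurrences are first lifted to the common level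
  -- `k ⊔ k′`.
  sufficient (last≡1 , condition) = constantGrowth⇒affine (growth λ w a a′ a≢a′ (k , f) (k′ , f′) →
    leftSpecial⇒Pre (k ⊔ k′) w a a′ a≢a′ (Fac-mono (m≤m⊔n k k′) f) (Fac-mono (m≤n⊔m k k′) f′))
    where
    rootOf : PowerOrUnbordered τ → ∃ λ d → UnborderedRoot n e d
    rootOf (inj₁ (w , k , 2≤k , eq)) = unborderedRoot n e parryₑ (length w)
      (subst (λ p → PowerRoot p e (length w)) length-τ (power⇒root τ e e-τ (subst (0 <_) (sym length-τ) 0<n) w k 2≤k eq))
    rootOf (inj₂ unbordered) = n , unbordered⇒root n e 0<n λ b border →
      unbordered (border⇒borderWord τ e e-τ b (subst (λ p → Border p e b) (sym length-τ) border))

    open Affine n e 0<n 0<e₀ (trans e-last (cong pred last≡1)) parryₑ (proj₁ (rootOf condition)) (proj₂ (rootOf condition))
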